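{- Let $P$ be a tree poset of height $k$. Then, as $n\to\infty$, the number of $P$-free set systems $\mathcal{F}\subseteq 2^{[n]}$ is $$2^{(1+o(1))(k-1)\binom{n}{\lfloor n/2\rfloor}}.$$
   Context: All posets are finite. A poset $Q$ contains a poset $P$ if there is an injective map $\pi:P\to Q$ with $\pi(A)\le \pi(B)$ whenever $A\le B$; otherwise $Q$ is $P$-free. A set system $\mathcal{F}\subseteq 2^{[n]}$ is regarded as a poset ordered by inclusion. The Hasse diagram of $P$ is the graph on $P$ with an edge between $x$ and $y$ whenever one covers the other ($x$ covers $z$ if $x>z$ and there is no $y$ with $x>y>z$). $P$ is a tree poset if its Hasse diagram is a tree. The height of $P$ is the number of elements in a longest chain of $P$. -}

module Defs where

open import Level using (0ℓ)
open import Data.Nat using (ℕ; zero; suc; _≤_; _/_)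
open import Data.Nat.Combinatorics using (_C_)
open import Data.Fin using (Fin)
open import Data.Fin.Subset using (Subset; _⊆_)
open import Data.Bool using (Bool; true)
open import Data.List using (List; []; _∷_; _++_; [_]; length)
open import Data.List.Relation.Unary.Unique.Propositional using (Unique)
open import Data.List.Relation.Unary.AllPairs using (AllPairs)
open import Data.List.Relation.Unary.Linked using (Linked)
open import Data.Product using (Σ; ∃; _×_; _,_)
open import Data.Sum using (_⊎_)
open import Relation.Nullary using (¬_)
open import Relation.Binary.PropositionalEquality using (_≡_; _≢_)
open import Relation.Binary.Structures using (IsPartialOrder)
open import Relation.Binary.Construct.Closure.ReflexiveTransitive using (Star)

record FinPoset : Set₁ where
  field
    size  : ℕ
    _≤P_  : Fin size → Fin size → Set
    isPO  : IsPartialOrder _≡_ _≤P_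

module _ (P : FinPoset) where
  open FinPoset P

  _<P_ : Fin size → Fin size → Set
  x <P y = x ≤P y × x ≢ y

  Covers : Fin size → Fin size → Set
  Covers y x = x <P y × ¬ (∃ λ z → x <P z × z <P y)

  HasseAdj : Fin size → Fin size → Set
  HasseAdj x y = Covers x y ⊎ Covers y x

  HasseConnected : Set
  HasseConnected = ∀ x y → Star HasseAdj x y

  HasseCycle : Set
  HasseCycle = Σ (Fin size) λ x → Σ (List (Fin size)) λ ys →
    (2 ≤ length ys) × Unique (x ∷ ys) × Linked HasseAdj (x ∷ ys ++ [ x ])

  IsTreePoset : Set
  IsTreePoset = (1 ≤ size) × HasseConnected × ¬ HasseCycle

  Comparable : Fin size → Fin size → Set
  Comparable x y = x ≤P y ⊎ y ≤P x

  IsChain : List (Fin size) → Set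
  IsChain xs = Unique xs × AllPairs Comparable xs

  HasHeight : ℕ → Set
  HasHeight k = (∃ λ xs → IsChain xs × length xs ≡ k)
              × (∀ xs → IsChain xs → length xs ≤ k)

Family : ℕ → Set
Family n = Subset n → Bool

_≈F_ : ∀ {n} → Family n → Family n → Set
F ≈F G = ∀ X → F X ≡ G X

Contains : ∀ {n} → FinPoset → Family n → Set
Contains {n} P F = Σ (Fin size → Subset n) λ π →
    (∀ x y → π x ≡ π y → x ≡ y)
  × (∀ x → F (π x) ≡ true)
  × (∀ x y → x ≤P y → π x ⊆ π y)
  where open FinPoset P

PFreeFamily : FinPoset → ℕ → Set
PFreeFamily P n = Σ (Family n) λ F → ¬ Contains P F

HasCard : (A : Set) → (A → A → Set) → ℕ → Set
HasCard A _≈_ N = Σ (Fin N → A) λ e →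
  (∀ i j → e i ≈ e j → i ≡ j) × (∀ a → ∃ λ i → e i ≈ a)

_≈PF_ : ∀ {P n} → PFreeFamily P n → PFreeFamily P n → Set
(F , _) ≈PF (G , _) = F ≈F G

centralBinom : ℕ → ℕ
centralBinom n = n C (n / 2)

{-# OPTIONS --safe #-}

-- Let C = C(n,⌊n/2⌋). Since P contains a chain of k elements, every family within k - 1 layers next to the
-- middle is P-free, and these layers have (1 - o(1))(k - 1)C members.
--
-- For the upper bound let p = |P| and consider the states (A , i) with A ∈ F and i < k, where (B , i+1) is
-- an upper neighbour of (A , i) if A ⊂ B. Repeatedly remove a state with i < k - 1 that has fewer than p upper
-- neighbours left, or one with i > 0 that has fewer than p lower neighbours left. If this gets stuck, then
-- the tree P, levelled by longest chains, embeds greedily into what remains. Hence for P-free F every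
-- state is removed, (A , 0) for lack of upper and (A , k-1) for lack of lower neighbours, and some i has
-- (A , i) removed for the former and (A , i+1) for the latter reason. Colour A by such an i. If A ⊂ B have the same
-- colour i, the first of (A , i) and (B , i+1) to be removed sees the other among its fewer than p neighbours,
-- so the comparability graph of a colour class has bounded average degree.
--
-- It remains to see that there are only 2^((1+o(1))C) families of bounded average degree. A set of
-- vertices in which all comparability degrees are o(n) has at most (1 + o(1))C members, by the LYM argument with
-- a Bonferroni correction for comparable pairs. While the degree is large somewhere, branch on whether a vertex u
-- of large degree belongs to the family; if it does, all neighbours of u receive a hit. A vertex
-- with r hits can belong to the family only rarely, since hits inside the family count its edges, and a potential
-- that decreases with every hit bounds the number of branchings.

module Submission where

open import Defs
open import Data.Nat using (ℕ; zero; suc; pred; _≤_; _<_; z≤n; s≤s; z<s; _*_; _∸_; _^_; _+_; _/_; _%_; _!; >-nonZero; ≢-nonZero; _≤?_; _<?_)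
open import Data.Nat.Properties
open import Data.Nat.DivMod using (m≡m%n+[m/n]*n; m/n*n≡m; m%n<n; m/n*n≤m; /-mono-≤; m*n/n≡m)
open import Data.Nat.Combinatorics using (_C_; nCk+nC[k+1]≡[n+1]C[k+1]; nC1≡n; k![n∸k]!∣n!)
open import Data.Nat.Combinatorics.Specification using (nCk≡n!/k![n-k]!; k>n⇒nCk≡0)
open import Data.Nat.Tactic.RingSolver using (solve-∀)
open import Data.Bool using (Bool; true; false; _∧_; _∨_; if_then_else_)
import Data.Bool.Properties as Boolₚ
open import Data.Fin as Fin using (Fin; zero; suc)
import Data.Fin.Properties as Finₚ
open import Data.Fin.Subset as S using (Subset; _⊆_; _⊂_; ∣_∣; inside; outside)
open import Data.Fin.Subset.Properties as Sₚ using (_⊂?_; _⊆?_; ⊆-refl; ⊆-trans; ⊂-trans; ⊂-irref; ⊂-asymmetric; p⊆q⇒∣p∣≤∣q∣; p⊂q⇒∣p∣<∣q∣)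
open import Data.Vec as Vec using (Vec; []; _∷_)
import Data.Vec.Properties as Vecₚ
open import Data.List using (List; []; _∷_; _++_; length; map; filter; upTo; cartesianProductWith; cartesianProduct; lookup)
open import Data.List.Properties using (length-++; length-map; length-upTo; length-tabulate)
open import Data.List.Relation.Unary.Any as Any using (Any; here; there; any?)
import Data.List.Relation.Unary.Any.Properties as Anyₚ
open import Data.List.Relation.Unary.All as All using (All; []; _∷_)
open import Data.List.Relation.Unary.AllPairs as AllPairs using ([]; _∷_)
open import Data.List.Relation.Unary.Linked using (Linked; []; [-]; _∷_)
open import Data.List.Relation.Unary.Unique.Propositional using (Unique)
import Data.List.Relation.Unary.AllPairs.Properties as AllPairsₚ
import Data.List.Relation.Unary.Unique.Propositional.Properties as Uniqueₚ
open import Data.List.Membership.Propositional using (_∈_; _∉_; find; lose)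
open import Data.List.Membership.Propositional.Properties
open import Data.List.Relation.Binary.Permutation.Propositional using (_↭_; ↭-sym; ↭-refl; ↭-trans; prep; swap; ↭⇒↭ₛ)
open import Data.List.Relation.Binary.Permutation.Propositional.Properties using (∈-resp-↭; ↭-length; shift; filter-↭)
import Data.List.Relation.Binary.Permutation.Setoid.Properties as ↭ₛ
open import Data.Product using (Σ; ∃; ∃₂; _×_; _,_; proj₁; proj₂)
import Data.Product.Properties as ×ₚ
open import Data.Sum using (_⊎_; inj₁; inj₂)
open import Function using (_∘_; id; case_of_)
open import Relation.Nullary using (¬_; Dec; yes; no; does; contradiction)
open import Relation.Nullary.Decidable using (decidable-stable; ¬?; _×-dec_)
open import Relation.Binary.Definitions using (DecidableEquality)
import Relation.Binary.Definitions as B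
open import Relation.Binary.PropositionalEquality using (_≡_; _≢_; refl; sym; trans; cong; cong₂; subst; subst₂; setoid; module ≡-Reasoning)
open import Relation.Binary.Structures using (IsPartialOrder)
open import Relation.Binary.Construct.Closure.ReflexiveTransitive using (Star; ε; _◅_)

-- Sums over lists, and duplicate-free lists

ind : Bool → ℕ
ind true  = 1
ind false = 0

ind≤1 : ∀ b → ind b ≤ 1
ind≤1 true  = s≤s z≤n
ind≤1 false = z≤n

module _ {P : Set} where
  ind-yes : (d : Dec P) → P → ind (does d) ≡ 1
  ind-yes (yes _) _ = refl
  ind-yes (no ¬p) p = contradiction p ¬p

  ind-no : (d : Dec P) → ¬ P → ind (does d) ≡ 0
  ind-no (yes p) ¬p = contradiction p ¬p
  ind-no (no _)  _  = refl

module _ {A : Set} where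

  ∑ : List A → (A → ℕ) → ℕ
  ∑ []       f = 0
  ∑ (x ∷ xs) f = f x + ∑ xs f

  ∑-↭ : ∀ {xs ys} (f : A → ℕ) → xs ↭ ys → ∑ xs f ≡ ∑ ys f
  ∑-↭ f _↭_.refl = refl
  ∑-↭ f (prep x p) = cong (f x +_) (∑-↭ f p)
  ∑-↭ f (swap {xs} {ys} x y p) = begin
    f x + (f y + ∑ xs f)  ≡⟨ cong (λ z → f x + (f y + z)) (∑-↭ f p) ⟩
    f x + (f y + ∑ ys f)  ≡⟨ +-assoc (f x) (f y) _ ⟨
    f x + f y + ∑ ys f    ≡⟨ cong (_+ ∑ ys f) (+-comm (f x) (f y)) ⟩
    f y + f x + ∑ ys f    ≡⟨ +-assoc (f y) (f x) _ ⟩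
    f y + (f x + ∑ ys f)  ∎
    where open ≡-Reasoning
  ∑-↭ f (_↭_.trans p q) = trans (∑-↭ f p) (∑-↭ f q)

  ∑-mono : ∀ xs {f g : A → ℕ} → (∀ x → x ∈ xs → f x ≤ g x) → ∑ xs f ≤ ∑ xs g
  ∑-mono []       h = z≤n
  ∑-mono (x ∷ xs) h = +-mono-≤ (h x (here refl)) (∑-mono xs (λ y y∈ → h y (there y∈)))

  ∑-cong : ∀ xs {f g : A → ℕ} → (∀ x → x ∈ xs → f x ≡ g x) → ∑ xs f ≡ ∑ xs g
  ∑-cong []       h = refl
  ∑-cong (x ∷ xs) h = cong₂ _+_ (h x (here refl)) (∑-cong xs (λ y y∈ → h y (there y∈)))

  ∑-+ : ∀ xs (f g : A → ℕ) → ∑ xs (λ x → f x + g x) ≡ ∑ xs f + ∑ xs g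
  ∑-+ []       f g = refl
  ∑-+ (x ∷ xs) f g rewrite ∑-+ xs f g = interchange (f x) (g x) (∑ xs f) (∑ xs g)
    where
    interchange : ∀ a b c d → a + b + (c + d) ≡ a + c + (b + d)
    interchange = solve-∀

  ∑-*ˡ : ∀ xs c (f : A → ℕ) → ∑ xs (λ x → c * f x) ≡ c * ∑ xs f
  ∑-*ˡ []       c f = sym (*-zeroʳ c)
  ∑-*ˡ (x ∷ xs) c f rewrite ∑-*ˡ xs c f = sym (*-distribˡ-+ c (f x) (∑ xs f))

  ∑-*ʳ : ∀ xs c (f : A → ℕ) → ∑ xs (λ x → f x * c) ≡ ∑ xs f * c
  ∑-*ʳ []       c f = refl
  ∑-*ʳ (x ∷ xs) c f rewrite ∑-*ʳ xs c f = sym (*-distribʳ-+ c (f x) (∑ xs f))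

  ∑-const : ∀ (xs : List A) c → ∑ xs (λ _ → c) ≡ length xs * c
  ∑-const []       c = refl
  ∑-const (x ∷ xs) c = cong (c +_) (∑-const xs c)

  ∑-zero : ∀ xs {f : A → ℕ} → (∀ x → x ∈ xs → f x ≡ 0) → ∑ xs f ≡ 0
  ∑-zero []       h = refl
  ∑-zero (x ∷ xs) h rewrite h x (here refl) = ∑-zero xs (λ y y∈ → h y (there y∈))

  module _ {P : A → Set} (P? : ∀ x → Dec (P x)) where
    ∑-filter : ∀ xs (f : A → ℕ) → ∑ (filter P? xs) f ≡ ∑ xs (λ x → ind (does (P? x)) * f x)
    ∑-filter []       f = refl
    ∑-filter (x ∷ xs) f with P? x
    ... | yes _ = cong₂ _+_ (sym (+-identityʳ (f x))) (∑-filter xs f)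
    ... | no  _ = ∑-filter xs f

    length-filter-ind : ∀ xs → length (filter P? xs) ≡ ∑ xs (λ x → ind (does (P? x)))
    length-filter-ind []       = refl
    length-filter-ind (x ∷ xs) with P? x
    ... | yes _ = cong suc (length-filter-ind xs)
    ... | no  _ = length-filter-ind xs

  extract : ∀ {x : A} {xs} → x ∈ xs → ∃ λ ys → xs ↭ x ∷ ys
  extract {x} x∈ with ∈-∃++ x∈
  ... | ys , zs , refl = ys ++ zs , shift x ys zs

  Unique-resp-↭ : ∀ {xs ys : List A} → xs ↭ ys → Unique xs → Unique ys
  Unique-resp-↭ p = ↭ₛ.Unique-resp-↭ (setoid A) (↭⇒↭ₛ p)

  Unique-∉ : ∀ {x : A} {xs} → Unique (x ∷ xs) → x ∉ xs
  Unique-∉ = Uniqueₚ.Unique[x∷xs]⇒x∉xs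

  Unique-cons : ∀ {x : A} {xs} → x ∉ xs → Unique xs → Unique (x ∷ xs)
  Unique-cons x∉ u = All.tabulate (λ {y} y∈ x≡y → x∉ (subst (_∈ _) (sym x≡y) y∈)) ∷ u

  Unique-length-≤ : ∀ {xs ys : List A} → Unique xs → (∀ x → x ∈ xs → x ∈ ys) → length xs ≤ length ys
  Unique-length-≤ {[]}     u sub = z≤n
  Unique-length-≤ {x ∷ xs} {ys} u@(_ ∷ u′) sub with extract (sub x (here refl))
  ... | zs , p = subst (suc (length xs) ≤_) (sym (↭-length p)) (s≤s (Unique-length-≤ u′ sub′))
    where
    sub′ : ∀ y → y ∈ xs → y ∈ zs
    sub′ y y∈ with ∈-resp-↭ p (sub y (there y∈))
    ... | here refl = contradiction y∈ (Unique-∉ u)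
    ... | there y∈′ = y∈′

Unique-Fin-length : ∀ {N} {xs : List (Fin N)} → Unique xs → length xs ≤ N
Unique-Fin-length {N} xs! = ≤-trans (Unique-length-≤ xs! λ x _ → ∈-allFin x) (≤-reflexive (length-tabulate id))

∑-swap : ∀ {A B : Set} (xs : List A) (ys : List B) (f : A → B → ℕ) →
  ∑ xs (λ x → ∑ ys (f x)) ≡ ∑ ys (λ y → ∑ xs (λ x → f x y))
∑-swap []       ys f = sym (∑-zero ys (λ _ _ → refl))
∑-swap (x ∷ xs) ys f = trans (cong (∑ ys (f x) +_) (∑-swap xs ys f))
                             (sym (∑-+ ys (f x) (λ y → ∑ xs (λ z → f z y))))

∑-map : ∀ {A B : Set} (g : A → B) (f : B → ℕ) xs → ∑ (map g xs) f ≡ ∑ xs (f ∘ g)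
∑-map g f []       = refl
∑-map g f (x ∷ xs) = cong (f (g x) +_) (∑-map g f xs)

module Update {V B : Set} (_≟_ : DecidableEquality V) where

  update : V → B → (V → B) → V → B
  update u b G v = if does (v ≟ u) then b else G v

  update-self : ∀ u b G → update u b G u ≡ b
  update-self u b G with u ≟ u
  ... | yes _ = refl
  ... | no ¬p = contradiction refl ¬p

  update-other : ∀ u b G {v} → v ≢ u → update u b G v ≡ G v
  update-other u b G {v} v≢u with v ≟ u
  ... | yes p = contradiction p v≢u
  ... | no _  = refl

-- Covering the sparse vertex sets of a graph

module Enumerate {V : Set} (_≟_ : DecidableEquality V) where

  open Update {B = Bool} _≟_

  Agree : List V → (V → Bool) → (V → Bool) → Set
  Agree A F G = ∀ v → v ∈ A → F v ≡ G v

  Agree-update : ∀ {A u F G b} → u ∉ A → F u ≡ b → Agree A F G → Agree (u ∷ A) F (update u b G)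
  Agree-update {u = u} {F} {G} {b} u∉ Fu ag .u (here refl) = trans Fu (sym (update-self u b G))
  Agree-update {u = u} {F} {G} {b} u∉ Fu ag v (there v∈) =
    trans (ag v v∈) (sym (update-other u b G λ { refl → u∉ v∈ }))

  -- Branching on u: the first list serves the sets without u, the second the sets containing u.
  join : V → List (V → Bool) → List (V → Bool) → List (V → Bool)
  join u Gs Hs = map (update u false) Gs ++ map (update u true) Hs

  length-join : ∀ u Gs Hs → length (join u Gs Hs) ≡ length Gs + length Hs
  length-join u Gs Hs = trans (length-++ (map (update u false) Gs))
    (cong₂ _+_ (length-map (update u false) Gs) (length-map (update u true) Hs))

  join-covers : ∀ {A u F} Gs Hs → u ∉ A →
    (F u ≡ false → Any (Agree A F) Gs) → (F u ≡ true → Any (Agree A F) Hs) →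
    Any (Agree (u ∷ A) F) (join u Gs Hs)
  join-covers {A} {u} {F} Gs Hs u∉ out in′ with F u in eq
  ... | false = Anyₚ.++⁺ˡ (Anyₚ.map⁺ (Any.map (Agree-update u∉ eq) (out refl)))
  ... | true  = Anyₚ.++⁺ʳ _ (Anyₚ.map⁺ (Any.map (Agree-update u∉ eq) (in′ refl)))

  enumerate : ∀ A → Unique A → ∃ λ Gs → length Gs ≡ 2 ^ length A × (∀ F → Any (Agree A F) Gs)
  enumerate [] u = (λ _ → false) ∷ [] , refl , λ F → here λ v ()
  enumerate (u ∷ A) uniq@(_ ∷ uniq′) with enumerate A uniq′
  ... | Gs , len , cov = join u Gs Gs
    , trans (length-join u Gs Gs) (trans (cong₂ _+_ len len) (cong (2 ^ length A +_) (sym (+-identityʳ _))))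
    , λ F → join-covers Gs Gs (Unique-∉ uniq) (λ _ → cov F) (λ _ → cov F)

-- The hypothesis `growth` reads (1 + 1/t)^Δ ≥ t: a drop of the potential by Δ is worth a factor t.
-- The hypothesis `small` ends the branching: once no degree reaches Δ, at most L vertices are left
-- and all their subsets are listed.
module SparseCover {V : Set} (_≟_ : DecidableEquality V)
  (adj : V → V → ℕ) (adj≤1 : ∀ u v → adj u v ≤ 1) (adj-sym : ∀ u v → adj u v ≡ adj v u) (adj-irrefl : ∀ u → adj u u ≡ 0)
  (t Δ r L : ℕ) (1≤t : 1 ≤ t) (growth : t * t ^ Δ ≤ suc t ^ Δ)
  (small : ∀ A → Unique A → (∀ u → u ∈ A → ∑ A (adj u) < Δ) → length A ≤ L) where

  open Enumerate _≟_

  -- h u counts the chosen neighbours of u; once h u ≥ r the vertex u is dead, and choosing it uses up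
  -- r units of the cost.
  potential : List V → (V → ℕ) → ℕ
  potential A h = ∑ A (λ u → suc (r ∸ h u))

  degree : List V → (V → Bool) → V → ℕ
  degree A F u = ∑ A (λ w → ind (F w) * adj u w)

  cost : List V → (V → ℕ) → (V → Bool) → ℕ
  cost A h F = ∑ A (λ u → ind (F u) * (h u + degree A F u))

  -- len ≤ 2^L t^q (1 + 1/t)^Ψ
  record Bound (len q Ψ : ℕ) : Set where
    constructor bound
    field unbound : len * t ^ Ψ ≤ 2 ^ L * t ^ q * suc t ^ Ψ
  open Bound

  Bound-mono-+ : ∀ {len q} Ψ d → Bound len q Ψ → Bound len q (d + Ψ)
  Bound-mono-+ {len} {q} Ψ d (bound b) = bound (begin
    len * t ^ (d + Ψ)                  ≡⟨ cong (len *_) (^-distribˡ-+-* t d Ψ) ⟩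
    len * (t ^ d * t ^ Ψ)              ≡⟨ shuffle len (t ^ d) (t ^ Ψ) ⟩
    t ^ d * (len * t ^ Ψ)              ≤⟨ *-mono-≤ (^-monoˡ-≤ d (n≤1+n t)) b ⟩
    suc t ^ d * (2 ^ L * t ^ q * suc t ^ Ψ) ≡⟨ shuffle (2 ^ L * t ^ q) (suc t ^ d) (suc t ^ Ψ) ⟨
    2 ^ L * t ^ q * (suc t ^ d * suc t ^ Ψ) ≡⟨ cong (2 ^ L * t ^ q *_) (^-distribˡ-+-* (suc t) d Ψ) ⟨
    2 ^ L * t ^ q * suc t ^ (d + Ψ)    ∎)
    where
    open ≤-Reasoning
    shuffle : ∀ a b c → a * (b * c) ≡ b * (a * c)
    shuffle = solve-∀

  Bound-mono : ∀ {len q Ψ Ψ′} → Ψ ≤ Ψ′ → Bound len q Ψ → Bound len q Ψ′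
  Bound-mono {len} {q} {Ψ} le b =
    subst (Bound len q) (m∸n+n≡m le) (Bound-mono-+ Ψ _ b)

  -- Choosing a dead vertex lowers q, so the bound for that branch is 1/t times the bound for the
  -- other. Together they need a factor 1 + 1/t, which is what the one unit of potential given up
  -- with the vertex provides.
  Bound-dead : ∀ {l₁ l₂ q Ψ} → Bound l₁ (suc q) Ψ → Bound l₂ q Ψ → Bound (l₁ + l₂) (suc q) (suc Ψ)
  Bound-dead {l₁} {l₂} {q} {Ψ} (bound b₁) (bound b₂) = bound (begin
    (l₁ + l₂) * (t * t ^ Ψ)                ≡⟨ e₁ l₁ l₂ t (t ^ Ψ) ⟩
    t * (l₁ * t ^ Ψ) + t * (l₂ * t ^ Ψ)    ≤⟨ +-mono-≤ (*-monoʳ-≤ t b₁) (*-monoʳ-≤ t b₂) ⟩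
    t * (2 ^ L * (t * t ^ q) * suc t ^ Ψ) + t * (2 ^ L * t ^ q * suc t ^ Ψ) ≡⟨ e₂ t (2 ^ L) (t ^ q) (suc t ^ Ψ) ⟩
    2 ^ L * (t * t ^ q) * (suc t * suc t ^ Ψ) ∎)
    where
    open ≤-Reasoning
    e₁ : ∀ a b c d → (a + b) * (c * d) ≡ c * (a * d) + c * (b * d)
    e₁ = solve-∀
    e₂ : ∀ t a b c → t * (a * (t * b) * c) + t * (a * b * c) ≡ a * (t * b) * (suc t * c)
    e₂ = solve-∀

  -- Here q stays fixed. The branch that contains the vertex has lost Δ of its potential, and by
  -- `growth` this again makes its bound 1/t times the bound for the other branch.
  Bound-live : ∀ {l₁ l₂ q Ψ Ψ₂} → Bound l₁ q Ψ → Bound l₂ q Ψ₂ → Δ + Ψ₂ ≤ Ψ → Bound (l₁ + l₂) q (suc Ψ)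
  Bound-live {l₁} {l₂} {q} {Ψ} {Ψ₂} (bound b₁) b₂ le = bound (begin
    (l₁ + l₂) * (t * t ^ Ψ)                ≡⟨ e₁ l₁ l₂ t (t ^ Ψ) ⟩
    t * (l₁ * t ^ Ψ) + t * (l₂ * t ^ Ψ)    ≤⟨ +-mono-≤ (*-monoʳ-≤ t b₁) b₂″ ⟩
    t * (2 ^ L * t ^ q * suc t ^ Ψ) + 2 ^ L * t ^ q * suc t ^ Ψ ≡⟨ e₂ t (2 ^ L * t ^ q) (suc t ^ Ψ) ⟩
    2 ^ L * t ^ q * (suc t * suc t ^ Ψ)    ∎)
    where
    open ≤-Reasoning
    Ψ′ = Ψ ∸ Δ
    eq : Δ + Ψ′ ≡ Ψ
    eq = m+[n∸m]≡n (≤-trans (m≤m+n Δ Ψ₂) le)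
    b₂′ : Bound l₂ q Ψ′
    b₂′ = Bound-mono (+-cancelˡ-≤ Δ Ψ₂ Ψ′ (subst (Δ + Ψ₂ ≤_) (sym eq) le)) b₂
    e₁ : ∀ a b c d → (a + b) * (c * d) ≡ c * (a * d) + c * (b * d)
    e₁ = solve-∀
    e₂ : ∀ t a b → t * (a * b) + a * b ≡ a * (suc t * b)
    e₂ = solve-∀
    e₃ : ∀ a b c d → a * (b * (c * d)) ≡ (a * c) * (b * d)
    e₃ = solve-∀
    e₄ : ∀ a b c → a * (b * c) ≡ b * (a * c)
    e₄ = solve-∀
    b₂″ : t * (l₂ * t ^ Ψ) ≤ 2 ^ L * t ^ q * suc t ^ Ψ
    b₂″ = begin
      t * (l₂ * t ^ Ψ)              ≡⟨ cong (λ z → t * (l₂ * t ^ z)) eq ⟨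
      t * (l₂ * t ^ (Δ + Ψ′))       ≡⟨ cong (λ z → t * (l₂ * z)) (^-distribˡ-+-* t Δ Ψ′) ⟩
      t * (l₂ * (t ^ Δ * t ^ Ψ′))   ≡⟨ e₃ t l₂ (t ^ Δ) (t ^ Ψ′) ⟩
      (t * t ^ Δ) * (l₂ * t ^ Ψ′)   ≤⟨ *-mono-≤ growth (unbound b₂′) ⟩
      suc t ^ Δ * (2 ^ L * t ^ q * suc t ^ Ψ′) ≡⟨ e₄ (suc t ^ Δ) (2 ^ L * t ^ q) (suc t ^ Ψ′) ⟩
      2 ^ L * t ^ q * (suc t ^ Δ * suc t ^ Ψ′) ≡⟨ cong (2 ^ L * t ^ q *_) (^-distribˡ-+-* (suc t) Δ Ψ′) ⟨
      2 ^ L * t ^ q * suc t ^ (Δ + Ψ′)         ≡⟨ cong (λ z → 2 ^ L * t ^ q * suc t ^ z) eq ⟩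
      2 ^ L * t ^ q * suc t ^ Ψ     ∎

  -- A cost below `suc q * r` leaves room for at most q choices of a dead vertex, since each of them
  -- costs at least r. The listed sets have to be correct on A only.
  Covered : List V → (V → ℕ) → ℕ → Set
  Covered A h q = ∃ λ Gs → Bound (length Gs) q (potential A h)
    × (∀ F → cost A h F < suc q * r → Any (Agree A F) Gs)

  cost-↭ : ∀ {A A′} h F → A ↭ A′ → cost A h F ≡ cost A′ h F
  cost-↭ {A} {A′} h F p = trans (∑-↭ _ p)
    (∑-cong A′ (λ u _ → cong (λ z → ind (F u) * (h u + z)) (∑-↭ _ p)))

  Covered-↭ : ∀ {A A′} h q → A ↭ A′ → Covered A′ h q → Covered A h q
  Covered-↭ {A} {A′} h q p (Gs , b , cov) = Gs
    , subst (Bound (length Gs) q) (sym (∑-↭ _ p)) b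
    , λ F c → Any.map (λ ag v v∈ → ag v (∈-resp-↭ p v∈)) (cov F (subst (_< suc q * r) (cost-↭ h F p) c))

  -- The cost counts each edge inside F at both of its ends. If u is chosen and removed, the count
  -- at the other end w turns into a hit on w, and the count at u itself is discarded, so the cost
  -- can only drop.
  cost-∷ : ∀ u A h F → ind (F u) * h u + cost A (λ w → h w + ind (F u) * adj u w) F ≤ cost (u ∷ A) h F
  cost-∷ u A h F = +-mono-≤ (*-monoʳ-≤ (ind (F u)) (m≤m+n (h u) _)) (∑-mono A λ w _ →
    *-monoʳ-≤ (ind (F w)) (≤-reflexive (trans (+-assoc (h w) _ _)
      (cong (λ z → h w + (ind (F u) * z + degree A F w)) (adj-sym u w)))))

  cost-shift : ∀ u A h F {b} → F u ≡ b →
    ind b * h u + cost A (λ w → h w + ind b * adj u w) F ≤ cost (u ∷ A) h F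
  cost-shift u A h F refl = cost-∷ u A h F

  cost-skip : ∀ u A h F → cost A h F ≤ cost (u ∷ A) h F
  cost-skip u A h F = ≤-trans (∑-mono A (λ w _ → *-monoʳ-≤ (ind (F w)) (+-monoʳ-≤ (h w) (m≤n+m (degree A F w) _))))
    (m≤n+m _ _)

  Alive : List V → (V → ℕ) → Set
  Alive A h = ∀ u → u ∈ A → h u < r

  -- As long as `h w < r`, the subtraction `r ∸ h w` is not truncated after one more hit either, so
  -- each hit lowers the potential by exactly one.
  potential-hit : ∀ A h u → Alive A h → ∑ A (adj u) + potential A (λ w → h w + adj u w) ≡ potential A h
  potential-hit A h u alive = trans (sym (∑-+ A (adj u) _)) (∑-cong A λ w w∈ → hit (h w) (adj u w) (alive w w∈) (adj≤1 u w))
    where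
    hit : ∀ a b → a < r → b ≤ 1 → b + suc (r ∸ (a + b)) ≡ suc (r ∸ a)
    hit a zero    _   _ rewrite +-identityʳ a = refl
    hit a (suc zero) a<r _ rewrite +-comm a 1 = cong suc (sym (∸-suc′ a<r))
      where
      ∸-suc′ : ∀ {m n} → n < m → m ∸ n ≡ suc (m ∸ suc n)
      ∸-suc′ {suc m} {zero}  _ = refl
      ∸-suc′ {suc m} {suc n} (s≤s lt) = ∸-suc′ lt
    hit a (suc (suc b)) _ (s≤s ())

  cover-dead : ∀ u A h q → u ∉ A → r ≤ h u →
    (∀ q′ → Covered A h q′) → Covered (u ∷ A) h q
  cover-dead u A h q u∉ dead rec with rec q
  -- With q = 0 no listed set contains u: choosing a dead vertex would cost r, which already
  -- exhausts the budget.
  cover-dead u A h zero u∉ dead rec | Gs , b , cov = join u Gs []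
    , subst₂ (λ l z → Bound l 0 z) (sym (trans (length-join u Gs []) (+-identityʳ _))) refl
        (Bound-mono (m≤n+m _ _) b)
    , λ F c → join-covers Gs [] u∉ (λ _ → cov F (≤-<-trans (cost-skip u A h F) c))
        (λ Fu → contradiction (<-≤-trans (≤-<-trans (≤-trans (≤-reflexive (sym (+-identityʳ (h u)))) (m+n≤o⇒m≤o (1 * h u) (cost-shift u A h F Fu))) c)
                 (subst (_≤ h u) (sym (+-identityʳ r)) dead)) (<-irrefl refl))
  cover-dead u A h (suc q) u∉ dead rec | Gs , b , cov with rec q
  ... | Hs , b′ , cov′ = join u Gs Hs
    , subst₂ (λ l z → Bound l (suc q) z) (sym (length-join u Gs Hs))
        (cong (λ z → suc z + potential A h) (sym (m≤n⇒m∸n≡0 dead)))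
        (Bound-dead b b′)
    , λ F c → join-covers Gs Hs u∉ (λ _ → cov F (≤-<-trans (cost-skip u A h F) c))
        (λ Fu → cov′ F (+-cancelˡ-< r _ _ (begin-strict
           r + cost A h F                  ≤⟨ +-mono-≤ dead (∑-mono A (λ w _ → *-monoʳ-≤ (ind (F w)) (+-monoˡ-≤ _ (m≤m+n (h w) _)))) ⟩
           h u + cost A (λ w → h w + 1 * adj u w) F  ≡⟨ cong (_+ cost A (λ w → h w + 1 * adj u w) F) (sym (+-identityʳ (h u))) ⟩
           1 * h u + cost A (λ w → h w + 1 * adj u w) F  ≤⟨ cost-shift u A h F Fu ⟩
           cost (u ∷ A) h F                <⟨ c ⟩
           r + suc q * r                   ∎)))
    where open ≤-Reasoning

  cover-live : ∀ u A h q → u ∉ A → Alive (u ∷ A) h → Δ ≤ ∑ A (adj u) →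
    (∀ h′ → Covered A h′ q) → Covered (u ∷ A) h q
  cover-live u A h q u∉ alive big rec with rec h | rec (λ w → h w + adj u w)
  ... | Gs , b , cov | Hs , b′ , cov′ = join u Gs Hs
    , subst (λ l → Bound l q _) (sym (length-join u Gs Hs))
        -- Removing u frees `suc (r ∸ h u)` of the potential, of which a single unit is used.
        (Bound-mono (s≤s (m≤n+m _ (r ∸ h u)))
          (Bound-live b b′
            (subst (Δ + potential A (λ w → h w + adj u w) ≤_) (potential-hit A h u (λ w w∈ → alive w (there w∈))) (+-monoˡ-≤ _ big))))
    , λ F c → join-covers Gs Hs u∉ (λ _ → cov F (≤-<-trans (cost-skip u A h F) c))
        (λ Fu → cov′ F (≤-<-trans (≤-trans
           (∑-mono A (λ w _ → *-monoʳ-≤ (ind (F w)) (+-monoˡ-≤ _ (+-monoʳ-≤ (h w) (≤-reflexive (sym (+-identityʳ _)))))))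
           (m+n≤o⇒n≤o (1 * h u) (cost-shift u A h F Fu))) c))

  cover-small : ∀ A h q → Unique A → length A ≤ L → Covered A h q
  cover-small A h q uniq le with enumerate A uniq
  ... | Gs , len , cov = Gs
    , bound (begin
        length Gs * t ^ Ψ               ≤⟨ *-mono-≤ (≤-trans (≤-reflexive len) (^-monoʳ-≤ 2 le)) (^-monoˡ-≤ Ψ (n≤1+n t)) ⟩
        2 ^ L * suc t ^ Ψ               ≡⟨ cong (_* suc t ^ Ψ) (sym (*-identityʳ (2 ^ L))) ⟩
        2 ^ L * 1 * suc t ^ Ψ           ≤⟨ *-monoˡ-≤ (suc t ^ Ψ) (*-monoʳ-≤ (2 ^ L) (m^n>0 t {{>-nonZero 1≤t}} q)) ⟩
        2 ^ L * t ^ q * suc t ^ Ψ       ∎)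
    , λ F _ → cov F
    where
    open ≤-Reasoning
    Ψ = potential A h

  -- Dead vertices are treated first. A vertex of large degree is branched on only when all of A is
  -- alive, because only then does every neighbour hit lower the potential.
  cover : ∀ s A h q → length A ≤ s → Unique A → Covered A h q
  cover zero [] h q _ uniq = cover-small [] h q uniq z≤n
  cover (suc s) A h q len uniq with any? (λ u → r ≤? h u) A
  ... | yes dead with find dead
  ...   | u , u∈ , r≤hu with extract u∈
  ...     | A′ , p = Covered-↭ h q p (cover-dead u A′ h q (Unique-∉ uniq′) r≤hu
              λ q′ → cover s A′ h q′ (≤-pred (subst (_≤ suc s) (↭-length p) len)) (AllPairs.tail uniq′))
    where uniq′ = Unique-resp-↭ p uniq
  cover (suc s) A h q len uniq | no ¬dead with any? (λ u → Δ ≤? ∑ A (adj u)) A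
  ... | no ¬big = cover-small A h q uniq (small A uniq λ u u∈ → ≰⇒> λ le → ¬big (lose u∈ le))
  ... | yes big with find big
  ...   | u , u∈ , Δ≤ with extract u∈
  ...     | A′ , p = Covered-↭ h q p (cover-live u A′ h q (Unique-∉ uniq′)
              (λ w w∈ → ≰⇒> λ le → ¬dead (lose (∈-resp-↭ (↭-sym p) w∈) le))
              (subst (Δ ≤_) (trans (∑-↭ (adj u) p) (cong (_+ ∑ A′ (adj u)) (adj-irrefl u))) Δ≤)
              λ h′ → cover s A′ h′ q (≤-pred (subst (_≤ suc s) (↭-length p) len)) (AllPairs.tail uniq′))
    where uniq′ = Unique-resp-↭ p uniq

-- The LYM inequality for families with few comparable pairs

nCk*k!*[n∸k]!≡n! : ∀ {n k} → k ≤ n → (n C k) * (k ! * (n ∸ k) !) ≡ n !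
nCk*k!*[n∸k]!≡n! {n} {k} k≤n =
  trans (cong (_* (k ! * (n ∸ k) !)) (nCk≡n!/k![n-k]! k≤n)) (m/n*n≡m {{_}} (k![n∸k]!∣n! k≤n))

-- Log-convexity of the factorial: the g factors added on top of the larger argument are the larger
-- ones.
!-exchange : ∀ a b g → a ≤ b → (a + g) ! * b ! ≤ a ! * (b + g) !
!-exchange a b zero a≤b rewrite +-identityʳ a | +-identityʳ b = ≤-refl
!-exchange a b (suc g) a≤b rewrite +-suc a g | +-suc b g = begin
  (suc (a + g) * (a + g) !) * b !  ≡⟨ *-assoc (suc (a + g)) ((a + g) !) (b !) ⟩
  suc (a + g) * ((a + g) ! * b !)  ≤⟨ *-mono-≤ (s≤s (+-monoˡ-≤ g a≤b)) (!-exchange a b g a≤b) ⟩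
  suc (b + g) * (a ! * (b + g) !)  ≡⟨ shuffle (suc (b + g)) (a !) _ ⟩
  a ! * (suc (b + g) * (b + g) !)  ∎
  where
  open ≤-Reasoning
  shuffle : ∀ a b c → a * (b * c) ≡ b * (a * c)
  shuffle = solve-∀

-- The pair c, d is the balanced split of the sum. Every other split moves g units from one side to
-- the other, and `!-exchange` compares the products.
!*!-minimal : ∀ {a b c d} → a + b ≡ c + d → c ≤ d → d ≤ suc c → c ! * d ! ≤ a ! * b !
!*!-minimal {a} {b} {c} {d} eq c≤d d≤1+c with a ≤? c
... | yes a≤c with m≤n⇒∃[o]m+o≡n a≤c
...   | g , refl = subst (λ z → (a + g) ! * d ! ≤ a ! * z !)
          (+-cancelˡ-≡ a (d + g) b (trans (rearrange a d g) (sym eq))) (!-exchange a d g (≤-trans a≤c c≤d))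
  where
  rearrange : ∀ a d g → a + (d + g) ≡ a + g + d
  rearrange = solve-∀
!*!-minimal {a} {b} {c} {d} eq c≤d d≤1+c | no a≰c with m≤n⇒∃[o]m+o≡n (≤-trans d≤1+c (≰⇒> a≰c))
... | g , refl = subst₂ _≤_ (cong (λ z → z ! * d !) eq′) (*-comm (b !) _)
          (!-exchange b d g (≤-trans (m≤m+n b g) (≤-trans (≤-reflexive eq′) c≤d)))
  where
  rearrange : ∀ d g b → d + g + b ≡ b + g + d
  rearrange = solve-∀
  eq′ : b + g ≡ c
  eq′ = +-cancelʳ-≡ d (b + g) c (trans (sym (rearrange d g b)) eq)

n/2≤n∸n/2 : ∀ n → n / 2 ≤ n ∸ n / 2
n/2≤n∸n/2 n = m+n≤o⇒m≤o∸n (n / 2) (≤-trans (≤-reflexive (double (n / 2))) (m/n*n≤m n 2))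
  where
  double : ∀ a → a + a ≡ a * 2
  double = solve-∀

n∸n/2≤1+n/2 : ∀ n → n ∸ n / 2 ≤ suc (n / 2)
n∸n/2≤1+n/2 n = m≤n+o⇒m∸n≤o n (n / 2) (begin
  n                      ≡⟨ m≡m%n+[m/n]*n n 2 ⟩
  n % 2 + n / 2 * 2      ≤⟨ +-monoˡ-≤ _ (≤-pred (m%n<n n 2)) ⟩
  1 + n / 2 * 2          ≡⟨ double (n / 2) ⟩
  n / 2 + suc (n / 2)    ∎)
  where
  open ≤-Reasoning
  double : ∀ a → 1 + a * 2 ≡ a + suc a
  double = solve-∀

n/2≤n : ∀ n → n / 2 ≤ n
n/2≤n n = ≤-trans (n/2≤n∸n/2 n) (m∸n≤m n (n / 2))

n!≤centralBinom*k!*[n∸k]! : ∀ {n k} → k ≤ n → n ! ≤ centralBinom n * (k ! * (n ∸ k) !)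
n!≤centralBinom*k!*[n∸k]! {n} {k} k≤n = begin
  n !                                           ≡⟨ nCk*k!*[n∸k]!≡n! (n/2≤n n) ⟨
  centralBinom n * ((n / 2) ! * (n ∸ n / 2) !)  ≤⟨ *-monoʳ-≤ (centralBinom n) (!*!-minimal {k} {n ∸ k} {n / 2} {n ∸ n / 2}
      (trans (m+[n∸m]≡n k≤n) (sym (m+[n∸m]≡n (n/2≤n n)))) (n/2≤n∸n/2 n) (n∸n/2≤1+n/2 n)) ⟩
  centralBinom n * (k ! * (n ∸ k) !)            ∎
  where open ≤-Reasoning

nCk≤centralBinom : ∀ n k → n C k ≤ centralBinom n
nCk≤centralBinom n k with k ≤? n
... | no k≰n = subst (_≤ centralBinom n) (sym (k>n⇒nCk≡0 (≰⇒> k≰n))) z≤n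
... | yes k≤n = *-cancelʳ-≤ (n C k) (centralBinom n) (k ! * (n ∸ k) !) {{>-nonZero (*-mono-≤ (1≤n! k) (1≤n! (n ∸ k)))}}
      (subst (_≤ centralBinom n * (k ! * (n ∸ k) !)) (sym (nCk*k!*[n∸k]!≡n! k≤n)) (n!≤centralBinom*k!*[n∸k]! k≤n))

-- A binomial coefficient other than the two extreme ones is at least its upper index.
j!*l!*[j+l]≤[j+l]! : ∀ {j l} → 1 ≤ j → 1 ≤ l → j ! * l ! * (j + l) ≤ (j + l) !
j!*l!*[j+l]≤[j+l]! {suc j} {suc l} _ _ = ≤-trans (*-monoˡ-≤ (suc j + suc l) (lemma j l)) (≤-reflexive (*-comm ((j + suc l) !) _))
  where
  open ≤-Reasoning
  lemma : ∀ j l → suc j ! * suc l ! ≤ (j + suc l) !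
  lemma j zero rewrite +-comm j 1 | *-identityʳ (suc j !) = ≤-refl
  lemma j (suc l) = begin
    suc j ! * (suc (suc l) * suc l !)   ≡⟨ shuffle (suc j !) (suc (suc l)) (suc l !) ⟩
    suc (suc l) * (suc j ! * suc l !)   ≤⟨ *-mono-≤ (s≤s (m≤n+m (suc l) j)) (lemma j l) ⟩
    suc (j + suc l) * (j + suc l) !     ≡⟨ cong _! (+-suc j (suc l)) ⟨
    (j + suc (suc l)) !                 ∎
    where
    shuffle : ∀ a b c → a * (b * c) ≡ b * (a * c)
    shuffle = solve-∀

-- Inclusion indicators and saturated chains in the cube

_≟ₛ_ : ∀ {n} → DecidableEquality (Subset n)
_≟ₛ_ = Vecₚ.≡-dec Boolₚ._≟_

eq le lt adj : ∀ {n} → Subset n → Subset n → ℕ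
eq a b = ind (does (a ≟ₛ b))
le a b = ind (does (a ⊆? b))
lt a b = ind (does (a ⊂? b))
adj a b = lt a b + lt b a

⊆∧≢⇒⊂ : ∀ {n} {a b : Subset n} → a ⊆ b → a ≢ b → a ⊂ b
⊆∧≢⇒⊂ {a = []} {[]} a⊆b a≢b = contradiction refl a≢b
⊆∧≢⇒⊂ {a = inside ∷ a} {outside ∷ b} a⊆b a≢b with () ← a⊆b Vec.here
⊆∧≢⇒⊂ {a = outside ∷ a} {inside ∷ b} a⊆b a≢b = Sₚ.out⊂in (Sₚ.drop-∷-⊆ a⊆b)
⊆∧≢⇒⊂ {a = outside ∷ a} {outside ∷ b} a⊆b a≢b = Sₚ.s⊂s (⊆∧≢⇒⊂ (Sₚ.drop-∷-⊆ a⊆b) (a≢b ∘ cong (outside ∷_)))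
⊆∧≢⇒⊂ {a = inside ∷ a} {inside ∷ b} a⊆b a≢b = Sₚ.s⊂s (⊆∧≢⇒⊂ (Sₚ.drop-∷-⊆ a⊆b) (a≢b ∘ cong (inside ∷_)))

-- down S lists the sets S ∖ {i} for i ∈ S.
down : ∀ {n} → Subset n → List (Subset n)
down []            = []
down (outside ∷ s) = map (outside ∷_) (down s)
down (inside ∷ s)  = (outside ∷ s) ∷ map (inside ∷_) (down s)

length-down : ∀ {n} (s : Subset n) → length (down s) ≡ ∣ s ∣
length-down []            = refl
length-down (outside ∷ s) = trans (length-map _ (down s)) (length-down s)
length-down (inside ∷ s)  = cong suc (trans (length-map _ (down s)) (length-down s))

∣down∣ : ∀ {n} (s : Subset n) {t} → t ∈ down s → ∣ s ∣ ≡ suc ∣ t ∣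
∣down∣ (outside ∷ s) t∈ with ∈-map⁻ _ t∈
... | t′ , t′∈ , refl = ∣down∣ s t′∈
∣down∣ (inside ∷ s) (here refl) = refl
∣down∣ (inside ∷ s) (there t∈) with ∈-map⁻ _ t∈
... | t′ , t′∈ , refl = cong suc (∣down∣ s t′∈)

-- If `a ⊆ s`, removing an element of s keeps a inside exactly when that element is outside a, which
-- happens |s| - |a| times; otherwise every term is 0. The term with |a| stands on the left to avoid
-- truncated subtraction.
∑-down-le : ∀ {n} (a s : Subset n) → ∑ (down s) (le a) + ∣ a ∣ * le a s ≡ ∣ s ∣ * le a s
∑-down-le [] [] = refl
∑-down-le (outside ∷ a) (outside ∷ s) rewrite ∑-map (outside ∷_) (le (outside ∷ a)) (down s) = ∑-down-le a s
∑-down-le (outside ∷ a) (inside ∷ s)  rewrite ∑-map (inside ∷_) (le (outside ∷ a)) (down s) =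
  trans (+-assoc (le a s) _ _) (cong (le a s +_) (∑-down-le a s))
∑-down-le (inside ∷ a) (outside ∷ s)
  rewrite ∑-map (outside ∷_) (le (inside ∷ a)) (down s) | ∑-zero (down s) {λ _ → 0} (λ _ _ → refl)
        | *-zeroʳ ∣ a ∣ | *-zeroʳ ∣ s ∣ = refl
∑-down-le (inside ∷ a) (inside ∷ s) rewrite ∑-map (inside ∷_) (le (inside ∷ a)) (down s) =
  trans (shuffle (∑ (down s) (le a)) (le a s) (∣ a ∣ * le a s)) (cong (le a s +_) (∑-down-le a s))
  where
  shuffle : ∀ x y z → x + (y + z) ≡ y + (x + z)
  shuffle = solve-∀

m*[m∸1]!≡m! : ∀ m → 1 ≤ m → m * (m ∸ 1) ! ≡ m !
m*[m∸1]!≡m! (suc m) _ = refl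

-- The recursion of the factorial, read as sorting the saturated chains from s down to a proper
-- subset a by their first step: each of the |s| - |a| possible steps leaves a chain shorter by one.
∑-down-! : ∀ {n} (a s : Subset n) →
  ∑ (down s) (λ t → le a t * (∣ t ∣ ∸ ∣ a ∣) !) ≡ lt a s * (∣ s ∣ ∸ ∣ a ∣) !
∑-down-! a s with a ⊂? s
... | no a⊄s = ∑-zero (down s) λ t t∈ → cong (_* (∣ t ∣ ∸ ∣ a ∣) !) (ind-no (a ⊆? t) (a⊄s ∘ strict t t∈))
  where
  down-⊆ : ∀ {n} (s : Subset n) {t} → t ∈ down s → t ⊆ s
  down-⊆ (outside ∷ s) t∈ with ∈-map⁻ _ t∈
  ... | t′ , t′∈ , refl = Sₚ.s⊆s (down-⊆ s t′∈)
  down-⊆ (inside ∷ s) (here refl) = Sₚ.out⊆ ⊆-refl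
  down-⊆ (inside ∷ s) (there t∈) with ∈-map⁻ _ t∈
  ... | t′ , t′∈ , refl = Sₚ.s⊆s (down-⊆ s t′∈)
  strict : ∀ t → t ∈ down s → a ⊆ t → a ⊂ s
  strict t t∈ a⊆t = ⊆∧≢⇒⊂ (⊆-trans a⊆t (down-⊆ s t∈)) λ { refl →
    <⇒≱ (≤-reflexive (sym (∣down∣ s t∈))) (p⊆q⇒∣p∣≤∣q∣ a⊆t) }
... | yes a⊂s = begin
  ∑ (down s) (λ t → le a t * (∣ t ∣ ∸ ∣ a ∣) !)      ≡⟨ ∑-cong (down s) (λ t t∈ → cong (λ z → le a t * z !)
      (trans (cong (_∸ ∣ a ∣) (cong pred (sym (∣down∣ s t∈)))) (pred-∸ ∣ s ∣ ∣ a ∣))) ⟩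
  ∑ (down s) (λ t → le a t * (∣ s ∣ ∸ ∣ a ∣ ∸ 1) !)  ≡⟨ ∑-*ʳ (down s) _ (le a) ⟩
  ∑ (down s) (le a) * (∣ s ∣ ∸ ∣ a ∣ ∸ 1) !          ≡⟨ cong (_* (∣ s ∣ ∸ ∣ a ∣ ∸ 1) !) count ⟩
  (∣ s ∣ ∸ ∣ a ∣) * (∣ s ∣ ∸ ∣ a ∣ ∸ 1) !            ≡⟨ m*[m∸1]!≡m! (∣ s ∣ ∸ ∣ a ∣) (m<n⇒0<n∸m (p⊂q⇒∣p∣<∣q∣ a⊂s)) ⟩
  (∣ s ∣ ∸ ∣ a ∣) !                                  ≡⟨ +-identityʳ _ ⟨
  1 * (∣ s ∣ ∸ ∣ a ∣) !                              ∎
  where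
  open ≡-Reasoning
  pred-∸ : ∀ m n → pred m ∸ n ≡ m ∸ n ∸ 1
  pred-∸ m n = trans (∸-+-assoc m 1 n) (trans (cong (m ∸_) (+-comm 1 n)) (sym (∸-+-assoc m n 1)))
  le≡1 : le a s ≡ 1
  le≡1 = ind-yes (a ⊆? s) (proj₁ a⊂s)
  count : ∑ (down s) (le a) ≡ ∣ s ∣ ∸ ∣ a ∣
  count = trans (sym (m+n∸n≡m _ ∣ a ∣)) (cong (_∸ ∣ a ∣)
    (subst₂ (λ x y → ∑ (down s) (le a) + x ≡ y)
      (trans (cong (∣ a ∣ *_) le≡1) (*-identityʳ ∣ a ∣)) (trans (cong (∣ s ∣ *_) le≡1) (*-identityʳ ∣ s ∣)) (∑-down-le a s)))

le-split : ∀ {n} (a s : Subset n) → le a s * (∣ s ∣ ∸ ∣ a ∣) ! ≡ eq a s + lt a s * (∣ s ∣ ∸ ∣ a ∣) !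
le-split a s with a ≟ₛ s
... | yes refl rewrite ind-yes (a ⊆? a) ⊆-refl | ind-no (a ⊂? a) (⊂-irref refl) | n∸n≡0 ∣ a ∣ = refl
... | no a≢s with a ⊆? s
...   | yes a⊆s rewrite ind-yes (a ⊂? s) (⊆∧≢⇒⊂ a⊆s a≢s) = refl
...   | no a⊈s  rewrite ind-no (a ⊂? s) (a⊈s ∘ proj₁) = refl

module LYM {n : ℕ} (A : List (Subset n)) (A! : Unique A) where

  -- (|S| - |b|)! counts the saturated chains from S down to b, and H-recursion sorts them by their
  -- first step.
  H : (Subset n → ℕ) → Subset n → ℕ
  H g s = ∑ A (λ b → g b * (le b s * (∣ s ∣ ∸ ∣ b ∣) !))

  H-recursion : ∀ g s → H g s ≡ ∑ A (λ b → g b * eq b s) + ∑ (down s) (H g)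
  H-recursion g s = begin
    H g s                                                         ≡⟨ ∑-cong A (λ b _ → trans (cong (g b *_) (le-split b s)) (*-distribˡ-+ (g b) _ _)) ⟩
    ∑ A (λ b → g b * eq b s + g b * (lt b s * (∣ s ∣ ∸ ∣ b ∣) !)) ≡⟨ ∑-+ A _ _ ⟩
    _ + ∑ A (λ b → g b * (lt b s * (∣ s ∣ ∸ ∣ b ∣) !))           ≡⟨ cong (∑ A (λ b → g b * eq b s) +_) (begin
       ∑ A (λ b → g b * (lt b s * (∣ s ∣ ∸ ∣ b ∣) !))            ≡⟨ ∑-cong A (λ b _ → trans (cong (g b *_) (sym (∑-down-! b s))) (sym (∑-*ˡ (down s) (g b) _))) ⟩
       ∑ A (λ b → ∑ (down s) (λ t → g b * (le b t * (∣ t ∣ ∸ ∣ b ∣) !))) ≡⟨ ∑-swap A (down s) _ ⟩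
       ∑ (down s) (H g) ∎) ⟩
    ∑ A (λ b → g b * eq b s) + ∑ (down s) (H g)                  ∎
    where open ≡-Reasoning

  ∑-eq-∈ : ∀ (g : Subset n → ℕ) {s} {xs} → Unique xs → s ∈ xs → ∑ xs (λ b → g b * eq b s) ≡ g s
  ∑-eq-∈ g {s} u (here {b} {xs} refl) rewrite ind-yes (s ≟ₛ s) refl | *-identityʳ (g s)
    | ∑-zero xs {λ b → g b * eq b s} (λ b b∈ → trans (cong (g b *_) (ind-no (b ≟ₛ s) λ { refl → Unique-∉ u b∈ })) (*-zeroʳ (g b)))
    = +-identityʳ (g s)
  ∑-eq-∈ g {s} u (there {b} s∈) rewrite ind-no (b ≟ₛ s) (λ { refl → Unique-∉ u s∈ }) | *-zeroʳ (g b) = ∑-eq-∈ g (AllPairs.tail u) s∈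

  ∑-eq-∉ : ∀ (g : Subset n → ℕ) {s} {xs} → s ∉ xs → ∑ xs (λ b → g b * eq b s) ≡ 0
  ∑-eq-∉ g {s} {xs} s∉ = ∑-zero xs λ b b∈ → trans (cong (g b *_) (ind-no (b ≟ₛ s) λ { refl → s∉ b∈ })) (*-zeroʳ (g b))

  -- Counts maximal chains below b with a marked member a of A strictly below b: (|b| - |a|)! ways
  -- from b down to a and |a|! ways from a to the empty set.
  below : Subset n → ℕ
  below b = ∑ A (λ a → ∣ a ∣ ! * (lt a b * (∣ b ∣ ∸ ∣ a ∣) !))

  -- x s counts the pairs of a maximal chain below s and a member of A on it; in p s two members of A
  -- are marked.
  x p : Subset n → ℕ
  x = H (λ b → ∣ b ∣ !)
  p = H below

  below≡∑x : ∀ s → below s ≡ ∑ (down s) x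
  below≡∑x s = trans (∑-cong A (λ a _ → trans (cong (∣ a ∣ ! *_) (sym (∑-down-! a s))) (sym (∑-*ˡ (down s) (∣ a ∣ !) _))))
                     (∑-swap A (down s) _)

  -- Bonferroni: a chain meeting A in X points contains at least X - 1 pairs from A.
  x≤!+p : ∀ m s → ∣ s ∣ ≤ m → x s ≤ ∣ s ∣ ! + p s
  x≤!+p m s le with Any.any? (s ≟ₛ_) A
  -- Here s lies on every chain below it. It accounts for |s|! of the marks, and any other marked
  -- member forms a pair with s. If s is not in A, the bound is inherited from the sets of `down s`
  -- by induction on m.
  ... | yes s∈ = begin
    x s                                       ≡⟨ H-recursion (λ b → ∣ b ∣ !) s ⟩
    _ + ∑ (down s) x                          ≡⟨ cong₂ _+_ (∑-eq-∈ (λ b → ∣ b ∣ !) A! s∈) (sym (below≡∑x s)) ⟩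
    ∣ s ∣ ! + below s                         ≡⟨ cong (∣ s ∣ ! +_) (∑-eq-∈ below A! s∈) ⟨
    ∣ s ∣ ! + ∑ A (λ b → below b * eq b s)    ≤⟨ +-monoʳ-≤ (∣ s ∣ !) (m≤m+n _ _) ⟩
    ∣ s ∣ ! + (_ + ∑ (down s) p)              ≡⟨ cong (∣ s ∣ ! +_) (H-recursion below s) ⟨
    ∣ s ∣ ! + p s                             ∎
    where open ≤-Reasoning
  ... | no s∉ = begin
    x s                                       ≡⟨ H-recursion (λ b → ∣ b ∣ !) s ⟩
    _ + ∑ (down s) x                          ≡⟨ cong (_+ ∑ (down s) x) (∑-eq-∉ (λ b → ∣ b ∣ !) s∉) ⟩
    ∑ (down s) x                              ≤⟨ step m le ⟩
    ∑ (down s) (λ t → (∣ s ∣ ∸ 1) ! + p t)    ≡⟨ ∑-+ (down s) _ _ ⟩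
    ∑ (down s) (λ t → (∣ s ∣ ∸ 1) !) + ∑ (down s) p ≡⟨ cong (_+ ∑ (down s) p) (trans (∑-const (down s) _) (cong (_* (∣ s ∣ ∸ 1) !) (length-down s))) ⟩
    ∣ s ∣ * (∣ s ∣ ∸ 1) ! + ∑ (down s) p      ≤⟨ +-mono-≤ (m*[m∸1]!≤m! ∣ s ∣) (m≤n+m _ (∑ A (λ b → below b * eq b s))) ⟩
    ∣ s ∣ ! + (_ + ∑ (down s) p)              ≡⟨ cong (∣ s ∣ ! +_) (H-recursion below s) ⟨
    ∣ s ∣ ! + p s                             ∎
    where
    open ≤-Reasoning
    m*[m∸1]!≤m! : ∀ m → m * (m ∸ 1) ! ≤ m !
    m*[m∸1]!≤m! zero = z≤n
    m*[m∸1]!≤m! (suc m) = ≤-refl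
    step : ∀ m → ∣ s ∣ ≤ m → ∑ (down s) x ≤ ∑ (down s) (λ t → (∣ s ∣ ∸ 1) ! + p t)
    step m le = ∑-mono (down s) λ t t∈ → case ∣down∣ s t∈ of λ e →
      subst (λ z → x t ≤ z ! + p t) (cong pred (sym e)) (rec m t (subst (_≤ m) e le))
      where
      rec : ∀ m t → suc ∣ t ∣ ≤ m → x t ≤ ∣ t ∣ ! + p t
      rec (suc m) t (s≤s le) = x≤!+p m t le

  -- The number of maximal chains of the cube that pass through a.
  weight : Subset n → ℕ
  weight a = ∣ a ∣ ! * (n ∸ ∣ a ∣) !

  H-⊤ : ∀ g → H g S.⊤ ≡ ∑ A (λ b → g b * (n ∸ ∣ b ∣) !)
  H-⊤ g = ∑-cong A λ b _ → cong (g b *_) (trans (cong₂ (λ u v → u * (v ∸ ∣ b ∣) !) (ind-yes (b ⊆? S.⊤) Sₚ.⊆⊤) (Sₚ.∣⊤∣≡n n)) (+-identityʳ _))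

  module _ (middle : ∀ b → b ∈ A → 1 ≤ ∣ b ∣ × ∣ b ∣ < n) (Δ e : ℕ) (Δ+e≡n : Δ + e ≡ n)
           (sparse : ∀ b → b ∈ A → ∑ A (adj b) ≤ Δ) where

    -- With j = |b| - |a| and l = n - |b|, the chains through both sets are at most a fraction 1/(j
    -- + l) of those through a and at most 1/(|a| + j) of those through b, since by `middle` the
    -- binomial coefficients involved are not extreme. The two denominators add up to n + j.
    pair-bound : ∀ {a b} → a ∈ A → b ∈ A → a ⊂ b →
      n * (∣ a ∣ ! * (∣ b ∣ ∸ ∣ a ∣) ! * (n ∸ ∣ b ∣) !) ≤ weight a + weight b
    pair-bound {a} {b} a∈ b∈ a⊂b with m≤n⇒∃[o]m+o≡n (<⇒≤ (p⊂q⇒∣p∣<∣q∣ a⊂b)) | m≤n⇒∃[o]m+o≡n (<⇒≤ (proj₂ (middle b b∈)))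
    ... | j , a+j≡b | l , b+l≡n = begin
      n * (∣ a ∣ ! * (∣ b ∣ ∸ ∣ a ∣) ! * (n ∸ ∣ b ∣) !)      ≡⟨ cong₂ (λ u v → n * (∣ a ∣ ! * u ! * v !)) b∸a≡j n∸b≡l ⟩
      n * (∣ a ∣ ! * j ! * l !)                               ≤⟨ *-monoˡ-≤ (∣ a ∣ ! * j ! * l !) n≤ ⟩
      (j + l + (∣ a ∣ + j)) * (∣ a ∣ ! * j ! * l !)           ≡⟨ split (j + l) (∣ a ∣ + j) (∣ a ∣ !) (j !) (l !) ⟩
      ∣ a ∣ ! * (j ! * l ! * (j + l)) + (∣ a ∣ ! * j ! * (∣ a ∣ + j)) * l ! ≤⟨ +-mono-≤ (*-monoʳ-≤ (∣ a ∣ !) (j!*l!*[j+l]≤[j+l]! 1≤j 1≤l)) (*-monoˡ-≤ (l !) (j!*l!*[j+l]≤[j+l]! (proj₁ (middle a a∈)) 1≤j)) ⟩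
      ∣ a ∣ ! * (j + l) ! + (∣ a ∣ + j) ! * l !               ≡⟨ cong₂ _+_ (cong (λ z → ∣ a ∣ ! * z !) (sym n∸a≡j+l)) (cong₂ (λ u v → u ! * v !) a+j≡b (sym n∸b≡l)) ⟩
      weight a + weight b                                     ∎
      where
      open ≤-Reasoning
      b∸a≡j : ∣ b ∣ ∸ ∣ a ∣ ≡ j
      b∸a≡j = trans (cong (_∸ ∣ a ∣) (sym a+j≡b)) (m+n∸m≡n ∣ a ∣ j)
      n∸b≡l : n ∸ ∣ b ∣ ≡ l
      n∸b≡l = trans (cong (_∸ ∣ b ∣) (sym b+l≡n)) (m+n∸m≡n ∣ b ∣ l)
      n∸a≡j+l : n ∸ ∣ a ∣ ≡ j + l
      n∸a≡j+l = trans (cong (_∸ ∣ a ∣) (trans (sym b+l≡n) (trans (cong (_+ l) (sym a+j≡b)) (+-assoc ∣ a ∣ j l)))) (m+n∸m≡n ∣ a ∣ (j + l))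
      1≤j : 1 ≤ j
      1≤j = subst (1 ≤_) b∸a≡j (m<n⇒0<n∸m (p⊂q⇒∣p∣<∣q∣ a⊂b))
      1≤l : 1 ≤ l
      1≤l = subst (1 ≤_) n∸b≡l (m<n⇒0<n∸m (proj₂ (middle b b∈)))
      n≤ : n ≤ j + l + (∣ a ∣ + j)
      n≤ = ≤-trans (≤-reflexive (trans (sym b+l≡n) (+-comm ∣ b ∣ l))) (+-mono-≤ (m≤n+m l j) (≤-reflexive (sym a+j≡b)))
      split : ∀ u v a j l → (u + v) * (a * j * l) ≡ a * (j * l * u) + (a * j * v) * l
      split = solve-∀

    -- Each comparable pair is charged to the weights of both its ends by `pair-bound`. After
    -- swapping one of the double sums, b is charged once per comparable member of A, hence at most
    -- Δ times.
    n*p≤ : n * p S.⊤ ≤ Δ * x S.⊤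
    n*p≤ = begin
      n * p S.⊤                                                 ≡⟨ cong (n *_) (H-⊤ below) ⟩
      n * ∑ A (λ b → below b * (n ∸ ∣ b ∣) !)                   ≡⟨ cong (n *_) (∑-cong A λ b _ → sym (∑-*ʳ A _ _)) ⟩
      n * ∑ A (λ b → ∑ A (λ a → ∣ a ∣ ! * (lt a b * (∣ b ∣ ∸ ∣ a ∣) !) * (n ∸ ∣ b ∣) !)) ≡⟨ ∑-*ˡ A n _ ⟨
      ∑ A (λ b → n * ∑ A (λ a → ∣ a ∣ ! * (lt a b * (∣ b ∣ ∸ ∣ a ∣) !) * (n ∸ ∣ b ∣) !)) ≡⟨ ∑-cong A (λ b _ → sym (∑-*ˡ A n _)) ⟩
      ∑ A (λ b → ∑ A (λ a → n * (∣ a ∣ ! * (lt a b * (∣ b ∣ ∸ ∣ a ∣) !) * (n ∸ ∣ b ∣) !))) ≤⟨ ∑-mono A (λ b b∈ → ∑-mono A λ a a∈ → term a b a∈ b∈) ⟩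
      ∑ A (λ b → ∑ A (λ a → lt a b * weight a + lt a b * weight b)) ≡⟨ ∑-cong A (λ b _ → ∑-+ A _ _) ⟩
      ∑ A (λ b → ∑ A (λ a → lt a b * weight a) + ∑ A (λ a → lt a b * weight b)) ≡⟨ ∑-+ A _ _ ⟩
      ∑ A (λ b → ∑ A (λ a → lt a b * weight a)) + ∑ A (λ b → ∑ A (λ a → lt a b * weight b)) ≡⟨ cong (_+ ∑ A (λ b → ∑ A (λ a → lt a b * weight b))) (∑-swap A A (λ b a → lt a b * weight a)) ⟩
      ∑ A (λ b → ∑ A (λ a → lt b a * weight b)) + ∑ A (λ b → ∑ A (λ a → lt a b * weight b)) ≡⟨ ∑-+ A _ _ ⟨
      ∑ A (λ b → ∑ A (λ a → lt b a * weight b) + ∑ A (λ a → lt a b * weight b)) ≡⟨ ∑-cong A (λ b _ → trans (sym (∑-+ A _ _)) (trans (∑-cong A λ a _ → sym (*-distribʳ-+ (weight b) (lt b a) (lt a b))) (∑-*ʳ A (weight b) (adj b)))) ⟩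
      ∑ A (λ b → ∑ A (adj b) * weight b)                        ≤⟨ ∑-mono A (λ b b∈ → *-monoˡ-≤ (weight b) (sparse b b∈)) ⟩
      ∑ A (λ b → Δ * weight b)                                  ≡⟨ ∑-*ˡ A Δ weight ⟩
      Δ * ∑ A weight                                            ≡⟨ cong (Δ *_) (H-⊤ (λ b → ∣ b ∣ !)) ⟨
      Δ * x S.⊤                                                 ∎
      where
      open ≤-Reasoning
      term : ∀ a b → a ∈ A → b ∈ A → n * (∣ a ∣ ! * (lt a b * (∣ b ∣ ∸ ∣ a ∣) !) * (n ∸ ∣ b ∣) !) ≤ lt a b * weight a + lt a b * weight b
      term a b a∈ b∈ with a ⊂? b
      ... | yes a⊂b = subst₂ _≤_
              (cong (λ z → n * (∣ a ∣ ! * z * (n ∸ ∣ b ∣) !)) (sym (+-identityʳ _)))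
              (cong₂ _+_ (sym (+-identityʳ (weight a))) (sym (+-identityʳ (weight b)))) (pair-bound a∈ b∈ a⊂b)
      ... | no _ rewrite *-zeroʳ (∣ a ∣ !) | *-zeroʳ n = z≤n

    -- From x ≤ n! + p and n p ≤ Δ x it follows that (n - Δ) x ≤ n n!. Moreover x is the sum of the
    -- weights, each of which is at least n! divided by the central binomial coefficient.
    lym : e * length A ≤ n * centralBinom n
    lym = *-cancelʳ-≤ _ _ (n !) {{n !≢0}} (begin
      e * length A * n !                      ≡⟨ *-assoc e (length A) (n !) ⟩
      e * (length A * n !)                    ≡⟨ cong (e *_) (∑-const A (n !)) ⟨
      e * ∑ A (λ _ → n !)                     ≤⟨ *-monoʳ-≤ e (∑-mono A λ b b∈ → n!≤centralBinom*k!*[n∸k]! (<⇒≤ (proj₂ (middle b b∈)))) ⟩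
      e * ∑ A (λ b → cb * weight b)            ≡⟨ cong (e *_) (∑-*ˡ A cb weight) ⟩
      e * (cb * ∑ A weight)                    ≡⟨ cong (λ z → e * (cb * z)) (H-⊤ (λ b → ∣ b ∣ !)) ⟨
      e * (cb * x S.⊤)                         ≡⟨ shuffle e cb (x S.⊤) ⟩
      cb * (e * x S.⊤)                         ≤⟨ *-monoʳ-≤ cb e*x≤ ⟩
      cb * (n * n !)                           ≡⟨ rearrange cb n (n !) ⟩
      n * cb * n !                             ∎)
      where
      open ≤-Reasoning
      cb = centralBinom n
      shuffle : ∀ a b c → a * (b * c) ≡ b * (a * c)
      shuffle = solve-∀
      rearrange : ∀ a b c → a * (b * c) ≡ b * a * c
      rearrange = solve-∀
      e*x≤ : e * x S.⊤ ≤ n * n !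
      e*x≤ = +-cancelˡ-≤ (Δ * x S.⊤) _ _ (begin
        Δ * x S.⊤ + e * x S.⊤     ≡⟨ *-distribʳ-+ (x S.⊤) Δ e ⟨
        (Δ + e) * x S.⊤           ≡⟨ cong (_* x S.⊤) Δ+e≡n ⟩
        n * x S.⊤                 ≤⟨ *-monoʳ-≤ n (x≤!+p n S.⊤ (≤-reflexive (Sₚ.∣⊤∣≡n n))) ⟩
        n * (∣ S.⊤ {n} ∣ ! + p S.⊤) ≡⟨ cong (λ z → n * (z ! + p S.⊤)) (Sₚ.∣⊤∣≡n n) ⟩
        n * (n ! + p S.⊤)         ≡⟨ *-distribˡ-+ n (n !) (p S.⊤) ⟩
        n * n ! + n * p S.⊤       ≤⟨ +-monoʳ-≤ (n * n !) n*p≤ ⟩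
        n * n ! + Δ * x S.⊤       ≡⟨ +-comm (n * n !) _ ⟩
        Δ * x S.⊤ + n * n !       ∎)

lt-irrefl : ∀ {n} (a : Subset n) → lt a a ≡ 0
lt-irrefl a = ind-no (a ⊂? a) (⊂-irref refl)

adj-irrefl : ∀ {n} (a : Subset n) → adj a a ≡ 0
adj-irrefl a = cong₂ _+_ (lt-irrefl a) (lt-irrefl a)

adj-sym : ∀ {n} (a b : Subset n) → adj a b ≡ adj b a
adj-sym a b = +-comm (lt a b) (lt b a)

adj≤1 : ∀ {n} (a b : Subset n) → adj a b ≤ 1
adj≤1 a b with a ⊂? b | b ⊂? a
... | yes p | yes q = contradiction q (⊂-asymmetric p)
... | yes p | no _  = ≤-refl
... | no _  | yes _ = ≤-refl
... | no _  | no _  = z≤n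

length-filter-split : ∀ {A : Set} {P : A → Set} (P? : ∀ x → Dec (P x)) xs →
  length xs ≡ length (filter P? xs) + length (filter (¬? ∘ P?) xs)
length-filter-split P? [] = refl
length-filter-split P? (x ∷ xs) with P? x
... | yes _ = cong suc (length-filter-split P? xs)
... | no _  = trans (cong suc (length-filter-split P? xs)) (sym (+-suc _ _))

filter-∑-≤ : ∀ {A : Set} {P : A → Set} (P? : ∀ x → Dec (P x)) xs f → ∑ (filter P? xs) f ≤ ∑ xs f
filter-∑-≤ P? xs f = ≤-trans (≤-reflexive (∑-filter P? xs f)) (∑-mono xs λ x _ →
  ≤-trans (*-monoˡ-≤ (f x) (ind≤1 (does (P? x)))) (≤-reflexive (+-identityʳ (f x))))

-- The two exceptional sets ⊥ and ⊤ account for the summand 2.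
sparse-family-size : ∀ {n Δ e M} → 1 ≤ M → Δ + e ≡ n → Δ * suc M ≤ n → (A : List (Subset n)) → Unique A →
  (∀ b → b ∈ A → ∑ A (adj b) ≤ Δ) → M * length A ≤ suc M * centralBinom n + M * 2
sparse-family-size {n} {Δ} {e} {M} 1≤M Δ+e≡n Δ-small A A! sparse = begin
  M * length A                        ≤⟨ *-monoʳ-≤ M (≤-trans (≤-reflexive (length-filter-split mid? A)) (+-monoʳ-≤ (length A′) (Unique-length-≤ (Uniqueₚ.filter⁺ (¬? ∘ mid?) A!) extreme))) ⟩
  M * (length A′ + 2)                 ≡⟨ *-distribˡ-+ M (length A′) 2 ⟩
  M * length A′ + M * 2               ≤⟨ +-monoˡ-≤ (M * 2) main ⟩
  suc M * centralBinom n + M * 2      ∎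
  where
  open ≤-Reasoning
  Mid : Subset n → Set
  Mid b = 1 ≤ ∣ b ∣ × ∣ b ∣ < n
  mid? : ∀ b → Dec (Mid b)
  mid? b = (1 ≤? ∣ b ∣) ×-dec (∣ b ∣ <? n)
  A′ = filter mid? A
  extreme : ∀ b → b ∈ filter (¬? ∘ mid?) A → b ∈ S.⊥ ∷ S.⊤ ∷ []
  extreme b b∈ with 1 ≤? ∣ b ∣ | ∣ b ∣ <? n
  ... | no ¬p | _ = here (Sₚ.Empty-unique λ (i , i∈) → ¬p (≤-trans (≤-reflexive (sym (Sₚ.∣⁅x⁆∣≡1 i)))
                      (p⊆q⇒∣p∣≤∣q∣ λ {j} j∈ → subst (S._∈ b) (sym (Sₚ.x∈⁅y⁆⇒x≡y i j∈)) i∈)))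
  ... | yes _ | no ¬q = there (here (Sₚ.∣p∣≡n⇒p≡⊤ (≤-antisym (Sₚ.∣p∣≤n b) (≮⇒≥ ¬q))))
  ... | yes p | yes q = contradiction (p , q) (proj₂ (∈-filter⁻ (¬? ∘ mid?) {xs = A} b∈))
  e*A′ : e * length A′ ≤ n * centralBinom n
  e*A′ = LYM.lym A′ (Uniqueₚ.filter⁺ mid? A!) (λ b b∈ → proj₂ (∈-filter⁻ mid? {xs = A} b∈)) Δ e Δ+e≡n
    λ b b∈ → ≤-trans (filter-∑-≤ mid? A (adj b)) (sparse b (proj₁ (∈-filter⁻ mid? {xs = A} b∈)))
  main : M * length A′ ≤ suc M * centralBinom n
  main with A′ in eqA | n ≟ 0
  ... | [] | _ = ≤-trans (≤-reflexive (*-zeroʳ M)) z≤n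
  ... | b ∷ bs | yes refl with () ← proj₂ (proj₂ (∈-filter⁻ mid? {xs = A} (subst (b ∈_) (sym eqA) (here refl))))
  ... | b ∷ bs | no n≢0 = *-cancelˡ-≤ n {{≢-nonZero n≢0}} (begin
    n * (M * ℓ)                  ≡⟨ shuffle n M ℓ ⟩
    n * M * ℓ                    ≤⟨ *-monoˡ-≤ ℓ nM≤ ⟩
    e * suc M * ℓ                ≡⟨ rearr e (suc M) ℓ ⟩
    suc M * (e * ℓ)              ≤⟨ *-monoʳ-≤ (suc M) (subst (λ z → e * length z ≤ n * centralBinom n) eqA e*A′) ⟩
    suc M * (n * centralBinom n) ≡⟨ rearr′ (suc M) n _ ⟩
    n * (suc M * centralBinom n) ∎)
    where
    ℓ = length (b ∷ bs)
    shuffle : ∀ a b c → a * (b * c) ≡ a * b * c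
    shuffle = solve-∀
    rearr : ∀ a b c → a * b * c ≡ b * (a * c)
    rearr = solve-∀
    rearr′ : ∀ a b c → a * (b * c) ≡ b * (a * c)
    rearr′ = solve-∀
    nM≤ : n * M ≤ e * suc M
    nM≤ = +-cancelʳ-≤ n _ _ (begin
      n * M + n                ≡⟨ trans (+-comm (n * M) n) (sym (*-suc n M)) ⟩
      n * suc M                ≡⟨ cong (_* suc M) Δ+e≡n ⟨
      (Δ + e) * suc M          ≡⟨ *-distribʳ-+ (suc M) Δ e ⟩
      Δ * suc M + e * suc M    ≡⟨ +-comm (Δ * suc M) _ ⟩
      e * suc M + Δ * suc M    ≤⟨ +-monoʳ-≤ (e * suc M) Δ-small ⟩
      e * suc M + n            ∎)

-- Peeling and colouring

-- The last index below m at which f is true, with 0 as default if there is none.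
switch : (ℕ → Bool) → ℕ → ℕ
switch f zero    = 0
switch f (suc m) = if f m then m else switch f m

switch-spec : ∀ f m → f 0 ≡ true → f m ≡ false →
  switch f m < m × f (switch f m) ≡ true × f (suc (switch f m)) ≡ false
switch-spec f zero    f0 fm with () ← trans (sym f0) fm
switch-spec f (suc m) f0 fm with f m in eq
... | true  = ≤-refl , eq , fm
... | false with switch-spec f m f0 eq
...   | lt , t , u = m<n⇒m<1+n lt , t , u

∑-ind-∈ : ∀ {A : Set} (_≟_ : DecidableEquality A) {xs} (ys : List A) → Unique xs →
  ∑ xs (λ x → ind (does (any? (x ≟_) ys))) ≤ length ys
∑-ind-∈ _≟_ {xs} ys xs! = ≤-trans (≤-reflexive (sym (length-filter-ind (λ x → any? (x ≟_) ys) xs)))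
  (Unique-length-≤ (Uniqueₚ.filter⁺ (λ x → any? (x ≟_) ys) xs!) λ x x∈ → proj₂ (∈-filter⁻ (λ x → any? (x ≟_) ys) {xs = xs} x∈))

-- A state (A , i) proposes to put the set A at level i < k.
module Peeling {n : ℕ} (d k : ℕ) where

  State : Set
  State = Subset n × ℕ

  _≟ˢ_ : DecidableEquality State
  _≟ˢ_ = ×ₚ.≡-dec _≟ₛ_ _≟_

  Up : State → State → Set
  Up (a , i) (b , j) = j ≡ suc i × a ⊂ b

  Up? : ∀ q q′ → Dec (Up q q′)
  Up? (a , i) (b , j) = (j ≟ suc i) ×-dec (a ⊂? b)

  ups downs : State → List State → List State
  ups   q = filter (Up? q)
  downs q = filter (λ q′ → Up? q′ q)

  FewUp FewDown : List State → State → Set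
  FewUp   Q q = suc (proj₂ q) < k × length (ups q Q) < d
  FewDown Q q = 0 < proj₂ q × length (downs q Q) < d

  FewUp? : ∀ Q q → Dec (FewUp Q q)
  FewUp? Q q = (suc (proj₂ q) <? k) ×-dec (length (ups q Q) <? d)

  FewDown? : ∀ Q q → Dec (FewDown Q q)
  FewDown? Q q = (0 <? proj₂ q) ×-dec (length (downs q Q) <? d)

  -- The list is in the order of removal: the head goes first, and its neighbours are counted in the
  -- tail, which consists of the states still present.
  data Peel : List State → Set where
    []   : Peel []
    dropUp   : ∀ {q Q} → FewUp Q q → Peel Q → Peel (q ∷ Q)
    dropDown : ∀ {q Q} → FewDown Q q → Peel Q → Peel (q ∷ Q)

  Good : List State → Set
  Good Q = Unique Q × (∀ q → q ∈ Q → ¬ FewUp Q q × ¬ FewDown Q q)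

  length-filter-extract : ∀ {P : State → Set} (P? : ∀ q → Dec (P q)) {Q q Q′} → Q ↭ q ∷ Q′ →
    length (filter P? Q′) ≤ length (filter P? Q)
  length-filter-extract P? {Q} {q} {Q′} p = begin
    length (filter P? Q′)                 ≡⟨ length-filter-ind P? Q′ ⟩
    ∑ Q′ (ind ∘ does ∘ P?)                ≤⟨ m≤n+m _ (ind (does (P? q))) ⟩
    ∑ (q ∷ Q′) (ind ∘ does ∘ P?)          ≡⟨ ∑-↭ _ p ⟨
    ∑ Q (ind ∘ does ∘ P?)                 ≡⟨ length-filter-ind P? Q ⟨
    length (filter P? Q)                  ∎
    where open ≤-Reasoning

  GoodCore : List State → Set
  GoodCore Q = ∃ λ Q′ → Good Q′ × (∀ q → q ∈ Q′ → q ∈ Q) × ∃ (_∈ Q′)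

  PeelOrder : List State → Set
  PeelOrder Q = ∃ λ Q′ → Q ↭ Q′ × Peel Q′

  peel-step : ∀ {Q q Q′} → Q ↭ q ∷ Q′ → (∀ {Q″} → Q′ ↭ Q″ → Peel Q″ → Peel (q ∷ Q″)) →
    GoodCore Q′ ⊎ PeelOrder Q′ → GoodCore Q ⊎ PeelOrder Q
  peel-step p extend (inj₁ (R , good , sub , ne)) =
    inj₁ (R , good , (λ q q∈ → ∈-resp-↭ (↭-sym p) (there (sub q q∈))) , ne)
  peel-step p extend (inj₂ (R , p′ , peeled)) = inj₂ (_ , ↭-trans p (prep _ p′) , extend p′ peeled)

  filter-few : ∀ {P : State → Set} (P? : ∀ q → Dec (P q)) {Q q Q′ Q″} → Q ↭ q ∷ Q′ → Q′ ↭ Q″ →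
    length (filter P? Q) < d → length (filter P? Q″) < d
  filter-few P? p p′ lt = ≤-<-trans (≤-trans (≤-reflexive (sym (↭-length (filter-↭ P? p′)))) (length-filter-extract P? p)) lt

  peel : ∀ m Q → length Q ≤ m → Unique Q → GoodCore Q ⊎ PeelOrder Q
  peel m [] _ _ = inj₂ ([] , ↭-refl , [])
  peel (suc m) Q@(q₀ ∷ _) le Q! with any? (FewUp? Q) Q
  ... | yes few with find few
  ...   | q , q∈ , i<k , lt with extract q∈
  ...     | Q′ , p = peel-step p (λ p′ → dropUp (i<k , filter-few (Up? q) p p′ lt))
                       (peel m Q′ (≤-pred (subst (_≤ suc m) (↭-length p) le)) (AllPairs.tail (Unique-resp-↭ p Q!)))
  peel (suc m) Q@(q₀ ∷ _) le Q! | no ¬fewUp with any? (FewDown? Q) Q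
  ... | yes few with find few
  ...   | q , q∈ , 0<i , lt with extract q∈
  ...     | Q′ , p = peel-step p (λ p′ → dropDown (0<i , filter-few (λ q′ → Up? q′ q) p p′ lt))
                       (peel m Q′ (≤-pred (subst (_≤ suc m) (↭-length p) le)) (AllPairs.tail (Unique-resp-↭ p Q!)))
  peel (suc m) Q@(q₀ ∷ _) le Q! | no ¬fewUp | no ¬fewDown =
    inj₁ (Q , (Q! , λ q q∈ → (λ f → ¬fewUp (lose q∈ f)) , (λ f → ¬fewDown (lose q∈ f))) , (λ _ → id) , q₀ , here refl)

  -- ρ records the reason of removal (true for few upper neighbours), out the neighbours present at that time.
  record Orientation (Q : List State) : Set where
    field
      ρ         : State → Bool
      out       : State → List (Subset n)
      out-few   : ∀ q → length (out q) ≤ d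
      ρ-up      : ∀ q → q ∈ Q → ρ q ≡ true → suc (proj₂ q) < k
      ρ-down    : ∀ q → q ∈ Q → ρ q ≡ false → 0 < proj₂ q
      oriented  : ∀ q q′ → q ∈ Q → q′ ∈ Q → Up q q′ → ρ q ≡ true → ρ q′ ≡ false →
                  proj₁ q′ ∈ out q ⊎ proj₁ q ∈ out q′

  Up-irrefl : ∀ q → ¬ Up q q
  Up-irrefl (a , i) (_ , a⊂a) = ⊂-irref refl a⊂a

  module _ (q₀ : State) {Q : List State} (o : Orientation Q) (r₀ : Bool) (N₀ : List (Subset n)) where
    open Orientation o
    open Update {B = Bool} _≟ˢ_ using () renaming (update to updρ; update-self to ρ-self; update-other to ρ-other)
    open Update {B = List (Subset n)} _≟ˢ_ using () renaming (update to updN; update-self to N-self; update-other to N-other)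

    -- The state q₀ is removed before all of Q, so in a pair formed with q₀ the other state is still
    -- present and is recorded in N₀. Pairs inside Q keep their old record.
    orientation-cons : length N₀ ≤ d → (r₀ ≡ true → suc (proj₂ q₀) < k) → (r₀ ≡ false → 0 < proj₂ q₀) →
      (∀ q → q ∈ Q → r₀ ≡ true → Up q₀ q → proj₁ q ∈ N₀) →
      (∀ q → q ∈ Q → r₀ ≡ false → Up q q₀ → proj₁ q ∈ N₀) → Orientation (q₀ ∷ Q)
    orientation-cons few₀ up₀ down₀ nbr↑ nbr↓ = record
      { ρ = ρ′ ; out = out′ ; out-few = out-few′ ; ρ-up = ρ-up′ ; ρ-down = ρ-down′ ; oriented = oriented′ }
      where
      ρ′ = updρ q₀ r₀ ρ
      out′ = updN q₀ N₀ out
      out-few′ : ∀ q → length (out′ q) ≤ d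
      out-few′ q with q ≟ˢ q₀
      ... | yes _ = few₀
      ... | no _  = out-few q
      ρ-up′ : ∀ q → q ∈ q₀ ∷ Q → ρ′ q ≡ true → suc (proj₂ q) < k
      ρ-up′ q q∈ e with q ≟ˢ q₀
      ... | yes refl = up₀ e
      ρ-up′ q (here q≡)  e | no q≢ = contradiction q≡ q≢
      ρ-up′ q (there q∈) e | no _  = ρ-up q q∈ e
      ρ-down′ : ∀ q → q ∈ q₀ ∷ Q → ρ′ q ≡ false → 0 < proj₂ q
      ρ-down′ q q∈ e with q ≟ˢ q₀
      ... | yes refl = down₀ e
      ρ-down′ q (here q≡)  e | no q≢ = contradiction q≡ q≢
      ρ-down′ q (there q∈) e | no _  = ρ-down q q∈ e
      oriented′ : ∀ q q′ → q ∈ q₀ ∷ Q → q′ ∈ q₀ ∷ Q → Up q q′ → ρ′ q ≡ true → ρ′ q′ ≡ false →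
                  proj₁ q′ ∈ out′ q ⊎ proj₁ q ∈ out′ q′
      oriented′ q q′ q∈ q′∈ u e e′ with q ≟ˢ q₀ | q′ ≟ˢ q₀
      oriented′ q q′ q∈ q′∈ u e e′ | yes refl | yes refl = contradiction u (Up-irrefl q)
      oriented′ q q′ q∈ (here q′≡) u e e′ | yes refl | no q′≢ = contradiction q′≡ q′≢
      oriented′ q q′ q∈ (there q′∈) u e e′ | yes refl | no _ = inj₁ (nbr↑ q′ q′∈ e u)
      oriented′ q q′ (here q≡) q′∈ u e e′ | no q≢ | yes refl = contradiction q≡ q≢
      oriented′ q q′ (there q∈) q′∈ u e e′ | no _ | yes refl = inj₂ (nbr↓ q q∈ e′ u)
      oriented′ q q′ (here q≡) q′∈ u e e′ | no q≢ | no _ = contradiction q≡ q≢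
      oriented′ q q′ (there q∈) (here q′≡) u e e′ | no _ | no q′≢ = contradiction q′≡ q′≢
      oriented′ q q′ (there q∈) (there q′∈) u e e′ | no _ | no _ = oriented q q′ q∈ q′∈ u e e′

  orient : ∀ {Q} → Peel Q → Orientation Q
  orient [] = record { ρ = λ _ → true ; out = λ _ → [] ; out-few = λ _ → z≤n
    ; ρ-up = λ _ () ; ρ-down = λ _ () ; oriented = λ _ _ () }
  orient (dropUp {q} {Q} (i<k , lt) peeled) = orientation-cons q (orient peeled) true (map proj₁ (ups q Q))
    (≤-trans (≤-reflexive (length-map proj₁ (ups q Q))) (<⇒≤ lt)) (λ _ → i<k) (λ ())
    (λ q′ q′∈ _ u → ∈-map⁺ proj₁ (∈-filter⁺ (Up? q) q′∈ u)) (λ _ _ ())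
  orient (dropDown {q} {Q} (0<i , lt) peeled) = orientation-cons q (orient peeled) false (map proj₁ (downs q Q))
    (≤-trans (≤-reflexive (length-map proj₁ (downs q Q))) (<⇒≤ lt)) (λ ()) (λ _ → 0<i)
    (λ _ _ ()) (λ q′ q′∈ _ u → ∈-map⁺ proj₁ (∈-filter⁺ (λ q″ → Up? q″ q) q′∈ u))

  Orientation-↭ : ∀ {Q Q′} → Q ↭ Q′ → Orientation Q′ → Orientation Q
  Orientation-↭ p o = record { ρ = ρ ; out = out ; out-few = out-few
    ; ρ-up = λ q q∈ → ρ-up q (∈-resp-↭ p q∈) ; ρ-down = λ q q∈ → ρ-down q (∈-resp-↭ p q∈)
    ; oriented = λ q q′ q∈ q′∈ → oriented q q′ (∈-resp-↭ p q∈) (∈-resp-↭ p q′∈) }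
    where open Orientation o

  module Colour {Q : List State} (o : Orientation Q) (F : Family n)
                (complete : ∀ a i → F a ≡ true → i < k → (a , i) ∈ Q) where
    open Orientation o

    colour : Subset n → ℕ
    colour a = switch (λ i → ρ (a , i)) (k ∸ 1)

    -- Level 0 cannot be removed for lack of lower neighbours, nor level k - 1 for lack of upper
    -- ones, so the reason changes in between. For k = 1 these levels coincide and the two demands
    -- clash, so F has no members.
    colour-spec : ∀ a → F a ≡ true → 1 ≤ k →
      colour a < k ∸ 1 × ρ (a , colour a) ≡ true × ρ (a , suc (colour a)) ≡ false
    colour-spec a Fa 1≤k = switch-spec (λ i → ρ (a , i)) (k ∸ 1) bottom top
      where
      bottom : ρ (a , 0) ≡ true
      bottom with ρ (a , 0) in eq
      ... | true = refl
      ... | false = contradiction (ρ-down (a , 0) (complete a 0 Fa 1≤k) eq) λ ()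
      top : ρ (a , k ∸ 1) ≡ false
      top with ρ (a , k ∸ 1) in eq
      ... | false = refl
      ... | true = contradiction (subst (_< k) (m+[n∸m]≡n 1≤k)
              (ρ-up (a , k ∸ 1) (complete a (k ∸ 1) Fa (∸-monoʳ-< {k} z<s 1≤k)) eq)) (<-irrefl refl)

    InClass : ℕ → Subset n → Set
    InClass c a = F a ≡ true × colour a ≡ c

    nbrs : ℕ → Subset n → List (Subset n)
    nbrs c a = out (a , c) ++ out (a , suc c)

    module _ (c : ℕ) (1≤k : 1 ≤ k) where
      class-oriented : ∀ {a b} → InClass c a → InClass c b → a ⊂ b → b ∈ nbrs c a ⊎ a ∈ nbrs c b
      class-oriented {a} {b} (Fa , refl) (Fb , cb) a⊂b with colour-spec a Fa 1≤k | colour-spec b Fb 1≤k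
      ... | lt , ρa , _ | lt′ , _ , ρb
        with oriented (a , c) (b , suc c) (complete a c Fa (<-≤-trans lt (m∸n≤m k 1)))
              (complete b (suc c) Fb (subst (suc (suc c) ≤_) (m+[n∸m]≡n 1≤k) (s≤s lt)))
              (refl , a⊂b) ρa (subst (λ z → ρ (b , suc z) ≡ false) cb ρb)
      ... | inj₁ b∈ = inj₁ (∈-++⁺ˡ b∈)
      ... | inj₂ a∈ = inj₂ (∈-++⁺ʳ (out (b , c)) a∈)

      -- A set lists at most 2d neighbours, d from each of the levels c and c + 1. Every comparable
      -- pair is listed at one of its ends and is met in both orders by the double sum, hence the
      -- factor 4d.
      class-sparse : ∀ A → Unique A → (∀ a → a ∈ A → InClass c a) →
        ∑ A (λ a → ∑ A (adj a)) ≤ 4 * d * length A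
      class-sparse A A! inClass = begin
        ∑ A (λ a → ∑ A (adj a))                       ≤⟨ ∑-mono A (λ a a∈ → ∑-mono A λ b b∈ → bound a b (inClass a a∈) (inClass b b∈)) ⟩
        ∑ A (λ a → ∑ A (λ b → m a b + m b a))         ≡⟨ ∑-cong A (λ a _ → ∑-+ A _ _) ⟩
        ∑ A (λ a → ∑ A (m a) + ∑ A (λ b → m b a))     ≡⟨ ∑-+ A _ _ ⟩
        ∑ A (λ a → ∑ A (m a)) + ∑ A (λ a → ∑ A (λ b → m b a)) ≡⟨ cong (∑ A (λ a → ∑ A (m a)) +_) (∑-swap A A (λ a b → m b a)) ⟩
        ∑ A (λ a → ∑ A (m a)) + ∑ A (λ a → ∑ A (m a)) ≤⟨ +-mono-≤ half half ⟩
        length A * (d + d) + length A * (d + d)       ≡⟨ rearrange (length A) d ⟩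
        4 * d * length A                              ∎
        where
        open ≤-Reasoning
        m : Subset n → Subset n → ℕ
        m a b = ind (does (any? (b ≟ₛ_) (nbrs c a)))
        rearrange : ∀ l d → l * (d + d) + l * (d + d) ≡ 4 * d * l
        rearrange = solve-∀
        few : ∀ a → ∑ A (m a) ≤ d + d
        few a = ≤-trans (∑-ind-∈ _≟ₛ_ (nbrs c a) A!) (≤-trans (≤-reflexive (length-++ (out (a , c))))
          (+-mono-≤ (out-few (a , c)) (out-few (a , suc c))))
        half : ∑ A (λ a → ∑ A (m a)) ≤ length A * (d + d)
        half = ≤-trans (∑-mono A λ a _ → few a) (≤-reflexive (∑-const A (d + d)))
        covered : ∀ a b → b ∈ nbrs c a ⊎ a ∈ nbrs c b → 1 ≤ m a b + m b a
        covered a b (inj₁ b∈) = ≤-trans (≤-reflexive (sym (ind-yes (any? (b ≟ₛ_) (nbrs c a)) b∈))) (m≤m+n _ _)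
        covered a b (inj₂ a∈) = ≤-trans (≤-reflexive (sym (ind-yes (any? (a ≟ₛ_) (nbrs c b)) a∈))) (m≤n+m _ _)
        bound : ∀ a b → InClass c a → InClass c b → adj a b ≤ m a b + m b a
        bound a b ca cb with a ⊂? b | b ⊂? a
        ... | yes p | yes q = contradiction q (⊂-asymmetric p)
        ... | yes p | no _  = covered a b (class-oriented ca cb p)
        ... | no _  | yes q = ≤-trans (covered b a (class-oriented cb ca q)) (≤-reflexive (+-comm (m b a) _))
        ... | no _  | no _  = z≤n

-- Embedding a tree poset

Unique-map-on : ∀ {A B : Set} (f : A → B) {xs} → Unique xs →
  (∀ x y → x ∈ xs → y ∈ xs → f x ≡ f y → x ≡ y) → Unique (map f xs)
Unique-map-on f [] inj = []
Unique-map-on f {x ∷ xs} xs!@(_ ∷ xs!′) inj = Unique-cons fx∉ (Unique-map-on f xs!′ λ y z y∈ z∈ → inj y z (there y∈) (there z∈))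
  where
  fx∉ : f x ∉ map f xs
  fx∉ fx∈ with ∈-map⁻ f fx∈
  ... | y , y∈ , fx≡fy with inj x y (here refl) (there y∈) fx≡fy
  ...   | refl = Unique-∉ xs! y∈

¬¬-all-Fin : ∀ p {P : Fin p → Set} → (∀ i → ¬ ¬ P i) → ¬ ¬ (∀ i → P i)
¬¬-all-Fin zero    h ¬all = ¬all λ ()
¬¬-all-Fin (suc p) h ¬all = h zero λ p₀ → ¬¬-all-Fin p (λ i → h (suc i)) λ ps →
  ¬all λ { zero → p₀ ; (suc i) → ps i }

-- A member r that is not the maximum leads to a larger member, and the bound N limits how often
-- this happens. As H need not be decidable, the search is carried out under a double negation.
¬¬-maximum : ∀ (H : ℕ → Set) N r → H r → (∀ s → H s → s < N) →
  ¬ ¬ (∃ λ r → H r × (∀ s → H s → s ≤ r))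
¬¬-maximum H N r Hr bounded none = go N r (m≤m+n N r) Hr
  where
  go : ∀ f r → N ≤ f + r → ¬ H r
  go zero    r N≤r Hr = <⇒≱ (bounded r Hr) N≤r
  go (suc f) r N≤ Hr = none (r , Hr , λ s Hs → ≮⇒≥ λ r<s →
    go f s (≤-trans N≤ (≤-trans (≤-reflexive (sym (+-suc f r))) (+-monoʳ-≤ f r<s))) Hs)

-- The order of P need not be decidable, so the length of a longest chain ending at x exists only
-- up to double negation.
module Levels (P : FinPoset) (k : ℕ) (bounded : ∀ xs → IsChain P xs → length xs ≤ k) where
  open FinPoset P
  open IsPartialOrder isPO using () renaming (trans to ≤P-trans; antisym to ≤P-antisym)

  _<′_ : Fin size → Fin size → Set
  _<′_ = _<P_ P

  <′-trans : ∀ {x y z} → x <′ y → y <′ z → x <′ z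
  <′-trans (x≤y , x≢y) (y≤z , _) = ≤P-trans x≤y y≤z , λ { refl → x≢y (≤P-antisym x≤y y≤z) }

  ChainBelow : Fin size → ℕ → Set
  ChainBelow x r = ∃ λ xs → IsChain P (x ∷ xs) × All (_<′ x) xs × length xs ≡ r

  ChainBelow-suc : ∀ {x y r} → x <′ y → ChainBelow x r → ChainBelow y (suc r)
  ChainBelow-suc {x} {y} x<y (xs , (xs! , cmp) , below , refl) =
    x ∷ xs , (All.map (λ z<y y≡z → proj₂ z<y (sym y≡z)) below′ ∷ xs! , All.map (inj₂ ∘ proj₁) below′ ∷ cmp) , below′ , refl
    where
    below′ : All (_<′ y) (x ∷ xs)
    below′ = x<y ∷ All.map (λ z<x → <′-trans z<x x<y) below

  Leveling : Set
  Leveling = Σ (Fin size → ℕ) λ ℓ → (∀ x → ℓ x < k) × (∀ x y → x <′ y → ℓ x < ℓ y)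

  ChainBelow-< : ∀ x r → ChainBelow x r → r < k
  ChainBelow-< x r (xs , chain , _ , refl) = bounded (x ∷ xs) chain

  ¬¬-leveling : ¬ ¬ Leveling
  ¬¬-leveling none = ¬¬-all-Fin size
    (λ x → ¬¬-maximum (ChainBelow x) k 0 ([] , ([] ∷ [] , [] ∷ []) , [] , refl) (ChainBelow-< x))
    λ top → none ((λ x → proj₁ (top x)) , (λ x → ChainBelow-< x _ (proj₁ (proj₂ (top x)))) ,
      λ x y x<y → proj₂ (proj₂ (top y)) _ (ChainBelow-suc x<y (proj₁ (proj₂ (top x)))))

module Embedding (P : FinPoset) (connected : HasseConnected P) (acyclic : ¬ HasseCycle P)
  {k : ℕ} (ℓ : Fin (FinPoset.size P) → ℕ) (ℓ<k : ∀ x → ℓ x < k) (ℓ-mono : ∀ x y → _<P_ P x y → ℓ x < ℓ y)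
  {n : ℕ} (F : Family n) (Q : List (Subset n × ℕ))
  (Q-sound : ∀ q → q ∈ Q → F (proj₁ q) ≡ true) where

  open FinPoset P
  open IsPartialOrder isPO using () renaming (antisym to ≤P-antisym)
  open Peeling {n} size k

  V = Fin size

  _∈?ᵥ_ : ∀ (x : V) xs → Dec (x ∈ xs)
  x ∈?ᵥ xs = any? (x Fin.≟_) xs

  Adj : V → V → Set
  Adj = HasseAdj P

  Adj-sym : ∀ {x y} → Adj x y → Adj y x
  Adj-sym (inj₁ c) = inj₂ c
  Adj-sym (inj₂ c) = inj₁ c

  -- The last index lists the vertices. Each step avoids the vertices after it, so the paths are
  -- simple and can be closed up to a `HasseCycle`.
  data Path (S : List V) : V → V → List V → Set where
    stop : ∀ {x} → x ∈ S → Path S x x (x ∷ [])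
    step : ∀ {x y z xs} → x ∈ S → Adj x z → x ∉ xs → Path S z y xs → Path S x y (x ∷ xs)

  Path-weaken : ∀ {S v x y xs} → Path S x y xs → Path (v ∷ S) x y xs
  Path-weaken (stop x∈) = stop (there x∈)
  Path-weaken (step x∈ adj x∉ p) = step (there x∈) adj x∉ (Path-weaken p)

  Path-⊆ : ∀ {S x y xs} → Path S x y xs → ∀ {z} → z ∈ xs → z ∈ S
  Path-⊆ (stop x∈) (here refl) = x∈
  Path-⊆ (step x∈ _ _ p) (here refl) = x∈
  Path-⊆ (step x∈ _ _ p) (there z∈) = Path-⊆ p z∈

  Path-unique : ∀ {S x y xs} → Path S x y xs → Unique xs
  Path-unique (stop x∈) = [] ∷ []
  Path-unique (step x∈ adj x∉ p) = Unique-cons x∉ (Path-unique p)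

  Path-snoc : ∀ {S x y v xs} → Path S x y xs → Adj y v → v ∉ xs → v ∈ S → Path S x v (xs ++ v ∷ [])
  Path-snoc (stop x∈) adj v∉ v∈ = step x∈ adj (λ { (here refl) → v∉ (here refl) }) (stop v∈)
  Path-snoc (step {xs = xs} x∈ a x∉ p) adj v∉ v∈ = step x∈ a
    (λ x∈′ → case ∈-++⁻ xs x∈′ of λ { (inj₁ i) → x∉ i ; (inj₂ (here refl)) → v∉ (here refl) })
    (Path-snoc p adj (v∉ ∘ there) v∈)

  Path-linked : ∀ {S w x y v xs} → Adj w x → Path S x y xs → Adj y v → Linked Adj (w ∷ xs ++ v ∷ [])
  Path-linked wx (stop _) yv = wx ∷ yv ∷ [-]
  Path-linked wx (step _ xz _ p) yv = wx ∷ Path-linked xz p yv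

  Path-long : ∀ {S x y xs} → x ≢ y → Path S x y xs → 2 ≤ length xs
  Path-long x≢y (stop _) = contradiction refl x≢y
  Path-long x≢y (step _ _ _ (stop _)) = ≤-refl
  Path-long x≢y (step _ _ _ (step _ _ _ p)) = s≤s (s≤s z≤n)

  -- Monotonicity is maintained along covering pairs only; `monotone` recovers the whole order at
  -- the end. The paths keep S connected, so that a new vertex cannot have two neighbours in S.
  record Partial (S : List V) : Set where
    field
      π     : V → Subset n
      inQ   : ∀ x → x ∈ S → (π x , ℓ x) ∈ Q
      inj   : ∀ x y → x ∈ S → y ∈ S → π x ≡ π y → x ≡ y
      mono  : ∀ x y → x ∈ S → y ∈ S → Covers P y x → π x ⊂ π y
      paths : ∀ x y → x ∈ S → y ∈ S → ∃ (Path S x y)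

  module _ (good : Good Q) where

    -- The candidates share one level, so different states carry different sets, and at least |P| of
    -- these sets cannot all be among fewer than |P| used ones.
    fresh : (R : State → Set) (R? : ∀ q → Dec (R q)) → (∀ q q′ → R q → R q′ → proj₂ q ≡ proj₂ q′) →
      ∀ used → length used < size → size ≤ length (filter R? Q) → ∃ λ q → q ∈ Q × R q × proj₁ q ∉ used
    fresh R R? level used few many with any? (λ q → ¬? (any? (proj₁ q ≟ₛ_) used)) (filter R? Q)
    ... | yes free with find free
    ...   | q , q∈ , q∉ = q , proj₁ (∈-filter⁻ R? {xs = Q} q∈) , proj₂ (∈-filter⁻ R? {xs = Q} q∈) , q∉
    fresh R R? level used few many | no ¬free = contradiction few (≤⇒≯ (begin
      size                                 ≤⟨ many ⟩
      length (filter R? Q)                 ≡⟨ length-map proj₁ (filter R? Q) ⟨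
      length (map proj₁ (filter R? Q))     ≤⟨ Unique-length-≤ (Unique-map-on proj₁ (Uniqueₚ.filter⁺ R? (proj₁ good)) inj) sub ⟩
      length used                          ∎))
      where
      open ≤-Reasoning
      inj : ∀ q q′ → q ∈ filter R? Q → q′ ∈ filter R? Q → proj₁ q ≡ proj₁ q′ → q ≡ q′
      inj q q′ q∈ q′∈ e = cong₂ _,_ e (level q q′ (proj₂ (∈-filter⁻ R? {xs = Q} q∈)) (proj₂ (∈-filter⁻ R? {xs = Q} q′∈)))
      sub : ∀ a → a ∈ map proj₁ (filter R? Q) → a ∈ used
      sub a a∈ with ∈-map⁻ proj₁ a∈
      ... | q , q∈ , refl = decidable-stable (any? (proj₁ q ≟ₛ_) used) λ q∉ → ¬free (lose q∈ q∉)

    pickUp : ∀ used → length used < size → ∀ {a i} → (a , i) ∈ Q → suc i < k →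
      ∃ λ b → (b , suc i) ∈ Q × a ⊂ b × b ∉ used
    pickUp used few {a} {i} q∈ i<k with fresh (Up (a , i)) (Up? (a , i)) (λ q q′ u u′ → trans (proj₁ u) (sym (proj₁ u′))) used few
        (≮⇒≥ λ lt → proj₁ (proj₂ good (a , i) q∈) (i<k , lt))
    ... | (b , _) , b∈ , (refl , a⊂b) , b∉ = b , b∈ , a⊂b , b∉

    pickDown : ∀ used → length used < size → ∀ {a i} → (a , suc i) ∈ Q →
      ∃ λ b → (b , i) ∈ Q × b ⊂ a × b ∉ used
    pickDown used few {a} {i} q∈ with fresh (λ q → Up q (a , suc i)) (λ q → Up? q (a , suc i))
        (λ q q′ u u′ → suc-injective (trans (sym (proj₁ u)) (proj₁ u′))) used few
        (≮⇒≥ λ lt → proj₂ (proj₂ good (a , suc i) q∈) (z<s , lt))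
    ... | (b , _) , b∈ , (refl , b⊂a) , b∉ = b , b∈ , b⊂a , b∉

    -- Only the last vertex of the walk has to avoid the used sets.
    climb : ∀ used → length used < size → ∀ g {a i} → (a , i) ∈ Q → suc (g + i) < k →
      ∃ λ b → (b , suc (g + i)) ∈ Q × a ⊂ b × b ∉ used
    climb used few zero    q∈ lt = pickUp used few q∈ lt
    climb used few (suc g) q∈ lt with climb used few g q∈ (<-trans (n<1+n _) lt)
    ... | b , b∈ , a⊂b , _ with pickUp used few b∈ lt
    ...   | c , c∈ , b⊂c , c∉ = c , c∈ , ⊂-trans a⊂b b⊂c , c∉

    descend : ∀ used → length used < size → ∀ g {a i} → (a , suc (g + i)) ∈ Q →
      ∃ λ b → (b , i) ∈ Q × b ⊂ a × b ∉ used
    descend used few zero    q∈ = pickDown used few q∈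
    descend used few (suc g) q∈ with pickDown used few q∈
    ... | b , b∈ , b⊂a , _ with descend used few g b∈
    ...   | c , c∈ , c⊂b , c∉ = c , c∈ , ⊂-trans c⊂b b⊂a , c∉

    -- Neighbours in the Hasse diagram may lie more than one level apart, so the gap is bridged by a
    -- walk through the levels in between.
    reachUp : ∀ used → length used < size → ∀ {a i j} → (a , i) ∈ Q → i < j → j < k →
      ∃ λ b → (b , j) ∈ Q × a ⊂ b × b ∉ used
    reachUp used few {a} {i} {j} q∈ i<j j<k = subst (λ z → ∃ λ b → (b , z) ∈ Q × a ⊂ b × b ∉ used) level≡
        (climb used few (j ∸ suc i) q∈ (subst (_< k) (sym level≡) j<k))
      where
      level≡ : suc (j ∸ suc i + i) ≡ j
      level≡ = trans (sym (+-suc _ i)) (m∸n+n≡m i<j)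

    reachDown : ∀ used → length used < size → ∀ {a i j} → (a , i) ∈ Q → j < i →
      ∃ λ b → (b , j) ∈ Q × b ⊂ a × b ∉ used
    reachDown used few {a} {i} {j} q∈ j<i =
      descend used few (i ∸ suc j) (subst (λ z → (a , z) ∈ Q) (sym (trans (sym (+-suc _ j)) (m∸n+n≡m j<i))) q∈)

    module Extend {S} (part : Partial S) (few : length S < size) {u v} (u∈ : u ∈ S) (v∉ : v ∉ S) (uv : Adj u v) where
      open Partial part
      open Update {B = Subset n} (Fin._≟_ {size})

      few′ : length (map π S) < size
      few′ = ≤-<-trans (≤-reflexive (length-map π S)) few

      Image : Set
      Image = ∃ λ b → (b , ℓ v) ∈ Q × b ∉ map π S × (Covers P v u → π u ⊂ b) × (Covers P u v → b ⊂ π u)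
      attach : Adj u v → Image
      attach (inj₂ (u<v , _)) with reachUp (map π S) few′ (inQ u u∈) (ℓ-mono u v u<v) (ℓ<k v)
      ... | b , b∈ , u⊂b , b∉ = b , b∈ , b∉ , (λ _ → u⊂b) ,
              λ ((v≤u , _) , _) → contradiction (≤P-antisym (proj₁ u<v) v≤u) (proj₂ u<v)
      attach (inj₁ (v<u , _)) with reachDown (map π S) few′ (inQ u u∈) (ℓ-mono v u v<u)
      ... | b , b∈ , b⊂u , b∉ = b , b∈ , b∉ , (λ ((u≤v , _) , _) → contradiction (≤P-antisym (proj₁ v<u) u≤v) (proj₂ v<u)) ,
              λ _ → b⊂u

      image : Image
      image = attach uv

      b : Subset n
      b = proj₁ image

      π′ : V → Subset n
      π′ = update v b π

      π′v : π′ v ≡ b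
      π′v = update-self v b π

      π′-old : ∀ {x} → x ∈ S → π′ x ≡ π x
      π′-old x∈ = update-other v b π λ { refl → v∉ x∈ }

      -- A second neighbour y of v in S, together with the path from u to y inside S, would close a
      -- cycle through v.
      only-nbr : ∀ {y} → y ∈ S → Adj y v → y ≡ u
      only-nbr {y} y∈ yv with y Fin.≟ u
      ... | yes y≡u = y≡u
      ... | no y≢u with paths u y u∈ y∈
      ...   | xs , path = contradiction
              (v , xs , Path-long (y≢u ∘ sym) path , Unique-cons (v∉ ∘ Path-⊆ path) (Path-unique path) , Path-linked (Adj-sym uv) path yv)
              acyclic

      ¬Covers-self : ∀ {x} → ¬ Covers P x x
      ¬Covers-self ((_ , x≢x) , _) = x≢x refl

      extend : Partial (v ∷ S)
      extend = record { π = π′ ; inQ = inQ′ ; inj = inj′ ; mono = mono′ ; paths = paths′ }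
        where
        inQ′ : ∀ x → x ∈ v ∷ S → (π′ x , ℓ x) ∈ Q
        inQ′ x (here refl) = subst (λ z → (z , ℓ v) ∈ Q) (sym π′v) (proj₁ (proj₂ image))
        inQ′ x (there x∈)  = subst (λ z → (z , ℓ x) ∈ Q) (sym (π′-old x∈)) (inQ x x∈)
        b≢ : ∀ {x} → x ∈ S → b ≢ π x
        b≢ x∈ b≡ = proj₁ (proj₂ (proj₂ image)) (subst (_∈ map π S) (sym b≡) (∈-map⁺ π x∈))
        inj′ : ∀ x y → x ∈ v ∷ S → y ∈ v ∷ S → π′ x ≡ π′ y → x ≡ y
        inj′ x y (here refl) (here refl) e = refl
        inj′ x y (here refl) (there y∈) e = contradiction (trans (sym π′v) (trans e (π′-old y∈))) (b≢ y∈)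
        inj′ x y (there x∈) (here refl) e = contradiction (trans (sym π′v) (trans (sym e) (π′-old x∈))) (b≢ x∈)
        inj′ x y (there x∈) (there y∈) e = inj x y x∈ y∈ (trans (sym (π′-old x∈)) (trans e (π′-old y∈)))
        mono′ : ∀ x y → x ∈ v ∷ S → y ∈ v ∷ S → Covers P y x → π′ x ⊂ π′ y
        mono′ x y (here refl) (here refl) c = contradiction c ¬Covers-self
        mono′ x y (here refl) (there y∈) c with only-nbr y∈ (inj₁ c)
        ... | refl = subst₂ _⊂_ (sym π′v) (sym (π′-old y∈)) (proj₂ (proj₂ (proj₂ (proj₂ image))) c)
        mono′ x y (there x∈) (here refl) c with only-nbr x∈ (inj₂ c)
        ... | refl = subst₂ _⊂_ (sym (π′-old x∈)) (sym π′v) (proj₁ (proj₂ (proj₂ (proj₂ image))) c)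
        mono′ x y (there x∈) (there y∈) c = subst₂ _⊂_ (sym (π′-old x∈)) (sym (π′-old y∈)) (mono x y x∈ y∈ c)
        paths′ : ∀ x y → x ∈ v ∷ S → y ∈ v ∷ S → ∃ (Path (v ∷ S) x y)
        paths′ x y (here refl) (here refl) = _ , stop (here refl)
        paths′ x y (here refl) (there y∈) with paths u y u∈ y∈
        ... | xs , p = _ , step (here refl) (Adj-sym uv) (v∉ ∘ Path-⊆ p) (Path-weaken p)
        paths′ x y (there x∈) (here refl) with paths x u x∈ u∈
        ... | xs , p = _ , Path-snoc (Path-weaken p) uv (v∉ ∘ Path-⊆ p) (here refl)
        paths′ x y (there x∈) (there y∈) with paths x y x∈ y∈
        ... | xs , p = xs , Path-weaken p

    crossing : ∀ {S s t} → Star Adj s t → s ∈ S → t ∉ S → ∃₂ λ u v → u ∈ S × v ∉ S × Adj u v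
    crossing ε s∈ t∉ = contradiction s∈ t∉
    crossing {S} (_◅_ {j = w} sw path) s∈ t∉ with w ∈?ᵥ S
    ... | yes w∈ = crossing path w∈ t∉
    ... | no w∉ = _ , _ , s∈ , w∉ , sw

    complete : ∀ f s S → s ∈ S → Unique S → size ≤ f + length S → Partial S →
      Σ (List V) λ S → (∀ x → x ∈ S) × Partial S
    complete f s S s∈ S! le part with Finₚ.all? (_∈?ᵥ S)
    ... | yes all = S , all , part
    ... | no ¬all with Finₚ.¬∀⟶∃¬ size (_∈ S) (_∈?ᵥ S) ¬all
    complete zero s S s∈ S! le part | no ¬all | t , t∉ =
      contradiction (Unique-Fin-length (Unique-cons t∉ S!)) (<⇒≱ (s≤s le))
    complete (suc f) s S s∈ S! le part | no ¬all | t , t∉ with crossing (connected s t) s∈ t∉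
    ... | u , v , u∈ , v∉ , uv = complete f s (v ∷ S) (there s∈) (Unique-cons v∉ S!)
            (≤-trans le (≤-reflexive (sym (+-suc f (length S)))))
            (Extend.extend part (Unique-Fin-length (Unique-cons v∉ S!)) u∈ v∉ uv)

    singleton : ∀ s b → (b , ℓ s) ∈ Q → Partial (s ∷ [])
    singleton s b b∈ = record
      { π = λ _ → b
      ; inQ = λ { x (here refl) → b∈ }
      ; inj = λ { x y (here refl) (here refl) _ → refl }
      ; mono = λ { x y (here refl) (here refl) ((_ , x≢x) , _) → contradiction refl x≢x }
      ; paths = λ { x y (here refl) (here refl) → _ , stop (here refl) } }

    -- Induction on a bound g for the difference of levels. Whether y covers x cannot be decided,
    -- but inclusion of sets can: if it failed, no z could lie strictly between x and y, as the
    -- induction hypothesis would give the inclusion through z. So y would cover x, and the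
    -- inclusion would hold after all.
    monotone : (π : V → Subset n) → (∀ x y → Covers P y x → π x ⊂ π y) →
      ∀ g x y → ℓ y ≤ g + ℓ x → x ≤P y → π x ⊆ π y
    monotone π mono g x y le x≤y with x Fin.≟ y
    ... | yes refl = ⊆-refl
    monotone π mono zero x y le x≤y | no x≢y = contradiction le (<⇒≱ (ℓ-mono x y (x≤y , x≢y)))
    monotone π mono (suc g) x y le x≤y | no x≢y = decidable-stable (π x ⊆? π y) (λ ¬⊆ →
      ¬⊆ (proj₁ (mono x y ((x≤y , x≢y) , λ (z , x<z , z<y) → ¬⊆ (⊆-trans
        (monotone π mono g x z (≤-pred (≤-trans (ℓ-mono z y z<y) le)) (proj₁ x<z))
        (monotone π mono g z y (≤-trans le (≤-trans (≤-reflexive (sym (+-suc g (ℓ x)))) (+-monoʳ-≤ g (ℓ-mono x z x<z)))) (proj₁ z<y)))))))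

    contains : V → ∃ (_∈ Q) → Contains P F
    contains s (q@(a , i) , q∈) = finish (complete size s (s ∷ []) (here refl) ([] ∷ []) (m≤m+n size 1) (singleton s (proj₁ start) (proj₂ start)))
      where
      0<size : 0 < size
      0<size = ≤-trans (s≤s z≤n) (Finₚ.toℕ<n s)
      -- The given state may lie on any level i; from there the walks reach the level prescribed for
      -- s.
      start : ∃ λ b → (b , ℓ s) ∈ Q
      start with <-cmp i (ℓ s)
      ... | B.tri≈ _ refl _ = a , q∈
      ... | B.tri< i<s _ _ with reachUp [] 0<size q∈ i<s (ℓ<k s)
      ...   | b , b∈ , _ = b , b∈
      start | B.tri> _ _ s<i with reachDown [] 0<size q∈ s<i
      ...   | b , b∈ , _ = b , b∈
      finish : (Σ (List V) λ S → (∀ x → x ∈ S) × Partial S) → Contains P F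
      finish (S , all , part) = π , (λ x y → inj x y (all x) (all y)) , (λ x → Q-sound _ (inQ x (all x)))
        , λ x y → monotone π (λ x y → mono x y (all x) (all y)) (ℓ y) x y (m≤m+n (ℓ y) (ℓ x))
        where open Partial part

-- Covering the P-free families

subsets : ∀ n → List (Subset n)
subsets zero    = [] ∷ []
subsets (suc n) = map (outside ∷_) (subsets n) ++ map (inside ∷_) (subsets n)

∈-subsets : ∀ {n} (a : Subset n) → a ∈ subsets n
∈-subsets []            = here refl
∈-subsets (outside ∷ a) = ∈-++⁺ˡ (∈-map⁺ (outside ∷_) (∈-subsets a))
∈-subsets (inside ∷ a)  = ∈-++⁺ʳ _ (∈-map⁺ (inside ∷_) (∈-subsets a))

disjoint-heads : ∀ {n} (as bs : List (Subset n)) {v} → ¬ (v ∈ map (outside ∷_) as × v ∈ map (inside ∷_) bs)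
disjoint-heads as bs (p , q) with ∈-map⁻ (outside ∷_) p | ∈-map⁻ (inside ∷_) q
... | _ , _ , refl | _ , _ , ()

Unique-subsets : ∀ n → Unique (subsets n)
Unique-subsets zero    = [] ∷ []
Unique-subsets (suc n) = Uniqueₚ.++⁺ (Uniqueₚ.map⁺ Vecₚ.∷-injectiveʳ (Unique-subsets n))
  (Uniqueₚ.map⁺ Vecₚ.∷-injectiveʳ (Unique-subsets n)) (disjoint-heads (subsets n) (subsets n))

length-subsets : ∀ n → length (subsets n) ≡ 2 ^ n
length-subsets zero    = refl
length-subsets (suc n) = trans (length-++ (map (outside ∷_) (subsets n)))
  (cong₂ _+_ (trans (length-map _ (subsets n)) (length-subsets n))
             (trans (length-map _ (subsets n)) (trans (length-subsets n) (sym (+-identityʳ _)))))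

members : ∀ {n} → Family n → List (Subset n)
members {n} G = filter (λ a → G a Boolₚ.≟ true) (subsets n)

∑-members : ∀ {n} (G : Family n) f → ∑ (members G) f ≡ ∑ (subsets n) (λ a → ind (G a) * f a)
∑-members {n} G f = trans (∑-filter (λ a → G a Boolₚ.≟ true) (subsets n) f)
  (∑-cong (subsets n) λ a _ → cong (_* f a) (ind-≟ (G a)))
  where
  ind-≟ : ∀ b → ind (does (b Boolₚ.≟ true)) ≡ ind b
  ind-≟ true  = refl
  ind-≟ false = refl

AverageDegree≤ : ∀ {n} → ℕ → Family n → Set
AverageDegree≤ D G = ∑ (members G) (λ a → ∑ (members G) (adj a)) ≤ D * length (members G)

-- Markov: at most half of the members have degree at least 8d.
members-≤ : ∀ {n} d {Δ L} → 1 ≤ d → 8 * d ≤ Δ →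
  (∀ (A : List (Subset n)) → Unique A → (∀ u → u ∈ A → ∑ A (adj u) < Δ) → length A ≤ L) →
  ∀ (G : Family n) → AverageDegree≤ (4 * d) G → length (members G) ≤ L + L
members-≤ {n} d {Δ} {L} 1≤d 8d≤Δ small G average = begin
  length A                      ≡⟨ length-filter-split heavy? A ⟩
  length heavy + length light   ≤⟨ +-mono-≤ (≤-trans heavy≤light light≤L) light≤L ⟩
  L + L                         ∎
  where
  open ≤-Reasoning
  A = members G
  A! : Unique A
  A! = Uniqueₚ.filter⁺ (λ a → G a Boolₚ.≟ true) (Unique-subsets n)
  deg : Subset n → ℕ
  deg a = ∑ A (adj a)
  heavy? : ∀ a → Dec (8 * d ≤ deg a)
  heavy? a = 8 * d ≤? deg a
  heavy = filter heavy? A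
  light = filter (¬? ∘ heavy?) A
  light≤L : length light ≤ L
  light≤L = small light (Uniqueₚ.filter⁺ (¬? ∘ heavy?) A!) λ u u∈ →
    ≤-<-trans (filter-∑-≤ (¬? ∘ heavy?) A (adj u)) (<-≤-trans (≰⇒> (proj₂ (∈-filter⁻ (¬? ∘ heavy?) {xs = A} u∈))) 8d≤Δ)
  heavy≤light : length heavy ≤ length light
  heavy≤light = +-cancelˡ-≤ (length heavy) _ _ (*-cancelˡ-≤ (4 * d) {{>-nonZero (*-mono-≤ (s≤s {0} {3} z≤n) 1≤d)}} (begin
    4 * d * (length heavy + length heavy)   ≡⟨ double d (length heavy) ⟩
    length heavy * (8 * d)                  ≡⟨ ∑-const heavy (8 * d) ⟨
    ∑ heavy (λ _ → 8 * d)                   ≤⟨ ∑-mono heavy (λ a a∈ → proj₂ (∈-filter⁻ heavy? {xs = A} a∈)) ⟩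
    ∑ heavy deg                             ≤⟨ filter-∑-≤ heavy? A deg ⟩
    ∑ A deg                                 ≤⟨ average ⟩
    4 * d * length A                        ≡⟨ cong (4 * d *_) (length-filter-split heavy? A) ⟩
    4 * d * (length heavy + length light)   ∎))
    where
    double : ∀ d h → 4 * d * (h + h) ≡ h * (8 * d)
    double = solve-∀

-- At the start there are no hits, so the potential is (r + 1) 2^n and the cost of G is its degree
-- sum. By the average degree and `members-≤` the latter is at most 4d · 2L.
sparse-cover : ∀ {n} d {t Δ r L q} → 1 ≤ t → t * t ^ Δ ≤ suc t ^ Δ → 1 ≤ d → 8 * d ≤ Δ →
  (∀ (A : List (Subset n)) → Unique A → (∀ u → u ∈ A → ∑ A (adj u) < Δ) → length A ≤ L) →
  4 * d * (L + L) < suc q * r → ∀ {Ψ} → suc r * 2 ^ n ≤ Ψ →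
  ∃ λ Gs → length Gs * t ^ Ψ ≤ 2 ^ L * t ^ q * suc t ^ Ψ
         × (∀ (G : Family n) → AverageDegree≤ (4 * d) G → Any (G ≈F_) Gs)
sparse-cover {n} d {t} {Δ} {r} {L} {q} 1≤t growth 1≤d 8d≤Δ small budget {Ψ} Ψ-large
  with cover (length (subsets n)) (subsets n) (λ _ → 0) q ≤-refl (Unique-subsets n)
  where open SparseCover _≟ₛ_ adj adj≤1 adj-sym adj-irrefl t Δ r L 1≤t growth small
... | Gs , bnd , cov = Gs , Bound.unbound (Bound-mono (subst (_≤ Ψ) (sym potential≡) Ψ-large) bnd)
    , λ G average → Any.map (λ ag a → ag a (∈-subsets a)) (cov G (≤-<-trans (cost≤ G average) budget))
  where
  open SparseCover _≟ₛ_ adj adj≤1 adj-sym adj-irrefl t Δ r L 1≤t growth small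
  open ≤-Reasoning
  potential≡ : potential (subsets n) (λ _ → 0) ≡ suc r * 2 ^ n
  potential≡ = trans (∑-const (subsets n) (suc r)) (trans (*-comm (length (subsets n)) (suc r)) (cong (suc r *_) (length-subsets n)))
  cost≤ : ∀ G → AverageDegree≤ (4 * d) G → cost (subsets n) (λ _ → 0) G ≤ 4 * d * (L + L)
  cost≤ G average = begin
    cost (subsets n) (λ _ → 0) G                          ≡⟨ ∑-cong (subsets n) (λ a _ → cong (ind (G a) *_) (sym (∑-members G (adj a)))) ⟩
    ∑ (subsets n) (λ a → ind (G a) * ∑ (members G) (adj a)) ≡⟨ ∑-members G _ ⟨
    ∑ (members G) (λ a → ∑ (members G) (adj a))           ≤⟨ average ⟩
    4 * d * length (members G)                            ≤⟨ *-monoʳ-≤ (4 * d) (members-≤ d 1≤d 8d≤Δ small G average) ⟩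
    4 * d * (L + L)                                       ∎

-- Unions of colour classes

length-cartesianProductWith : ∀ {A B C : Set} (f : A → B → C) xs ys →
  length (cartesianProductWith f xs ys) ≡ length xs * length ys
length-cartesianProductWith f []       ys = refl
length-cartesianProductWith f (x ∷ xs) ys = trans (length-++ (map (f x) ys))
  (cong₂ _+_ (length-map (f x) ys) (length-cartesianProductWith f xs ys))

_∪ᶠ_ : ∀ {n} → Family n → Family n → Family n
(G ∪ᶠ H) a = G a ∨ H a

⋃ᶠ : ∀ {n} → (ℕ → Family n) → ℕ → Family n
⋃ᶠ Cs zero    a = false
⋃ᶠ Cs (suc c)   = Cs c ∪ᶠ ⋃ᶠ Cs c

⋃ᶠ-true : ∀ {n} (Cs : ℕ → Family n) {i c a} → i < c → Cs i a ≡ true → ⋃ᶠ Cs c a ≡ true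
⋃ᶠ-true Cs {i} {suc c} {a} i<c t with m≤n⇒m<n∨m≡n (≤-pred i<c)
... | inj₂ refl rewrite t = refl
... | inj₁ lt rewrite ⋃ᶠ-true Cs lt t = Boolₚ.∨-zeroʳ (Cs c a)

⋃ᶠ-false : ∀ {n} (Cs : ℕ → Family n) c {a} → (∀ i → Cs i a ≡ false) → ⋃ᶠ Cs c a ≡ false
⋃ᶠ-false Cs zero    h = refl
⋃ᶠ-false Cs (suc c) h rewrite h c = ⋃ᶠ-false Cs c h

unions : ∀ {n} → List (Family n) → ℕ → List (Family n)
unions Gs zero    = (λ _ → false) ∷ []
unions Gs (suc c) = cartesianProductWith _∪ᶠ_ Gs (unions Gs c)

length-unions : ∀ {n} (Gs : List (Family n)) c → length (unions Gs c) ≡ length Gs ^ c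
length-unions Gs zero    = refl
length-unions Gs (suc c) = trans (length-cartesianProductWith _∪ᶠ_ Gs (unions Gs c)) (cong (length Gs *_) (length-unions Gs c))

unions-cover : ∀ {n} (Gs : List (Family n)) (Cs : ℕ → Family n) → (∀ i → Any (Cs i ≈F_) Gs) →
  ∀ c → Any (⋃ᶠ Cs c ≈F_) (unions Gs c)
unions-cover Gs Cs h zero    = here λ _ → refl
unions-cover Gs Cs h (suc c) = Anyₚ.cartesianProductWith⁺ _∪ᶠ_ (λ e e′ a → cong₂ _∨_ (e a) (e′ a)) (h c) (unions-cover Gs Cs h c)

card-≤ : ∀ {P n N} (Gs : List (Family n)) → HasCard (PFreeFamily P n) (_≈PF_ {P} {n}) N →
  (∀ F → ¬ Contains P F → Any (F ≈F_) Gs) → N ≤ length Gs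
card-≤ {P} {n} {N} Gs (e , e-inj , _) cov = Finₚ.injective⇒≤ {f = λ i → Any.index (at i)} λ {i} {j} eqᵢⱼ →
  e-inj i j λ a → trans (Anyₚ.lookup-index (at i) a)
    (trans (cong (λ z → lookup Gs z a) eqᵢⱼ) (sym (Anyₚ.lookup-index (at j) a)))
  where
  at : ∀ i → Any (proj₁ (e i) ≈F_) Gs
  at i = cov (proj₁ (e i)) (proj₂ (e i))

module _ (P : FinPoset) (k : ℕ) (tree : IsTreePoset P) (1≤k : 1 ≤ k)
  (leveling : Σ (Fin (FinPoset.size P) → ℕ) λ ℓ → (∀ x → ℓ x < k) × (∀ x y → _<P_ P x y → ℓ x < ℓ y)) where
  open FinPoset P

  -- Peeling gets stuck only on a core into which P embeds, so a P-free family is fully peeled.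
  pfree-decomposition : ∀ {n} (F : Family n) → ¬ Contains P F →
    Σ (ℕ → Family n) λ Cs → (∀ c → AverageDegree≤ (4 * size) (Cs c)) × (F ≈F ⋃ᶠ Cs (k ∸ 1))
  pfree-decomposition {n} F free = decompose (peel (length Q) Q ≤-refl Q!)
    where
    open Peeling {n} size k
    inF? : ∀ a → Dec (F a ≡ true)
    inF? a = F a Boolₚ.≟ true
    Q : List State
    Q = cartesianProduct (members F) (upTo k)
    Q! : Unique Q
    Q! = Uniqueₚ.cartesianProduct⁺ (Uniqueₚ.filter⁺ inF? (Unique-subsets n)) (Uniqueₚ.upTo⁺ k)
    Q-sound : ∀ q → q ∈ Q → F (proj₁ q) ≡ true
    Q-sound q q∈ = proj₂ (∈-filter⁻ inF? {xs = subsets n} (proj₁ (∈-cartesianProduct⁻ (members F) (upTo k) q∈)))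
    Q-complete : ∀ a i → F a ≡ true → i < k → (a , i) ∈ Q
    Q-complete a i Fa i<k = ∈-cartesianProduct⁺ (∈-filter⁺ inF? (∈-subsets a) Fa) (∈-upTo⁺ i<k)
    decompose : GoodCore Q ⊎ PeelOrder Q → _
    decompose (inj₁ (R , good , R⊆Q , nonempty)) = contradiction
      (Embedding.contains P (proj₁ (proj₂ tree)) (proj₂ (proj₂ tree)) (proj₁ leveling) (proj₁ (proj₂ leveling)) (proj₂ (proj₂ leveling))
        F R (λ q q∈ → Q-sound q (R⊆Q q q∈)) good (Fin.fromℕ< (proj₁ tree)) nonempty)
      free
    decompose (inj₂ (R , p , peeled)) = Cs , sparse , F≈
      where
      open Colour (Orientation-↭ p (orient peeled)) F Q-complete
      Cs : ℕ → Family n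
      Cs c a = F a ∧ does (colour a ≟ c)
      Cs-class : ∀ c a → Cs c a ≡ true → InClass c a
      Cs-class c a = split (colour a ≟ c)
        where
        split : (e? : Dec (colour a ≡ c)) → F a ∧ does e? ≡ true → InClass c a
        split (yes e) t = trans (sym (Boolₚ.∧-identityʳ (F a))) t , e
        split (no _)  t = contradiction (trans (sym (Boolₚ.∧-zeroʳ (F a))) t) λ ()
      sparse : ∀ c → AverageDegree≤ (4 * size) (Cs c)
      sparse c = class-sparse c 1≤k (members (Cs c)) (Uniqueₚ.filter⁺ (λ a → Cs c a Boolₚ.≟ true) (Unique-subsets n))
        λ a a∈ → Cs-class c a (proj₂ (∈-filter⁻ (λ a → Cs c a Boolₚ.≟ true) {xs = subsets n} a∈))
      F≈ : F ≈F ⋃ᶠ Cs (k ∸ 1)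
      F≈ a with F a in Fa
      ... | false = sym (⋃ᶠ-false Cs (k ∸ 1) λ i → cong (_∧ does (colour a ≟ i)) Fa)
      ... | true  = sym (⋃ᶠ-true Cs (proj₁ (colour-spec a Fa 1≤k)) (own (colour a ≟ colour a)))
        where
        own : (d : Dec (colour a ≡ colour a)) → F a ∧ does d ≡ true
        own (yes _) rewrite Fa = refl
        own (no ¬e) = contradiction refl ¬e

  -- Each of the k - 1 colour classes agrees with an entry of Gs, so P-free families are among the
  -- unions of k - 1 entries.
  count-≤ : ∀ {n N} (Gs : List (Family n)) → HasCard (PFreeFamily P n) (_≈PF_ {P} {n}) N →
    (∀ (G : Family n) → AverageDegree≤ (4 * size) G → Any (G ≈F_) Gs) → N ≤ length Gs ^ (k ∸ 1)
  count-≤ {n} {N} Gs card cov = subst (N ≤_) (length-unions Gs (k ∸ 1)) (card-≤ {P} (unions Gs (k ∸ 1)) card λ F free →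
    case pfree-decomposition F free of λ (Cs , sparse , F≈) →
      Any.map (λ e a → trans (F≈ a) (e a)) (unions-cover Gs Cs (λ i → cov (Cs i) (sparse i)) (k ∸ 1)))

-- Families in k - 1 middle layers

layer : ∀ n → ℕ → List (Subset n)
layer zero    zero    = [] ∷ []
layer zero    (suc j) = []
layer (suc n) zero    = map (outside ∷_) (layer n zero)
layer (suc n) (suc j) = map (outside ∷_) (layer n (suc j)) ++ map (inside ∷_) (layer n j)

length-layer : ∀ n j → length (layer n j) ≡ n C j
length-layer zero    zero    = refl
length-layer zero    (suc j) = refl
length-layer (suc n) zero    = trans (length-map _ (layer n zero)) (length-layer n zero)
length-layer (suc n) (suc j) = begin
  length (map (outside ∷_) (layer n (suc j)) ++ map (inside ∷_) (layer n j))  ≡⟨ length-++ (map (outside ∷_) (layer n (suc j))) ⟩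
  _ + length (map (inside ∷_) (layer n j))  ≡⟨ cong₂ _+_ (trans (length-map _ (layer n (suc j))) (length-layer n (suc j))) (trans (length-map _ (layer n j)) (length-layer n j)) ⟩
  n C suc j + n C j                                                            ≡⟨ +-comm (n C suc j) (n C j) ⟩
  n C j + n C suc j                                                            ≡⟨ nCk+nC[k+1]≡[n+1]C[k+1] n j ⟩
  suc n C suc j                                                                ∎
  where
  open ≡-Reasoning

∈-layer : ∀ n j {a} → a ∈ layer n j → ∣ a ∣ ≡ j
∈-layer zero    zero    (here refl) = refl
∈-layer (suc n) zero    a∈ with ∈-map⁻ _ a∈
... | b , b∈ , refl = ∈-layer n zero b∈
∈-layer (suc n) (suc j) a∈ with ∈-++⁻ (map (outside ∷_) (layer n (suc j))) a∈
... | inj₁ i with ∈-map⁻ _ i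
...   | b , b∈ , refl = ∈-layer n (suc j) b∈
∈-layer (suc n) (suc j) a∈ | inj₂ i with ∈-map⁻ _ i
...   | b , b∈ , refl = cong suc (∈-layer n j b∈)

Unique-layer : ∀ n j → Unique (layer n j)
Unique-layer zero    zero    = [] ∷ []
Unique-layer zero    (suc j) = []
Unique-layer (suc n) zero    = Uniqueₚ.map⁺ Vecₚ.∷-injectiveʳ (Unique-layer n zero)
Unique-layer (suc n) (suc j) = Uniqueₚ.++⁺ (Uniqueₚ.map⁺ Vecₚ.∷-injectiveʳ (Unique-layer n (suc j)))
  (Uniqueₚ.map⁺ Vecₚ.∷-injectiveʳ (Unique-layer n j)) (disjoint-heads (layer n (suc j)) (layer n j))

layersBelow : ∀ n c → ℕ → List (Subset n)
layersBelow n c zero    = []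
layersBelow n c (suc w) = layer n (c ∸ w) ++ layersBelow n c w

∈-layersBelow : ∀ n c w {a} → a ∈ layersBelow n c w → ∃ λ i → i < w × ∣ a ∣ ≡ c ∸ i
∈-layersBelow n c (suc w) a∈ with ∈-++⁻ (layer n (c ∸ w)) a∈
... | inj₁ i = w , ≤-refl , ∈-layer n (c ∸ w) i
... | inj₂ i with ∈-layersBelow n c w i
...   | j , j<w , e = j , m<n⇒m<1+n j<w , e

Unique-layersBelow : ∀ n c w → w ≤ c → Unique (layersBelow n c w)
Unique-layersBelow n c zero    _   = []
Unique-layersBelow n c (suc w) w<c = Uniqueₚ.++⁺ (Unique-layer n (c ∸ w)) (Unique-layersBelow n c w (<⇒≤ w<c)) disjoint
  where
  disjoint : ∀ {v} → ¬ (v ∈ layer n (c ∸ w) × v ∈ layersBelow n c w)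
  disjoint (p , q) with ∈-layersBelow n c w q
  ... | i , i<w , e = <-irrefl (trans (sym (∈-layer n (c ∸ w) p)) e) (∸-monoʳ-< {c} i<w (<⇒≤ w<c))

module Subfamilies {n : ℕ} where
  open Update {B = Bool} (_≟ₛ_ {n})

  subfamily : (U : List (Subset n)) → Vec Bool (length U) → Family n
  subfamily []      []      = λ _ → false
  subfamily (u ∷ U) (b ∷ v) = update u b (subfamily U v)

  subfamily-⊆ : ∀ U v {a} → subfamily U v a ≡ true → a ∈ U
  subfamily-⊆ (u ∷ U) (b ∷ v) {a} t with a ≟ₛ u
  ... | yes refl = here refl
  ... | no a≢u  = there (subfamily-⊆ U v t)
  subfamily-⊆ [] [] ()

  subfamily-injective : ∀ {U} → Unique U → ∀ v w → (∀ a → a ∈ U → subfamily U v a ≡ subfamily U w a) → v ≡ w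
  subfamily-injective {[]}    _  []      []      h = refl
  subfamily-injective {u ∷ U} U! (b ∷ v) (c ∷ w) h = cong₂ _∷_
    (trans (sym (update-self u b (subfamily U v))) (trans (h u (here refl)) (update-self u c (subfamily U w))))
    (subfamily-injective (AllPairs.tail U!) v w λ a a∈ →
      trans (sym (update-other u b (subfamily U v) (a≢u a∈))) (trans (h a (there a∈)) (update-other u c (subfamily U w) (a≢u a∈))))
    where
    a≢u : ∀ {a} → a ∈ U → a ≢ u
    a≢u a∈ refl = Unique-∉ U! a∈

open Subfamilies

card-≥ : ∀ {P n N} (U : List (Subset n)) → Unique U → HasCard (PFreeFamily P n) (_≈PF_ {P} {n}) N →
  (∀ F → (∀ a → F a ≡ true → a ∈ U) → ¬ Contains P F) → 2 ^ length U ≤ N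
card-≥ {P} {n} {N} U U! (e , _ , e-surj) free = begin
  2 ^ length U                                 ≡⟨ length-subsets (length U) ⟨
  length (subsets (length U))                  ≡⟨ length-map index (subsets (length U)) ⟨
  length (map index (subsets (length U)))      ≤⟨ Unique-Fin-length (Uniqueₚ.map⁺ index-injective (Unique-subsets (length U))) ⟩
  N                                            ∎
  where
  open ≤-Reasoning
  pick : ∀ v → ∃ λ i → _≈PF_ {P} {n} (e i) (subfamily U v , free (subfamily U v) (λ a → subfamily-⊆ U v))
  pick v = e-surj (subfamily U v , free (subfamily U v) (λ a → subfamily-⊆ U v))
  index : Vec Bool (length U) → Fin N
  index v = proj₁ (pick v)
  index-injective : ∀ {v w} → index v ≡ index w → v ≡ w
  index-injective {v} {w} eq = subfamily-injective U! v w λ a _ →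
    trans (sym (proj₂ (pick v) a)) (trans (cong (λ i → proj₁ (e i) a) eq) (proj₂ (pick w) a))

size-injective : ∀ {n} {a b : Subset n} → a ⊆ b → ∣ a ∣ ≡ ∣ b ∣ → a ≡ b
size-injective {a = a} {b} a⊆b e = decidable-stable (a ≟ₛ b) λ a≢b → <-irrefl e (p⊂q⇒∣p∣<∣q∣ (⊆∧≢⇒⊂ a⊆b a≢b))

-- The images of a chain of k elements form a chain of distinct sets and so have k distinct sizes,
-- while the layers offer only k - 1.
few-layers-free : ∀ (P : FinPoset) {k xs} → IsChain P xs → length xs ≡ k → 1 ≤ k → ∀ {n} c (F : Family n) →
  (∀ a → F a ≡ true → a ∈ layersBelow n c (k ∸ 1)) → ¬ Contains P F
few-layers-free P {k} {xs} (xs! , cmp) refl 1≤k {n} c F F⊆ (π , π-inj , π∈F , π-mono) =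
  <⇒≱ (∸-monoʳ-< {k} z<s 1≤k) (begin
    length xs                          ≡⟨ length-map size xs ⟨
    length (map size xs)               ≤⟨ Unique-length-≤ sizes! sizes∈ ⟩
    length (map (c ∸_) (upTo (k ∸ 1))) ≡⟨ trans (length-map (c ∸_) (upTo (k ∸ 1))) (length-upTo (k ∸ 1)) ⟩
    k ∸ 1                              ∎)
  where
  open ≤-Reasoning
  size : Fin (FinPoset.size P) → ℕ
  size x = ∣ π x ∣
  distinct : ∀ {x y} → x ≢ y × Comparable P x y → size x ≢ size y
  distinct {x} {y} (x≢y , inj₁ x≤y) e = x≢y (π-inj x y (size-injective (π-mono x y x≤y) e))
  distinct {x} {y} (x≢y , inj₂ y≤x) e = x≢y (sym (π-inj y x (size-injective (π-mono y x y≤x) (sym e))))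
  sizes! : Unique (map size xs)
  sizes! = AllPairsₚ.map⁺ (AllPairs.zipWith distinct (xs! , cmp))
  sizes∈ : ∀ s → s ∈ map size xs → s ∈ map (c ∸_) (upTo (k ∸ 1))
  sizes∈ s s∈ with ∈-map⁻ size s∈
  ... | x , _ , refl with ∈-layersBelow n c (k ∸ 1) (F⊆ (π x) (π∈F x))
  ...   | i , i< , e = subst (_∈ map (c ∸_) (upTo (k ∸ 1))) (sym e) (∈-map⁺ (c ∸_) (∈-upTo⁺ i<))

nC[j+1]*[j+1]≡nCj*[n∸j] : ∀ {n j} → j < n → (n C suc j) * suc j ≡ (n C j) * (n ∸ j)
nC[j+1]*[j+1]≡nCj*[n∸j] {n} {j} j<n = *-cancelʳ-≡ _ _ (j ! * r !) {{j !* r !≢0}} (begin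
  (n C suc j) * suc j * (j ! * r !)     ≡⟨ left (n C suc j) (suc j) (j !) (r !) ⟩
  (n C suc j) * (suc j ! * r !)         ≡⟨ nCk*k!*[n∸k]!≡n! j<n ⟩
  n !                                   ≡⟨ nCk*k!*[n∸k]!≡n! (<⇒≤ j<n) ⟨
  (n C j) * (j ! * (n ∸ j) !)           ≡⟨ cong (λ z → (n C j) * (j ! * z !)) n∸j≡ ⟩
  (n C j) * (j ! * (suc r * r !))       ≡⟨ right (n C j) (suc r) (j !) (r !) ⟩
  (n C j) * suc r * (j ! * r !)         ≡⟨ cong (λ z → (n C j) * z * (j ! * r !)) n∸j≡ ⟨
  (n C j) * (n ∸ j) * (j ! * r !)       ∎)
  where
  open ≡-Reasoning
  r = n ∸ suc j
  n∸j≡ : n ∸ j ≡ suc r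
  n∸j≡ = +-∸-assoc 1 j<n
  left : ∀ a b c d → a * b * (c * d) ≡ a * (b * c * d)
  left = solve-∀
  right : ∀ a b c d → a * (c * (b * d)) ≡ a * b * (c * d)
  right = solve-∀

module NearCentral (n M w : ℕ) (wide : (2 * w + 2) * M ≤ n / 2) (w≤ : w ≤ n / 2) where
  c = n / 2
  C₀ = centralBinom n

  level : ℕ → ℕ
  level i = n C (c ∸ i)

  -- The ratio of level i to level i + 1 is at most (c + i + 2)/(c - i). Numerator and denominator
  -- differ by 2i + 2, which by `wide` is at most a fraction 1/M of the numerator, so one step down
  -- loses at most C₀/M.
  level-step : ∀ i → i < w → M * level i ≤ M * level (suc i) + C₀
  level-step i i<w = *-cancelʳ-≤ _ _ (c + i + 2) {{>-nonZero (≤-trans (s≤s z≤n) (m≤n+m 2 (c + i)))}} (begin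
    M * level i * (c + i + 2)                                 ≡⟨ cong (M * level i *_) c+i+2≡ ⟩
    M * level i * ((c ∸ i) + (2 * i + 2))                     ≡⟨ e₁ M (level i) (c ∸ i) (2 * i + 2) ⟩
    M * (level i * (c ∸ i)) + level i * ((2 * i + 2) * M)     ≤⟨ +-mono-≤ (*-monoʳ-≤ M ratio) (*-mono-≤ (nCk≤centralBinom n (c ∸ i)) small) ⟩
    M * (level (suc i) * (c + i + 2)) + C₀ * (c + i + 2)      ≡⟨ e₂ M (level (suc i)) C₀ (c + i + 2) ⟩
    (M * level (suc i) + C₀) * (c + i + 2)                    ∎)
    where
    open ≤-Reasoning
    i<c : i < c
    i<c = <-≤-trans i<w w≤
    c+i+2≡ : c + i + 2 ≡ (c ∸ i) + (2 * i + 2)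
    c+i+2≡ = trans (cong (λ z → z + i + 2) (sym (m∸n+n≡m (<⇒≤ i<c)))) (e₀ (c ∸ i) i)
      where
      e₀ : ∀ a i → a + i + i + 2 ≡ a + (2 * i + 2)
      e₀ = solve-∀
    e₁ : ∀ M l a b → M * l * (a + b) ≡ M * (l * a) + l * (b * M)
    e₁ = solve-∀
    e₂ : ∀ M l d x → M * (l * x) + d * x ≡ (M * l + d) * x
    e₂ = solve-∀
    small : (2 * i + 2) * M ≤ c + i + 2
    small = ≤-trans (*-monoˡ-≤ M (+-monoˡ-≤ 2 (*-monoʳ-≤ 2 (<⇒≤ i<w)))) (≤-trans wide (≤-trans (m≤m+n c i) (m≤m+n (c + i) 2)))
    j = c ∸ suc i
    c∸i≡ : c ∸ i ≡ suc j
    c∸i≡ = +-∸-assoc 1 i<c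
    j<n : j < n
    j<n = subst (_≤ n) c∸i≡ (≤-trans (m∸n≤m c i) (n/2≤n n))
    ratio : level i * (c ∸ i) ≤ level (suc i) * (c + i + 2)
    ratio = begin
      level i * (c ∸ i)                ≡⟨ cong (λ z → (n C z) * z) c∸i≡ ⟩
      (n C suc j) * suc j              ≡⟨ nC[j+1]*[j+1]≡nCj*[n∸j] j<n ⟩
      level (suc i) * (n ∸ j)          ≤⟨ *-monoʳ-≤ (level (suc i)) n∸j≤ ⟩
      level (suc i) * (c + i + 2)      ∎
      where
      n∸j≤ : n ∸ j ≤ c + i + 2
      n∸j≤ = m≤n+o⇒m∸n≤o n j (begin
        n                          ≡⟨ m+[n∸m]≡n (n/2≤n n) ⟨
        c + (n ∸ c)                ≤⟨ +-monoʳ-≤ c (n∸n/2≤1+n/2 n) ⟩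
        c + suc c                  ≡⟨ cong (_+ suc c) (m∸n+n≡m i<c) ⟨
        (j + suc i) + suc c        ≡⟨ e₄ j i c ⟩
        j + (c + i + 2)            ∎)
        where
        e₄ : ∀ j i c → j + suc i + suc c ≡ j + (c + i + 2)
        e₄ = solve-∀

  level-bound : ∀ i → i ≤ w → M * C₀ ≤ M * level i + i * C₀
  level-bound zero    _   = m≤m+n _ _
  level-bound (suc i) i<w = begin
    M * C₀                              ≤⟨ level-bound i (<⇒≤ i<w) ⟩
    M * level i + i * C₀                ≤⟨ +-monoˡ-≤ (i * C₀) (level-step i i<w) ⟩
    M * level (suc i) + C₀ + i * C₀     ≡⟨ +-assoc (M * level (suc i)) C₀ _ ⟩
    M * level (suc i) + suc i * C₀      ∎
    where open ≤-Reasoning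

-- With M = m w, the losses of at most w steps add up to no more than C₀/m, so each of the w layers
-- has at least (1 - 1/m) C₀ members.
length-layersBelow-≥ : ∀ n m w → (2 * w + 2) * (m * w) ≤ n / 2 → w ≤ n / 2 →
  (m ∸ 1) * w * centralBinom n ≤ length (layersBelow n (n / 2) w) * m
length-layersBelow-≥ n m w wide w≤ = go w ≤-refl
  where
  open ≤-Reasoning
  open NearCentral n (m * w) w wide w≤
  level-≥ : ∀ i → i < w → (m ∸ 1) * C₀ ≤ level i * m
  level-≥ i i<w = begin
    (m ∸ 1) * C₀                ≡⟨ *-distribʳ-∸ C₀ m 1 ⟩
    m * C₀ ∸ 1 * C₀             ≤⟨ m≤n+o⇒m∸n≤o (m * C₀) (1 * C₀) main ⟩
    level i * m                 ∎
    where
    e₁ : ∀ m c w → m * c * w ≡ m * w * c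
    e₁ = solve-∀
    e₂ : ∀ m w l c → m * w * l + w * c ≡ (1 * c + l * m) * w
    e₂ = solve-∀
    main : m * C₀ ≤ 1 * C₀ + level i * m
    main = *-cancelʳ-≤ _ _ w {{>-nonZero (≤-trans (s≤s z≤n) i<w)}} (begin
      m * C₀ * w                      ≡⟨ e₁ m C₀ w ⟩
      m * w * C₀                      ≤⟨ level-bound i (<⇒≤ i<w) ⟩
      m * w * level i + i * C₀        ≤⟨ +-monoʳ-≤ (m * w * level i) (*-monoˡ-≤ C₀ (<⇒≤ i<w)) ⟩
      m * w * level i + w * C₀        ≡⟨ e₂ m w (level i) C₀ ⟩
      (1 * C₀ + level i * m) * w      ∎)
  go : ∀ v → v ≤ w → (m ∸ 1) * v * C₀ ≤ length (layersBelow n c v) * m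
  go zero    _   rewrite *-zeroʳ (m ∸ 1) = z≤n
  go (suc v) v<w = begin
    (m ∸ 1) * suc v * C₀                              ≡⟨ e (m ∸ 1) v C₀ ⟩
    (m ∸ 1) * C₀ + (m ∸ 1) * v * C₀                   ≤⟨ +-mono-≤ (level-≥ v v<w) (go v (<⇒≤ v<w)) ⟩
    level v * m + length (layersBelow n c v) * m      ≡⟨ *-distribʳ-+ m (level v) _ ⟨
    (level v + length (layersBelow n c v)) * m        ≡⟨ cong (λ z → (z + length (layersBelow n c v)) * m) (length-layer n (c ∸ v)) ⟨
    (length (layer n (c ∸ v)) + length (layersBelow n c v)) * m ≡⟨ cong (_* m) (length-++ (layer n (c ∸ v))) ⟨
    length (layersBelow n c (suc v)) * m              ∎
    where
    e : ∀ a v c → a * suc v * c ≡ a * c + a * v * c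
    e = solve-∀

lower-bound : ∀ P k → HasHeight P k → 1 ≤ k → ∀ n m N →
  HasCard (PFreeFamily P n) (_≈PF_ {P} {n}) N →
  (2 * (k ∸ 1) + 2) * (m * (k ∸ 1)) ≤ n / 2 → k ∸ 1 ≤ n / 2 →
  2 ^ ((m ∸ 1) * (k ∸ 1) * centralBinom n) ≤ N ^ m
lower-bound P k ((xs , chain , len) , _) 1≤k n m N card wide w≤ = begin
  2 ^ ((m ∸ 1) * (k ∸ 1) * centralBinom n)   ≤⟨ ^-monoʳ-≤ 2 (length-layersBelow-≥ n m (k ∸ 1) wide w≤) ⟩
  2 ^ (length U * m)                         ≡⟨ ^-*-assoc 2 (length U) m ⟨
  (2 ^ length U) ^ m                         ≤⟨ ^-monoˡ-≤ m (card-≥ {P} U (Unique-layersBelow n (n / 2) (k ∸ 1) w≤) card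
                                                  (few-layers-free P chain len 1≤k (n / 2))) ⟩
  N ^ m                                      ∎
  where
  open ≤-Reasoning
  U = layersBelow n (n / 2) (k ∸ 1)

-- Numerical estimates

^-distribʳ-* : ∀ n a b → (a * b) ^ n ≡ a ^ n * b ^ n
^-distribʳ-* zero    a b = refl
^-distribʳ-* (suc n) a b = trans (cong (a * b *_) (^-distribʳ-* n a b)) (interchange a b (a ^ n) (b ^ n))
  where
  interchange : ∀ a b x y → a * b * (x * y) ≡ a * x * (b * y)
  interchange = solve-∀

parity : ∀ n → ∃ λ m → n ≡ m + m ⊎ n ≡ suc (m + m)
parity zero = 0 , inj₁ refl
parity (suc n) with parity n
... | m , inj₁ refl = m , inj₂ refl
... | m , inj₂ refl = suc m , inj₁ (cong suc (sym (+-suc m m)))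

sq : ℕ → ℕ
sq a = a * a

-- 16^m ≤ (4m+1) C(2m,m)², cleared of denominators.
even-factorial-bound : ∀ m → 16 ^ m * sq (sq (m !)) ≤ (4 * m + 1) * sq ((m + m) !)
even-factorial-bound zero = ≤-refl
even-factorial-bound (suc m) = begin
  16 * 16 ^ m * sq (sq (suc m * m !))                        ≡⟨ e₁ m (16 ^ m) (m !) ⟩
  16 * sq (sq (suc m)) * (16 ^ m * sq (sq (m !)))            ≤⟨ *-monoʳ-≤ (16 * sq (sq (suc m))) (even-factorial-bound m) ⟩
  -- The added term is exactly the slack of the induction step, which turns `e₂` into a polynomial
  -- identity.
  16 * sq (sq (suc m)) * ((4 * m + 1) * sq f)                ≤⟨ m≤m+n _ (4 * sq (suc m) * sq f) ⟩
  16 * sq (sq (suc m)) * ((4 * m + 1) * sq f) + 4 * sq (suc m) * sq f ≡⟨ e₂ m f ⟩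
  (4 * suc m + 1) * sq (suc (suc (m + m)) * (suc (m + m) * f)) ≡⟨ cong (λ z → (4 * suc m + 1) * sq (suc z !)) (+-suc m m) ⟨
  (4 * suc m + 1) * sq ((suc m + suc m) !)                   ∎
  where
  open ≤-Reasoning
  f = (m + m) !
  e₁ : ∀ m x g → 16 * x * ((suc m * g) * (suc m * g) * ((suc m * g) * (suc m * g)))
       ≡ 16 * (suc m * suc m * (suc m * suc m)) * (x * (g * g * (g * g)))
  e₁ = solve-∀
  e₂ : ∀ m f → 16 * (suc m * suc m * (suc m * suc m)) * ((4 * m + 1) * (f * f)) + 4 * (suc m * suc m) * (f * f)
       ≡ (4 * suc m + 1) * ((suc (suc (m + m)) * (suc (m + m) * f)) * (suc (suc (m + m)) * (suc (m + m) * f)))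
  e₂ = solve-∀

-- The odd case follows from the even one by adding one element to one of the halves. The split is
-- left unspecified here; `!*!-minimal` later replaces it by the one at `n / 2`.
factorial-bound : ∀ n → ∃₂ λ a b → a + b ≡ n × 4 ^ n * sq (a ! * b !) ≤ (4 * n + 1) * sq (n !)
factorial-bound n with parity n
... | m , inj₁ refl = m , m , refl , (begin
    4 ^ (m + m) * sq (m ! * m !)          ≡⟨ cong₂ _*_ (trans (^-distribˡ-+-* 4 m m) (sym (^-distribʳ-* m 4 4))) refl ⟩
    16 ^ m * sq (sq (m !))                ≤⟨ even-factorial-bound m ⟩
    (4 * m + 1) * sq ((m + m) !)          ≤⟨ *-monoˡ-≤ (sq ((m + m) !)) (+-monoˡ-≤ 1 (*-monoʳ-≤ 4 (m≤m+n m m))) ⟩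
    (4 * (m + m) + 1) * sq ((m + m) !)    ∎)
    where
    open ≤-Reasoning
... | m , inj₂ refl = m , suc m , +-suc m m , (begin
    4 * 4 ^ (m + m) * sq (m ! * (suc m * m !))   ≡⟨ cong (λ z → 4 * z * sq (m ! * (suc m * m !))) (trans (^-distribˡ-+-* 4 m m) (sym (^-distribʳ-* m 4 4))) ⟩
    4 * 16 ^ m * sq (m ! * (suc m * m !))        ≡⟨ e₁ m (16 ^ m) (m !) ⟩
    4 * sq (suc m) * (16 ^ m * sq (sq (m !)))    ≤⟨ *-monoʳ-≤ (4 * sq (suc m)) (even-factorial-bound m) ⟩
    4 * sq (suc m) * ((4 * m + 1) * sq f)        ≤⟨ m≤m+n _ ((16 * (m * sq m) + 16 * sq m + 4 * m + 1) * sq f) ⟩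
    4 * sq (suc m) * ((4 * m + 1) * sq f) + (16 * (m * sq m) + 16 * sq m + 4 * m + 1) * sq f ≡⟨ e₂ m f ⟩
    (4 * suc (m + m) + 1) * sq (suc (m + m) * f) ∎)
    where
    open ≤-Reasoning
    f = (m + m) !
    e₁ : ∀ m x g → 4 * x * ((g * (suc m * g)) * (g * (suc m * g))) ≡ 4 * (suc m * suc m) * (x * (g * g * (g * g)))
    e₁ = solve-∀
    e₂ : ∀ m f → 4 * (suc m * suc m) * ((4 * m + 1) * (f * f)) + (16 * (m * (m * m)) + 16 * (m * m) + 4 * m + 1) * (f * f)
         ≡ (4 * suc (m + m) + 1) * ((suc (m + m) * f) * (suc (m + m) * f))
    e₂ = solve-∀

sq-cancel-≤ : ∀ a b → sq a ≤ sq b → a ≤ b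
sq-cancel-≤ a b le = ≮⇒≥ λ b<a → <⇒≱ (*-mono-< b<a b<a) le

4^n≤[4n+1]*centralBinom² : ∀ n → 4 ^ n ≤ (4 * n + 1) * sq (centralBinom n)
4^n≤[4n+1]*centralBinom² n with factorial-bound n
... | a , b , a+b≡n , bound = *-cancelʳ-≤ _ _ (sq W) {{>-nonZero (*-mono-≤ 1≤W 1≤W)}} (begin
    4 ^ n * sq W                                 ≤⟨ *-monoʳ-≤ (4 ^ n) (*-mono-≤ W≤ W≤) ⟩
    4 ^ n * sq (a ! * b !)                       ≤⟨ bound ⟩
    (4 * n + 1) * sq (n !)                       ≡⟨ cong (λ z → (4 * n + 1) * sq z) (nCk*k!*[n∸k]!≡n! (n/2≤n n)) ⟨
    (4 * n + 1) * sq (centralBinom n * W)        ≡⟨ e (4 * n + 1) (centralBinom n) W ⟩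
    (4 * n + 1) * sq (centralBinom n) * sq W     ∎)
    where
    open ≤-Reasoning
    W = (n / 2) ! * (n ∸ n / 2) !
    1≤W : 1 ≤ W
    1≤W = *-mono-≤ (1≤n! (n / 2)) (1≤n! (n ∸ n / 2))
    W≤ : W ≤ a ! * b !
    W≤ = !*!-minimal {a} {b} {n / 2} {n ∸ n / 2} (trans a+b≡n (sym (m+[n∸m]≡n (n/2≤n n)))) (n/2≤n∸n/2 n) (n∸n/2≤1+n/2 n)
    e : ∀ x c w → x * ((c * w) * (c * w)) ≡ x * (c * c) * (w * w)
    e = solve-∀

2^n≤s*centralBinom : ∀ n s → 4 * n + 1 ≤ sq s → 2 ^ n ≤ s * centralBinom n
2^n≤s*centralBinom n s le = sq-cancel-≤ _ _ (begin
  sq (2 ^ n)                      ≡⟨ ^-distribʳ-* n 2 2 ⟨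
  4 ^ n                           ≤⟨ 4^n≤[4n+1]*centralBinom² n ⟩
  (4 * n + 1) * sq (centralBinom n) ≤⟨ *-monoˡ-≤ _ le ⟩
  sq s * sq (centralBinom n)      ≡⟨ e s (centralBinom n) ⟩
  sq (s * centralBinom n)         ∎)
  where
  open ≤-Reasoning
  e : ∀ s c → s * s * (c * c) ≡ s * c * (s * c)
  e = solve-∀

-- (1 + 1/t)^s ≥ 1 + s/t
bernoulli : ∀ t s → t ^ s * (t + s) ≤ suc t ^ s * t
bernoulli t zero = ≤-reflexive (cong (1 *_) (+-identityʳ t))
bernoulli t (suc s) = begin
  t * t ^ s * (t + suc s)                  ≤⟨ m≤m+n _ (s * t ^ s) ⟩
  t * t ^ s * (t + suc s) + s * t ^ s      ≡⟨ e₁ t s (t ^ s) ⟩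
  suc t * (t ^ s * (t + s))                ≤⟨ *-monoʳ-≤ (suc t) (bernoulli t s) ⟩
  suc t * (suc t ^ s * t)                  ≡⟨ *-assoc (suc t) (suc t ^ s) t ⟨
  suc t * suc t ^ s * t                    ∎
  where
  open ≤-Reasoning
  e₁ : ∀ t s x → t * x * (t + suc s) + s * x ≡ suc t * (x * (t + s))
  e₁ = solve-∀

-- By `bernoulli` (1 + 1/t)^t ≥ 2, and the j-th power of this is (1 + 1/t)^Δ ≥ 2^j = t.
growth : ∀ j t Δ → t ≡ 2 ^ j → Δ ≡ t * j → t * t ^ Δ ≤ suc t ^ Δ
growth j t Δ refl refl = begin
  t * t ^ (t * j)           ≡⟨ cong (t *_) (^-*-assoc t t j) ⟨
  t * (t ^ t) ^ j           ≡⟨ ^-distribʳ-* j 2 (t ^ t) ⟨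
  (2 * t ^ t) ^ j           ≤⟨ ^-monoˡ-≤ j double ⟩
  (suc t ^ t) ^ j           ≡⟨ ^-*-assoc (suc t) t j ⟩
  suc t ^ (t * j)           ∎
  where
  open ≤-Reasoning
  e : ∀ x t → 2 * x * t ≡ x * (t + t)
  e = solve-∀
  double : 2 * t ^ t ≤ suc t ^ t
  double = *-cancelʳ-≤ _ _ t {{>-nonZero (m^n>0 2 j)}} (≤-trans (≤-reflexive (e (t ^ t) t)) (bernoulli t t))

-- (1 + 1/2u)^s ≤ 1 + s/u for s ≤ u
reverse-bernoulli : ∀ u s → s ≤ u → suc (2 * u) ^ s * u ≤ (2 * u) ^ s * (u + s)
reverse-bernoulli u zero _ = ≤-reflexive (cong (1 *_) (sym (+-identityʳ u)))
reverse-bernoulli u (suc s) s<u = begin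
  suc (2 * u) * suc (2 * u) ^ s * u              ≡⟨ *-assoc (suc (2 * u)) (suc (2 * u) ^ s) u ⟩
  suc (2 * u) * (suc (2 * u) ^ s * u)            ≤⟨ *-monoʳ-≤ (suc (2 * u)) (reverse-bernoulli u s (<⇒≤ s<u)) ⟩
  suc (2 * u) * (x * (u + s))                    ≡⟨ e₁ u s x ⟩
  2 * u * x * (u + s) + x * (u + s)              ≤⟨ +-monoʳ-≤ (2 * u * x * (u + s)) (*-monoʳ-≤ x (+-monoʳ-≤ u (<⇒≤ s<u))) ⟩
  2 * u * x * (u + s) + x * (u + u)              ≡⟨ e₂ u s x ⟩
  2 * u * x * (u + suc s)                        ∎
  where
  open ≤-Reasoning
  x = (2 * u) ^ s
  e₁ : ∀ u s x → suc (2 * u) * (x * (u + s)) ≡ 2 * u * x * (u + s) + x * (u + s)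
  e₁ = solve-∀
  e₂ : ∀ u s x → 2 * u * x * (u + s) + x * (u + u) ≡ 2 * u * x * (u + suc s)
  e₂ = solve-∀

-- `reverse-bernoulli` with s = u gives (1 + 1/2u)^u ≤ 2; the E-th power is taken.
slow-growth : ∀ u E → 1 ≤ u → suc (2 * u) ^ (u * E) ≤ 2 ^ E * (2 * u) ^ (u * E)
slow-growth u E 1≤u = begin
  suc (2 * u) ^ (u * E)           ≡⟨ ^-*-assoc (suc (2 * u)) u E ⟨
  (suc (2 * u) ^ u) ^ E           ≤⟨ ^-monoˡ-≤ E double ⟩
  (2 * (2 * u) ^ u) ^ E           ≡⟨ ^-distribʳ-* E 2 ((2 * u) ^ u) ⟩
  2 ^ E * ((2 * u) ^ u) ^ E       ≡⟨ cong (2 ^ E *_) (^-*-assoc (2 * u) u E) ⟩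
  2 ^ E * (2 * u) ^ (u * E)       ∎
  where
  open ≤-Reasoning
  e : ∀ x u → x * (u + u) ≡ 2 * x * u
  e = solve-∀
  double : suc (2 * u) ^ u ≤ 2 * (2 * u) ^ u
  double = *-cancelʳ-≤ _ _ u {{>-nonZero 1≤u}} (≤-trans (reverse-bernoulli u u ≤-refl) (≤-reflexive (e ((2 * u) ^ u) u)))

quotient : ∀ c z → 1 ≤ z → ∃ λ q → q * z ≤ c × c < suc q * z
quotient c (suc z) _ = c / suc z , m/n*n≤m c (suc z) , (begin-strict
  c                                     ≡⟨ m≡m%n+[m/n]*n c (suc z) ⟩
  c % suc z + c / suc z * suc z         <⟨ +-monoˡ-< (c / suc z * suc z) (m%n<n c (suc z)) ⟩
  suc z + c / suc z * suc z             ∎)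
  where open ≤-Reasoning

sq-suc≤4*2^ : ∀ i → sq (suc i) ≤ 4 * 2 ^ i
sq-suc≤4*2^ zero = s≤s z≤n
sq-suc≤4*2^ (suc zero) = s≤s (s≤s (s≤s (s≤s z≤n)))
sq-suc≤4*2^ (suc (suc zero)) = m≤m+n 9 7
sq-suc≤4*2^ (suc (suc (suc i))) = begin
  sq (4 + i)                       ≤⟨ m≤m+n _ (i * i + 4 * i + 2) ⟩
  sq (4 + i) + (i * i + 4 * i + 2) ≡⟨ e₁ i ⟩
  2 * sq (3 + i)                   ≤⟨ *-monoʳ-≤ 2 (sq-suc≤4*2^ (suc (suc i))) ⟩
  2 * (4 * (2 * (2 * 2 ^ i)))      ≡⟨ e₂ (2 ^ i) ⟩
  4 * (2 * (2 * (2 * 2 ^ i)))      ∎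
  where
  open ≤-Reasoning
  e₁ : ∀ i → (4 + i) * (4 + i) + (i * i + 4 * i + 2) ≡ 2 * ((3 + i) * (3 + i))
  e₁ = solve-∀
  e₂ : ∀ x → 2 * (4 * (2 * (2 * x))) ≡ 4 * (2 * (2 * (2 * x)))
  e₂ = solve-∀

linear≤2^ : ∀ K i → 4 * K ≤ i → K * suc i ≤ 2 ^ i
linear≤2^ K i 4K≤i = *-cancelˡ-≤ 4 (begin
  4 * (K * suc i)    ≡⟨ *-assoc 4 K (suc i) ⟨
  4 * K * suc i      ≤⟨ *-monoˡ-≤ (suc i) (≤-trans 4K≤i (n≤1+n i)) ⟩
  sq (suc i)         ≤⟨ sq-suc≤4*2^ i ⟩
  4 * 2 ^ i          ∎)
  where open ≤-Reasoning

logarithm : ∀ b n → 2 ≤ b → 1 ≤ n → ∃ λ i → b ^ i ≤ n × n < b ^ suc i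
logarithm b (suc zero) 2≤b _ = 0 , ≤-refl , subst (2 ≤_) (sym (*-identityʳ b)) 2≤b
logarithm b (suc (suc n)) 2≤b _ with logarithm b (suc n) 2≤b (s≤s z≤n)
... | i , lo , hi with m≤n⇒m<n∨m≡n hi
...   | inj₁ lt = i , m≤n⇒m≤1+n lo , lt
...   | inj₂ e  = suc i , ≤-reflexive (sym e) , subst (_< b * b ^ suc i) (sym e)
        (≤-trans (≤-reflexive (cong suc (sym (+-identityʳ _)))) (<-≤-trans (*-monoˡ-< (b ^ suc i) {{>-nonZero (subst (1 ≤_) e (s≤s z≤n))}} {1} {2} ≤-refl) (*-monoˡ-≤ (b ^ suc i) 2≤b)))

logarithm-≥ : ∀ b I {n i} → 1 ≤ b → b ^ I ≤ n → n < b ^ suc i → I ≤ i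
logarithm-≥ b I {n} {i} 1≤b le lt = ≮⇒≥ λ i<I → <⇒≱ lt (≤-trans (^-monoʳ-≤ b {{>-nonZero 1≤b}} i<I) le)

-- Turns the bound on a cover into a power of two: t^q is 2^(jq), and since t = 2u the weight (1 +
-- 1/t)^(uE) is at most 2^E by `slow-growth`.
cancel-growth : ∀ g L j q u E t → t ≡ 2 ^ j → t ≡ 2 * u → 1 ≤ u →
  g * t ^ (u * E) ≤ 2 ^ L * t ^ q * suc t ^ (u * E) → g ≤ 2 ^ (L + j * q + E)
cancel-growth g L j q u E t t≡2^j t≡2u 1≤u bound = *-cancelʳ-≤ _ _ (t ^ (u * E)) {{>-nonZero (m^n>0 t {{>-nonZero 1≤t}} (u * E))}} (begin
  g * t ^ (u * E)                             ≤⟨ bound ⟩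
  2 ^ L * t ^ q * suc t ^ (u * E)             ≤⟨ *-monoʳ-≤ (2 ^ L * t ^ q) (subst (λ y → suc y ^ (u * E) ≤ 2 ^ E * y ^ (u * E)) (sym t≡2u) (slow-growth u E 1≤u)) ⟩
  2 ^ L * t ^ q * (2 ^ E * t ^ (u * E))       ≡⟨ *-assoc (2 ^ L * t ^ q) (2 ^ E) _ ⟨
  2 ^ L * t ^ q * 2 ^ E * t ^ (u * E)         ≡⟨ cong (λ y → 2 ^ L * y * 2 ^ E * t ^ (u * E)) (trans (cong (_^ q) t≡2^j) (^-*-assoc 2 j q)) ⟩
  2 ^ L * 2 ^ (j * q) * 2 ^ E * t ^ (u * E)   ≡⟨ cong (λ y → y * 2 ^ E * t ^ (u * E)) (^-distribˡ-+-* 2 L (j * q)) ⟨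
  2 ^ (L + j * q) * 2 ^ E * t ^ (u * E)       ≡⟨ cong (_* t ^ (u * E)) (^-distribˡ-+-* 2 (L + j * q) E) ⟨
  2 ^ (L + j * q + E) * t ^ (u * E)           ∎)
  where
  open ≤-Reasoning
  1≤t : 1 ≤ t
  1≤t = subst (1 ≤_) (sym t≡2^j) (m^n>0 2 j)

-- The parameters for 16^i ≤ n < 16^(i+1): t = 8^i, Δ = 3it and r = 288dmi, so that Δ = o(n), the
-- weight (1 + 1/t)^((r+1)2^n) is 2^(o(C)), and a cost of at most 8dL leaves room for C/(12mi) dead
-- vertices, each of which contributes a factor t = 2^(3i).
module Parameters (n d m i′ : ℕ) (1≤d : 1 ≤ d) (1≤m : 1 ≤ m)
  (lo : 16 ^ suc i′ ≤ n) (hi : n < 16 ^ suc (suc i′))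
  (h₁ : 3 * suc i′ * suc (4 * m) ≤ 2 ^ suc i′) (h₂ : 8 * d ≤ 2 ^ suc i′)
  (h₃ : 128 * m * suc (24 * d * (12 * m * suc i′)) ≤ 2 ^ suc i′) (h₄ : 8 * m ≤ 2 ^ suc i′) where

  open ≤-Reasoning

  i = suc i′
  x = 2 ^ i
  cb = centralBinom n
  z = 12 * m * i
  r = 24 * d * z
  j = 3 * i
  t = 2 ^ j
  Δ = t * j
  -- Half of t: `3 * i` computes to `suc (i′ + 2 * i)`, so that `t ≡ 2 * u` holds by `refl`.
  u = 2 ^ (i′ + 2 * i)

  1≤x : 1 ≤ x
  1≤x = m^n>0 2 i

  1≤t : 1 ≤ t
  1≤t = m^n>0 2 j

  1≤4m : 1 ≤ 4 * m
  1≤4m = *-mono-≤ (s≤s {0} {3} z≤n) 1≤m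

  1≤8m : 1 ≤ 8 * m
  1≤8m = *-mono-≤ (s≤s {0} {7} z≤n) 1≤m

  1≤z : 1 ≤ z
  1≤z = *-mono-≤ (*-mono-≤ (s≤s {0} {11} z≤n) 1≤m) (s≤s {0} {i′} z≤n)

  t≡x³ : t ≡ x * x * x
  t≡x³ = trans (cong (2 ^_) (*-comm 3 i)) (trans (sym (^-*-assoc 2 i 3)) (cube x))
    where
    cube : ∀ x → x * (x * (x * 1)) ≡ x * x * x
    cube = solve-∀

  16^i≡x⁴ : 16 ^ i ≡ x * x * x * x
  16^i≡x⁴ = trans (^-distribʳ-* i 4 4) (trans (cong₂ _*_ (^-distribʳ-* i 2 2) (^-distribʳ-* i 2 2)) (fourth x))
    where
    fourth : ∀ x → x * x * (x * x) ≡ x * x * x * x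
    fourth = solve-∀

  x≤n : x ≤ n
  x≤n = begin
    x                  ≡⟨ *-identityˡ x ⟨
    1 * x              ≤⟨ *-monoˡ-≤ x (*-mono-≤ (*-mono-≤ 1≤x 1≤x) 1≤x) ⟩
    x * x * x * x      ≡⟨ 16^i≡x⁴ ⟨
    16 ^ i             ≤⟨ lo ⟩
    n                  ∎

  n≤cb : n ≤ cb
  n≤cb = subst (_≤ cb) (nC1≡n n) (nCk≤centralBinom n 1)

  8m≤cb : 8 * m ≤ cb
  8m≤cb = ≤-trans h₄ (≤-trans x≤n n≤cb)

  -- Since t x = 16^i ≤ n, a factor x = 2^i is free to absorb j (4m + 1).
  Δ-small : Δ * suc (4 * m) ≤ n
  Δ-small = begin
    t * j * suc (4 * m)       ≡⟨ *-assoc t j _ ⟩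
    t * (j * suc (4 * m))     ≤⟨ *-monoʳ-≤ t h₁ ⟩
    t * x                     ≡⟨ cong (_* x) t≡x³ ⟩
    x * x * x * x             ≡⟨ 16^i≡x⁴ ⟨
    16 ^ i                    ≤⟨ lo ⟩
    n                         ∎

  Δ≤n : Δ ≤ n
  Δ≤n = ≤-trans (≤-trans (≤-reflexive (sym (*-identityʳ Δ))) (*-monoʳ-≤ Δ (s≤s {0} {4 * m} z≤n))) Δ-small

  8d≤Δ : 8 * d ≤ Δ
  8d≤Δ = begin
    8 * d              ≤⟨ h₂ ⟩
    x                  ≡⟨ *-identityˡ x ⟨
    1 * x              ≤⟨ *-monoˡ-≤ x (*-mono-≤ 1≤x 1≤x) ⟩
    x * x * x          ≡⟨ t≡x³ ⟨
    t                  ≡⟨ *-identityʳ t ⟨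
    t * 1              ≤⟨ *-monoʳ-≤ t (s≤s {0} {i′ + 2 * i} z≤n) ⟩
    Δ                  ∎

  -- As n < 16 x⁴, the number 8 x² is an upper bound for the square root of 4n + 1.
  2^n≤ : 2 ^ n ≤ 8 * (x * x) * cb
  2^n≤ = 2^n≤s*centralBinom n (8 * (x * x)) (begin
    4 * n + 1                    ≤⟨ +-monoʳ-≤ (4 * n) (s≤s {0} {3} z≤n) ⟩
    4 * n + 4                    ≡⟨ e₁ n ⟩
    4 * suc n                    ≤⟨ *-monoʳ-≤ 4 hi ⟩
    4 * (16 * 16 ^ i)            ≡⟨ cong (λ y → 4 * (16 * y)) 16^i≡x⁴ ⟩
    4 * (16 * (x * x * x * x))   ≡⟨ e₂ x ⟩
    sq (8 * (x * x))             ∎)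
    where
    e₁ : ∀ n → 4 * n + 4 ≡ 4 * suc n
    e₁ = solve-∀
    e₂ : ∀ x → 4 * (16 * (x * x * x * x)) ≡ (8 * (x * x)) * (8 * (x * x))
    e₂ = solve-∀

  -- The three numbers are `cb` divided by z, 4m and 8m, rounded down. They bound the number of
  -- chosen dead vertices, the excess of L over `cb`, and the exponent E - 1 of the weight.
  module _ (q q₄ q₈ : ℕ) (q-lo : q * z ≤ cb) (q-hi : cb < suc q * z)
    (q₄-lo : q₄ * (4 * m) ≤ cb) (q₄-hi : cb < suc q₄ * (4 * m))
    (q₈-lo : q₈ * (8 * m) ≤ cb) (q₈-hi : cb < suc q₈ * (8 * m)) where

    L = cb + q₄ + 2
    E = suc q₈

    small : ∀ (A : List (Subset n)) → Unique A → (∀ u → u ∈ A → ∑ A (adj u) < Δ) → length A ≤ L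
    small A A! sparse = ≤-pred (*-cancelˡ-< (4 * m) (length A) (suc L) (begin-strict
      4 * m * length A                                 ≤⟨ sparse-family-size 1≤4m (m+[n∸m]≡n Δ≤n) Δ-small A A! (λ b b∈ → <⇒≤ (sparse b b∈)) ⟩
      suc (4 * m) * cb + 4 * m * 2                     ≡⟨ +-assoc cb (4 * m * cb) (4 * m * 2) ⟩
      cb + (4 * m * cb + 4 * m * 2)                    <⟨ +-monoˡ-< (4 * m * cb + 4 * m * 2) q₄-hi ⟩
      suc q₄ * (4 * m) + (4 * m * cb + 4 * m * 2)      ≡⟨ e (4 * m) q₄ cb ⟩
      4 * m * suc L                                    ∎))
      where
      e : ∀ M q c → suc q * M + (M * c + M * 2) ≡ M * suc (c + q + 2)
      e = solve-∀

    L≤3cb : L ≤ 3 * cb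
    L≤3cb = begin
      cb + q₄ + 2              ≤⟨ +-mono-≤ (+-monoʳ-≤ cb (≤-trans (≤-trans (≤-reflexive (sym (*-identityʳ q₄))) (*-monoʳ-≤ q₄ 1≤4m)) q₄-lo))
                                           (≤-trans (≤-trans (m≤m+n 2 6) (*-monoʳ-≤ 8 1≤m)) 8m≤cb) ⟩
      cb + cb + cb             ≡⟨ e cb ⟩
      3 * cb                   ∎
      where
      e : ∀ c → c + c + c ≡ 3 * c
      e = solve-∀

    budget : 4 * d * (L + L) < suc q * r
    budget = begin-strict
      4 * d * (L + L)               ≤⟨ *-monoʳ-≤ (4 * d) (+-mono-≤ L≤3cb L≤3cb) ⟩
      4 * d * (3 * cb + 3 * cb)     ≡⟨ e₁ 4 3 d cb ⟩
      24 * d * cb                   <⟨ *-monoʳ-< (24 * d) {{>-nonZero (*-mono-≤ (s≤s {0} {23} z≤n) 1≤d)}} q-hi ⟩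
      24 * d * (suc q * z)          ≡⟨ e₂ (24 * d) (suc q) z ⟩
      suc q * r                     ∎
      where
      e₁ : ∀ a b d c → a * d * (b * c + b * c) ≡ a * (b + b) * d * c
      e₁ = solve-∀
      e₂ : ∀ a b c → a * (b * c) ≡ b * (a * c)
      e₂ = solve-∀

    -- Here 2^n is at most 8 x² · `cb` and `cb` is less than 8m E, while 2u = x³. The remaining
    -- factor x absorbs 128 m (r + 1) by `h₃`, where 128 = 2 · 8 · 8.
    Ψ-large : suc r * 2 ^ n ≤ u * E
    Ψ-large = *-cancelˡ-≤ 2 (begin
      2 * (suc r * 2 ^ n)                            ≤⟨ *-monoʳ-≤ 2 (*-monoʳ-≤ (suc r) (≤-trans 2^n≤ (*-monoʳ-≤ (8 * (x * x)) (<⇒≤ q₈-hi)))) ⟩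
      2 * (suc r * (8 * (x * x) * (E * (8 * m))))    ≡⟨ e₁ 2 8 (suc r) x E m ⟩
      x * x * (128 * m * suc r) * E                  ≤⟨ *-monoˡ-≤ E (*-monoʳ-≤ (x * x) h₃) ⟩
      x * x * x * E                                  ≡⟨ cong (_* E) t≡x³ ⟨
      2 * u * E                                      ≡⟨ *-assoc 2 u E ⟩
      2 * (u * E)                                    ∎)
      where
      e₁ : ∀ a b R x E m → a * (R * (b * (x * x) * (E * (b * m)))) ≡ x * x * (a * b * b * m * R) * E
      e₁ = solve-∀

    ℓ = L + j * q + E

    -- The slack `cb` is spent in eighths: two on q₄, three on the additive constants 2 and 1 by way
    -- of 8m ≤ `cb`, two on j q, and one on q₈.
    exponent : m * ℓ ≤ (m + 1) * cb
    exponent = *-cancelˡ-≤ 8 (begin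
      8 * (m * ℓ)                                                   ≡⟨ e₁ 2 4 3 m cb q₄ i q q₈ ⟩
      8 * m * cb + 2 * (q₄ * (4 * m)) + (2 * (8 * m) + 8 * m) + 2 * (q * z) + q₈ * (8 * m)
        ≤⟨ +-mono-≤ (+-mono-≤ (+-mono-≤ (+-monoʳ-≤ (8 * m * cb) (*-monoʳ-≤ 2 q₄-lo)) (+-mono-≤ (*-monoʳ-≤ 2 8m≤cb) 8m≤cb)) (*-monoʳ-≤ 2 q-lo)) q₈-lo ⟩
      8 * m * cb + 2 * cb + (2 * cb + cb) + 2 * cb + cb                    ≡⟨ e₂ m cb ⟩
      8 * ((m + 1) * cb)                                            ∎)
      where
      e₁ : ∀ b f h m c q₄ i q q₈ → b * f * (m * (c + q₄ + b + h * i * q + suc q₈)) ≡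
        b * f * m * c + b * (q₄ * (f * m)) + (b * (b * f * m) + b * f * m) + b * (q * (f * h * m * i)) + q₈ * (b * f * m)
      e₁ = solve-∀
      e₂ : ∀ m c → 8 * m * c + 2 * c + (2 * c + c) + 2 * c + c ≡ 8 * ((m + 1) * c)
      e₂ = solve-∀

    few-sparse : ∃ λ Gs → length Gs ≤ 2 ^ ℓ × (∀ (G : Family n) → AverageDegree≤ (4 * d) G → Any (G ≈F_) Gs)
    few-sparse = case sparse-cover d {t} {Δ} {r} {L} {q} 1≤t (growth j t Δ refl refl) 1≤d 8d≤Δ small budget {u * E} Ψ-large of
      λ (Gs , bound , cov) → Gs , cancel-growth (length Gs) L j q u E t refl refl (m^n>0 2 (i′ + 2 * i)) bound , cov

  sparse-families : ∃₂ λ Gs ℓ → length Gs ≤ 2 ^ ℓ × m * ℓ ≤ (m + 1) * cb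
    × (∀ (G : Family n) → AverageDegree≤ (4 * d) G → Any (G ≈F_) Gs)
  sparse-families = from-quotients (quotient cb z 1≤z) (quotient cb (4 * m) 1≤4m) (quotient cb (8 * m) 1≤8m)
    where
    Quotient : ℕ → Set
    Quotient y = ∃ λ q → q * y ≤ cb × cb < suc q * y
    from-quotients : Quotient z → Quotient (4 * m) → Quotient (8 * m) →
      ∃₂ λ Gs ℓ → length Gs ≤ 2 ^ ℓ × m * ℓ ≤ (m + 1) * cb × (∀ (G : Family n) → AverageDegree≤ (4 * d) G → Any (G ≈F_) Gs)
    from-quotients (q , lo , hi) (q₄ , lo₄ , hi₄) (q₈ , lo₈ , hi₈) = case few-sparse q q₄ q₈ lo hi lo₄ hi₄ lo₈ hi₈ of
      λ (Gs , few , cov) → Gs , ℓ q q₄ q₈ lo hi lo₄ hi₄ lo₈ hi₈ , few , exponent q q₄ q₈ lo hi lo₄ hi₄ lo₈ hi₈ , cov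


-- Sufficiently large n and the final assembly

threshold : ℕ → ℕ → ℕ → ℕ
threshold d m w = 3 * suc (4 * m) + 8 * d + 128 * m * suc (24 * d * (12 * m)) + 8 * m + 2 * ((2 * w + 2) * (m * w) + w)

upper-bound : ∀ P k (tree : IsTreePoset P) → 1 ≤ k →
  Σ (Fin (FinPoset.size P) → ℕ) (λ ℓ → (∀ x → ℓ x < k) × (∀ x y → _<P_ P x y → ℓ x < ℓ y)) →
  ∀ {n m N} → HasCard (PFreeFamily P n) (_≈PF_ {P} {n}) N →
  (∃₂ λ Gs ℓ → length Gs ≤ 2 ^ ℓ × m * ℓ ≤ (m + 1) * centralBinom n
    × (∀ (G : Family n) → AverageDegree≤ (4 * FinPoset.size P) G → Any (G ≈F_) Gs)) →
  N ^ m ≤ 2 ^ ((m + 1) * (k ∸ 1) * centralBinom n)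
upper-bound P k tree 1≤k leveling {n} {m} {N} card (Gs , ℓ , few , exponent , cov) = begin
  N ^ m                                       ≤⟨ ^-monoˡ-≤ m (count-≤ P k tree 1≤k leveling Gs card cov) ⟩
  (length Gs ^ (k ∸ 1)) ^ m                   ≤⟨ ^-monoˡ-≤ m (^-monoˡ-≤ (k ∸ 1) few) ⟩
  ((2 ^ ℓ) ^ (k ∸ 1)) ^ m                     ≡⟨ trans (^-*-assoc (2 ^ ℓ) (k ∸ 1) m) (^-*-assoc 2 ℓ _) ⟩
  2 ^ (ℓ * ((k ∸ 1) * m))                     ≤⟨ ^-monoʳ-≤ 2 (begin
      ℓ * ((k ∸ 1) * m)                         ≡⟨ e₁ ℓ (k ∸ 1) m ⟩
      (k ∸ 1) * (m * ℓ)                         ≤⟨ *-monoʳ-≤ (k ∸ 1) exponent ⟩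
      (k ∸ 1) * ((m + 1) * centralBinom n)      ≡⟨ e₂ (k ∸ 1) (m + 1) (centralBinom n) ⟩
      (m + 1) * (k ∸ 1) * centralBinom n        ∎) ⟩
  2 ^ ((m + 1) * (k ∸ 1) * centralBinom n)    ∎
  where
  open ≤-Reasoning
  e₁ : ∀ a b c → a * (b * c) ≡ b * (c * a)
  e₁ = solve-∀
  e₂ : ∀ a b c → a * (b * c) ≡ b * a * c
  e₂ = solve-∀

-- Each condition asks 2^i to dominate a constant or a linear function of i. The summands of the
-- threshold are their coefficients, so the single inequality `large` implies all of them.
module Eventually (d m w : ℕ) (1≤d : 1 ≤ d) (1≤m : 1 ≤ m) (i′ : ℕ) (K : ℕ) (K≡ : K ≡ threshold d m w) (large : K * suc (suc i′) ≤ 2 ^ suc i′) where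
  open ≤-Reasoning
  i = suc i′
  a₁ = 3 * suc (4 * m)
  a₂ = 8 * d
  a₃ = 128 * m * suc (24 * d * (12 * m))
  a₄ = 8 * m
  a₅ = 2 * ((2 * w + 2) * (m * w) + w)

  from : ∀ a → a ≤ threshold d m w → a * suc i ≤ 2 ^ i
  from a le = ≤-trans (*-monoˡ-≤ (suc i) (≤-trans le (≤-reflexive (sym K≡)))) large

  from′ : ∀ a → a ≤ threshold d m w → a ≤ 2 ^ i
  from′ a le = ≤-trans (≤-trans (≤-reflexive (sym (*-identityʳ a))) (*-monoʳ-≤ a (s≤s {0} {i} z≤n))) (from a le)

  h₁ : 3 * i * suc (4 * m) ≤ 2 ^ i
  h₁ = begin
    3 * i * suc (4 * m)     ≡⟨ e i (4 * m) ⟩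
    a₁ * i                  ≤⟨ *-monoʳ-≤ a₁ (n≤1+n i) ⟩
    a₁ * suc i              ≤⟨ from a₁ (≤-trans (m≤m+n a₁ a₂) (≤-trans (m≤m+n _ a₃) (≤-trans (m≤m+n _ a₄) (m≤m+n _ a₅)))) ⟩
    2 ^ i                   ∎
    where
    e : ∀ i m → 3 * i * suc m ≡ 3 * suc m * i
    e = solve-∀

  h₂ : 8 * d ≤ 2 ^ i
  h₂ = from′ a₂ (≤-trans (m≤n+m a₂ a₁) (≤-trans (m≤m+n _ a₃) (≤-trans (m≤m+n _ a₄) (m≤m+n _ a₅))))

  h₃ : 128 * m * suc (24 * d * (12 * m * i)) ≤ 2 ^ i
  h₃ = begin
    128 * m * suc (24 * d * (12 * m * i))                  ≤⟨ m≤m+n _ (128 * m * i + 128 * m * (24 * d * (12 * m))) ⟩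
    128 * m * suc (24 * d * (12 * m * i)) + (128 * m * i + 128 * m * (24 * d * (12 * m))) ≡⟨ e 128 24 12 m d i ⟩
    a₃ * suc i                                             ≤⟨ from a₃ (≤-trans (m≤n+m a₃ (a₁ + a₂)) (≤-trans (m≤m+n _ a₄) (m≤m+n _ a₅))) ⟩
    2 ^ i                                                  ∎
    where
    e : ∀ a b c m d i → a * m * suc (b * d * (c * m * i)) + (a * m * i + a * m * (b * d * (c * m))) ≡ a * m * suc (b * d * (c * m)) * suc i
    e = solve-∀

  h₄ : 8 * m ≤ 2 ^ i
  h₄ = from′ a₄ (≤-trans (m≤n+m a₄ (a₁ + a₂ + a₃)) (m≤m+n _ a₅))

  half : ∀ {n y} → 2 * y ≤ n → y ≤ n / 2
  half {n} {y} le = ≤-trans (≤-reflexive (sym (trans (cong (_/ 2) (*-comm 2 y)) (m*n/n≡m y 2)))) (/-mono-≤ le ≤-refl)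

  h₅ : ∀ {n} → 2 ^ i ≤ n → (2 * w + 2) * (m * w) + w ≤ n / 2
  h₅ le = half (≤-trans (from′ a₅ (m≤n+m a₅ (a₁ + a₂ + a₃ + a₄))) le)

-- The threshold does not involve the levelling of P, so the bound to be proved is a decidable
-- statement and the levelling may be assumed to exist.
eventually : ∀ P k → IsTreePoset P → HasHeight P k → ∀ {N} m → 1 ≤ m →
  ∀ K → K ≡ threshold (FinPoset.size P) m (k ∸ 1) → ∀ n → HasCard (PFreeFamily P n) (_≈PF_ {P} {n}) N →
  ∀ i → 4 * K ≤ i → 16 ^ i ≤ n → n < 16 ^ suc i →
  (2 ^ ((m ∸ 1) * (k ∸ 1) * centralBinom n) ≤ N ^ m) × (N ^ m ≤ 2 ^ ((m + 1) * (k ∸ 1) * centralBinom n))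
-- The threshold has a positive first summand, which excludes K = 0; then 4K ≤ i excludes i = 0, so
-- i has the form `suc i′`.
eventually P k tree height m 1≤m zero K≡ n card i 4K≤i lo hi = contradiction K≡ λ ()
eventually P k tree height m 1≤m (suc K) K≡ n card zero () lo hi
eventually P k tree height {N} m 1≤m K@(suc _) K≡ n card (suc i′) 4K≤i lo hi =
    lower-bound P k height 1≤k n m N card (≤-trans (m≤m+n _ w) wide) (≤-trans (m≤n+m w _) wide)
  , decidable-stable (_ ≤? _) (λ ¬le → Levels.¬¬-leveling P k (proj₂ height) λ leveling →
      ¬le (upper-bound P k tree 1≤k leveling {n} {m} card (Parameters.sparse-families n d m i′ 1≤d 1≤m lo hi h₁ h₂ h₃ h₄)))
  where
  d = FinPoset.size P
  w = k ∸ 1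
  1≤d : 1 ≤ d
  1≤d = proj₁ tree
  1≤k : 1 ≤ k
  1≤k = proj₂ height (Fin.fromℕ< 1≤d ∷ []) ([] ∷ [] , [] ∷ [])
  open Eventually d m w 1≤d 1≤m i′ K K≡ (linear≤2^ K (suc i′) 4K≤i)
  wide : (2 * w + 2) * (m * w) + w ≤ n / 2
  wide = h₅ (Parameters.x≤n n d m i′ 1≤d 1≤m lo hi h₁ h₂ h₃ h₄)

-- The o(1) is expressed by an error of 1/m for every m, and taking m-th powers clears the
-- denominator in the exponent.
theorem1p4 : (P : FinPoset) (k : ℕ) → IsTreePoset P → HasHeight P k →
    (count : ℕ → ℕ) → (∀ n → HasCard (PFreeFamily P n) (_≈PF_ {P} {n}) (count n)) →
    ∀ m → 1 ≤ m → ∃ λ N → ∀ n → N ≤ n →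
    (2 ^ ((m ∸ 1) * (k ∸ 1) * centralBinom n) ≤ count n ^ m)
    × (count n ^ m ≤ 2 ^ ((m + 1) * (k ∸ 1) * centralBinom n))
theorem1p4 P k tree height count card m 1≤m = large-n (threshold (FinPoset.size P) m (k ∸ 1)) refl
  where
  large-n : ∀ K → K ≡ threshold (FinPoset.size P) m (k ∸ 1) → ∃ λ N → ∀ n → N ≤ n →
    (2 ^ ((m ∸ 1) * (k ∸ 1) * centralBinom n) ≤ count n ^ m)
    × (count n ^ m ≤ 2 ^ ((m + 1) * (k ∸ 1) * centralBinom n))
  -- From n ≥ 16^(4K) the logarithm i of n to base 16 is at least 4K, which is what `linear≤2^`
  -- needs for K (i + 1) ≤ 2^i.
  large-n K K≡ = 16 ^ (4 * K) , λ n N≤n →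
    case logarithm 16 n (m≤m+n 2 14) (≤-trans (m^n>0 16 (4 * K)) N≤n) of λ (i , lo , hi) →
      eventually P k tree height m 1≤m K K≡ n (card n) i (logarithm-≥ 16 (4 * K) {n} {i} (s≤s z≤n) N≤n hi) lo hi
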